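{- There is a dynamic algorithm for \textsc{Point Line Cover} with parameter $k$ which handles point insertions in $O(g(k)^2)$ time, point deletions in $O(g(k)^3)$ time, and queries in $O(g(k)^{2g(k)+2})$ time, under the promise that there is a computable function $g$ such that (throughout the sequence of updates) the point set can always be covered by at most $g(k)$ lines.
   Context: \textsc{Point Line Cover} (parameter $k$): given a finite set $\mathcal P$ of points in the plane and an integer $k\in\mathbb N$, find a set of at most $k$ lines such that every point of $\mathcal P$ lies on at least one of them. A dynamic algorithm stores the current point set ($k$ is fixed), supports insertion and deletion of a single point, and on a query returns a set of at most $k$ lines covering the current point set, or reports that none exists. The function $g:\mathbb N\to\mathbb N$ is computable and known; no guarantees are required if at some time the current point set cannot be covered by $g(k)$ lines.
   Formalization: The points of the plane have rational coordinates (entered as numerators and denominators in lowest terms) and the covering lines have rational coefficients, instead of real ones; time is counted on a uniform-cost RAM with integer words. -}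

module Defs where

open import Data.Bool using (Bool; true; false; if_then_else_; _∧_)
open import Data.Fin using (Fin; toℕ)
open import Data.Integer using (ℤ; +_; -[1+_]; 0ℤ; -1ℤ)
import Data.Integer as ℤ
open import Data.List using (List; []; _∷_; length; lookup; filter)
open import Data.List.Membership.Propositional using (_∈_)
open import Data.List.Relation.Unary.Any using (Any)
open import Data.Nat using (ℕ; suc; _+_; _*_; _≤_; _⊔_)
import Data.Nat as ℕ
open import Data.Product using (Σ; ∃-syntax; _×_; _,_)
open import Data.Product.Properties using (≡-dec)
open import Data.Rational using (ℚ; 0ℚ; ↥_; ↧_; _/_)
import Data.Rational as ℚ
import Data.Rational.Properties as ℚ
open import Data.Sum using (_⊎_)
open import Data.Unit using (⊤)
open import Relation.Binary.Definitions using (DecidableEquality)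
open import Relation.Binary.PropositionalEquality using (_≡_)
open import Relation.Nullary using (¬_; ¬?; does)

------------------------------------------------------------------------
-- Points and lines

-- Coordinates are rational: the points are inputs of a machine and need a
-- finite description.
Point : Set
Point = ℚ × ℚ

_≟ᴾ_ : DecidableEquality Point
_≟ᴾ_ = ≡-dec ℚ._≟_ ℚ._≟_

-- The line { (x , y) | a x + b y = c }.
record Line : Set where
  constructor line
  field
    a b c    : ℚ
    nonzero  : ¬ (a ≡ 0ℚ × b ≡ 0ℚ)

_on_ : Point → Line → Set
(x , y) on ℓ = (a ℚ.* x) ℚ.+ (b ℚ.* y) ≡ c
  where open Line ℓ

-- A list stands for the set of its members; order and repetitions are
-- irrelevant to every notion below.
PointSet : Set
PointSet = List Point

insert : Point → PointSet → PointSet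
insert p P = p ∷ P

delete : Point → PointSet → PointSet
delete p P = filter (λ q → ¬? (q ≟ᴾ p)) P

IsCover : ℕ → PointSet → List Line → Set
IsCover k P ls = length ls ≤ k × (∀ {p} → p ∈ P → Any (p on_) ls)

CoverableBy : ℕ → PointSet → Set
CoverableBy k P = ∃[ ls ] IsCover k P ls

------------------------------------------------------------------------
-- The machine model: the random access machine with integer words, the
-- arithmetic operations +, -, *, ÷ and the uniform cost criterion.
--
-- Programs are structured (sequencing, conditionals, while loops). The memory
-- is a family of arrays; array names are constants of the program, so that a
-- program uses only finitely many arrays, and indices are computed.

Array : Set
Array = ℕ

Memory : Set
Memory = Array → ℤ → ℤ

infix 9 _[_]
infixl 7 _⊗_ _⊘_
infixl 6 _⊕_ _⊖_

data Exp : Set where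
  lit                 : ℤ → Exp
  _[_]                : Array → Exp → Exp
  _⊕_ _⊖_ _⊗_ _⊘_     : Exp → Exp → Exp

infix 5 _≺_ _≐_

data Test : Set where
  _≺_ _≐_ : Exp → Exp → Test

infix  4 _[_]≔_
infixr 3 _⨾_

data Program : Set where
  skip               : Program
  _[_]≔_             : Array → Exp → Exp → Program
  _⨾_                : Program → Program → Program
  when_then_else_end : Test → Program → Program → Program
  while_loop_end     : Test → Program → Program

-- Integer division with nonnegative remainder; division by zero yields zero.
_div_ : ℤ → ℤ → ℤ
i div (+ 0)         = 0ℤ
i div j@(+ (suc _)) = i ℤ./ j
i div j@(-[1+ _ ])  = i ℤ./ j

eval : Exp → Memory → ℤ
eval (lit z)   M = z
eval (A [ e ]) M = M A (eval e M)
eval (d ⊕ e)   M = eval d M ℤ.+ eval e M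
eval (d ⊖ e)   M = eval d M ℤ.- eval e M
eval (d ⊗ e)   M = eval d M ℤ.* eval e M
eval (d ⊘ e)   M = eval d M div eval e M

test : Test → Memory → Bool
test (d ≺ e) M = does (eval d M ℤ.<? eval e M)
test (d ≐ e) M = does (eval d M ℤ.≟ eval e M)

-- One unit of time for each constant, memory access and arithmetic operation,
-- regardless of the size of the integers.
costᴱ : Exp → ℕ
costᴱ (lit z)   = 1
costᴱ (A [ e ]) = 1 + costᴱ e
costᴱ (d ⊕ e)   = 1 + costᴱ d + costᴱ e
costᴱ (d ⊖ e)   = 1 + costᴱ d + costᴱ e
costᴱ (d ⊗ e)   = 1 + costᴱ d + costᴱ e
costᴱ (d ⊘ e)   = 1 + costᴱ d + costᴱ e

costᵀ : Test → ℕ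
costᵀ (d ≺ e) = 1 + costᴱ d + costᴱ e
costᵀ (d ≐ e) = 1 + costᴱ d + costᴱ e

_[_,_↦_] : Memory → Array → ℤ → ℤ → Memory
(M [ A , i ↦ v ]) B j =
  if does (B ℕ.≟ A) ∧ does (j ℤ.≟ i) then v else M B j

-- ⟨ p , M ⟩⇓⟨ M′ , t ⟩: started in memory M, the program p halts after time t
-- in memory M′.
infix 2 ⟨_,_⟩⇓⟨_,_⟩

data ⟨_,_⟩⇓⟨_,_⟩ : Program → Memory → Memory → ℕ → Set where

  ⇓-skip : ∀ {M} → ⟨ skip , M ⟩⇓⟨ M , 1 ⟩

  ⇓-assign : ∀ {A d e M} →
    ⟨ A [ d ]≔ e , M ⟩⇓⟨ M [ A , eval d M ↦ eval e M ] , 1 + costᴱ d + costᴱ e ⟩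

  ⇓-seq : ∀ {p q M M′ M″ s t} →
    ⟨ p , M ⟩⇓⟨ M′ , s ⟩ → ⟨ q , M′ ⟩⇓⟨ M″ , t ⟩ →
    ⟨ p ⨾ q , M ⟩⇓⟨ M″ , s + t ⟩

  ⇓-then : ∀ {b p q M M′ t} → test b M ≡ true →
    ⟨ p , M ⟩⇓⟨ M′ , t ⟩ →
    ⟨ when b then p else q end , M ⟩⇓⟨ M′ , costᵀ b + t ⟩

  ⇓-else : ∀ {b p q M M′ t} → test b M ≡ false →
    ⟨ q , M ⟩⇓⟨ M′ , t ⟩ →
    ⟨ when b then p else q end , M ⟩⇓⟨ M′ , costᵀ b + t ⟩

  ⇓-stop : ∀ {b p M} → test b M ≡ false →
    ⟨ while b loop p end , M ⟩⇓⟨ M , costᵀ b ⟩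

  ⇓-loop : ∀ {b p M M′ M″ s t} → test b M ≡ true →
    ⟨ p , M ⟩⇓⟨ M′ , s ⟩ → ⟨ while b loop p end , M′ ⟩⇓⟨ M″ , t ⟩ →
    ⟨ while b loop p end , M ⟩⇓⟨ M″ , costᵀ b + s + t ⟩

inp out : Array
inp = 0
out = 1

blank : Memory
blank A i = 0ℤ

loadℕ : ℕ → Memory → Memory
loadℕ n M = M [ inp , + 0 ↦ + n ]

-- A point is entered as the numerators and denominators of its coordinates,
-- in lowest terms.
loadPoint : Point → Memory → Memory
loadPoint (x , y) M =
  M [ inp , + 0 ↦ ↥ x ] [ inp , + 1 ↦ ↧ x ] [ inp , + 2 ↦ ↥ y ] [ inp , + 3 ↦ ↧ y ]

Computable : (ℕ → ℕ) → Set
Computable g = Σ Program λ p → ∀ n →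
  ∃[ M ] ∃[ t ] (⟨ p , loadℕ n blank ⟩⇓⟨ M , t ⟩) × M out (+ 0) ≡ + g n

------------------------------------------------------------------------
-- Dynamic algorithms

data Operation : Set where
  ins del : Point → Operation
  query   : Operation

-- The memory is kept from one operation to the next. Initialisation receives
-- the parameter k only.
record DynamicAlgorithm : Set where
  field
    onInit onInsert onDelete onQuery : Program

open DynamicAlgorithm public

programFor : DynamicAlgorithm → Operation → Program
programFor 𝒜 (ins p) = onInsert 𝒜
programFor 𝒜 (del p) = onDelete 𝒜
programFor 𝒜 query   = onQuery 𝒜

load : Operation → Memory → Memory
load (ins p) = loadPoint p
load (del p) = loadPoint p
load query M = M

after : Operation → PointSet → PointSet
after (ins p) = insert p
after (del p) = delete p
after query P = P

-- The lines ls are written as  n, a₀, b₀, c₀, a₁, b₁, c₁, …  with n = length ls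
-- and integer coefficients.
Writes : Memory → List Line → Set
Writes M ls = M out (+ 0) ≡ + length ls × (∀ (i : Fin (length ls)) →
    Line.a (lookup ls i) ≡ M out (+ (1 + 3 * toℕ i)) / 1
  × Line.b (lookup ls i) ≡ M out (+ (2 + 3 * toℕ i)) / 1
  × Line.c (lookup ls i) ≡ M out (+ (3 + 3 * toℕ i)) / 1)

ReportsNone : Memory → Set
ReportsNone M = M out (+ 0) ≡ -1ℤ

CorrectAnswer : ℕ → PointSet → Memory → Set
CorrectAnswer k P M =
    (∃[ ls ] Writes M ls × IsCover k P ls)
  ⊎ (ReportsNone M × ¬ CoverableBy k P)

Correct : ℕ → Operation → PointSet → Memory → Set
Correct k (ins p) P M = ⊤
Correct k (del p) P M = ⊤
Correct k query   P M = CorrectAnswer k P M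

-- The point set P and all later ones in the sequence are coverable by m lines.
AlwaysCoverableBy : ℕ → PointSet → List Operation → Set
AlwaysCoverableBy m P []       = CoverableBy m P
AlwaysCoverableBy m P (o ∷ os) = CoverableBy m P × AlwaysCoverableBy m (after o P) os

-- From memory M with current point set P, the algorithm processes the
-- operations one after another, each within its time limit, and answers all
-- queries correctly.
Serves : DynamicAlgorithm → (k : ℕ) → (limit : Operation → ℕ) →
         Memory → PointSet → List Operation → Set
Serves 𝒜 k limit M P []       = ⊤
Serves 𝒜 k limit M P (o ∷ os) = ∃[ M′ ] ∃[ t ]
    (⟨ programFor 𝒜 o , load o M ⟩⇓⟨ M′ , t ⟩)
  × t ≤ limit o
  × Correct k o P M′
  × Serves 𝒜 k limit M′ (after o P) os

boundFor : (insertion deletion querying : ℕ → ℕ) → Operation → ℕ → ℕ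
boundFor f₁ f₂ f₃ (ins p) = f₁
boundFor f₁ f₂ f₃ (del p) = f₂
boundFor f₁ f₂ f₃ query   = f₃

-- 𝒜 solves Point Line Cover under the promise g, handling insertions, deletions
-- and queries in time O(f₁(g(k))), O(f₂(g(k))) and O(f₃(g(k))), with an implied
-- constant independent of k and of the sequence of operations. The value
-- g(k) = 0 is replaced by 1, since otherwise bounds such as g(k)² would be 0.
SolvesPointLineCover : DynamicAlgorithm → (g f₁ f₂ f₃ : ℕ → ℕ) → Set
SolvesPointLineCover 𝒜 g f₁ f₂ f₃ = Σ ℕ λ C → ∀ k →
  ∃[ M₀ ] ∃[ t₀ ] (⟨ onInit 𝒜 , loadℕ k blank ⟩⇓⟨ M₀ , t₀ ⟩)
    × (∀ os → AlwaysCoverableBy (g k) [] os →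
       Serves 𝒜 k (λ o → C * boundFor f₁ f₂ f₃ o (1 ⊔ g k)) M₀ [] os)

{-# OPTIONS --safe #-}
module Submission where

open import Defs
open import Data.Bool using (Bool; true; false; if_then_else_; not; _∧_; _∨_)
open import Data.Empty using (⊥)
open import Data.Fin using (Fin; toℕ)
import Data.Fin as Fin
import Data.Fin.Properties as Fin
open import Data.Integer using (ℤ; +_; -[1+_]; 0ℤ; -1ℤ)
import Data.Integer as ℤ
import Data.Integer.DivMod as ℤ
import Data.Integer.Properties as ℤ
open import Data.Integer.Tactic.RingSolver using (solve-∀)
open import Data.List using (List; []; _∷_; length; lookup; filter; foldr; _++_; _ʳ++_)
open import Data.List.Membership.Propositional using (_∈_; _∉_)
open import Data.List.Membership.Propositional.Properties using (∈-filter⁺; ∈-filter⁻; ∈-lookup)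
open import Data.List.Properties using (++-identityʳ; length-ʳ++; ʳ++-defn; ʳ++-ʳ++)
open import Data.List.Relation.Unary.All using (All; []; _∷_)
import Data.List.Relation.Unary.All as All
open import Data.List.Relation.Unary.AllPairs using ([]; _∷_)
open import Data.List.Relation.Unary.Any using (Any; here; there; index)
import Data.List.Relation.Unary.Any as Any
import Data.List.Relation.Unary.Any.Properties as Any
open import Data.List.Relation.Unary.Unique.Propositional using (Unique)
import Data.List.Relation.Unary.Unique.Propositional.Properties as Unique
open import Data.Maybe using (Maybe; just; nothing)
open import Data.Nat using (ℕ; zero; suc; _+_; _*_; _∸_; _^_; _⊓_; _⊔_; _≤_; _<_; z≤n; s≤s; _≤?_; _<?_)
import Data.Nat as ℕ
import Data.Nat.DivMod as ℕ
import Data.Nat.Properties as ℕ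
open import Data.Nat.Properties using (≤-refl; ≤-trans; ≤-reflexive; +-mono-≤; *-monoʳ-≤; *-monoˡ-≤; *-mono-≤; m≤m+n; m≤n+m; *-identityʳ; *-distribʳ-+)
open import Data.Nat.Solver using (module +-*-Solver)
open import Data.Product using (Σ; ∃-syntax; _×_; _,_; proj₁; proj₂)
open import Data.Rational using (ℚ; 0ℚ; 1ℚ; mkℚ; ↥_; ↧_; toℚᵘ)
import Data.Rational as ℚ
import Data.Rational.Properties as ℚ
import Data.Rational.Solver as ℚ
open import Data.Rational.Unnormalised using (mkℚᵘ; *≡*)
import Data.Rational.Unnormalised.Properties as ℚᵘ
open import Data.Sum using (_⊎_; inj₁; inj₂)
open import Data.Unit using (tt)
open import Function using (_∘_; id)
open import Relation.Binary.Definitions using (tri<; tri≈; tri>)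
open import Relation.Binary.PropositionalEquality using (_≡_; _≢_; refl; sym; trans; cong; cong₂; subst; subst₂; module ≡-Reasoning)
open import Relation.Nullary using (¬_; ¬?; Dec; yes; no; does; contradiction)
open import Relation.Nullary.Decidable using (dec-true; dec-false; map′)
open import Relation.Unary using (Decidable)

-- Write m for g(k). A line with more than m points of a set coverable by m lines
-- belongs to every such cover. The algorithm keeps at most m classes, each
-- consisting of more than m points of one such line, and a bucket of remaining
-- points of which no line contains more than m, hence at most m² points. A new
-- point creates a class only on a line through itself; these lines are counted
-- by slope in a table. A deletion may shrink a class to m points, which are then
-- inserted anew. For a query, m + 1 points of each class and the remaining
-- points form a kernel of at most 3m² points. With j = min(k, m) lines available,
-- each kernel point not yet covered is assigned to one of j slots, and two points
-- determine the line of a slot; there are j^(2j) ways, and j^(2j-1) up to symmetry.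

-- Programs and their running time

-- A new point raises counts only on lines through itself, so testing these keeps the bucket of
-- remaining points free of lines with more than m points. That such lines occur in every cover by m
-- lines has two uses: there are at most m of them, so a free class exists when one is needed; and
-- the m + 1 kernel points of a class force its line into every cover of the kernel by at most m
-- lines. The obstacle to constant time per table access is that slopes are fractions, and reducing
-- a fraction is not one machine operation. A slope is therefore rounded, at a precision fine enough
-- to separate the slopes at hand, to an integer key. Keys are sparse and unbounded, so the table is
-- reset only where it is about to be used. A trial costs, up to a constant, at most m for the slots
-- times 3m² for the kernel points. With m^(2m) trials the exponent would be 2m + 3; fixing the slot
-- of the first point brings it down to 2m + 2.

upd : (ℤ → ℤ) → ℤ → ℤ → ℤ → ℤ
upd f i v j = if does (j ℤ.≟ i) then v else f j

upd-same : ∀ f {i v j} → j ≡ i → upd f i v j ≡ v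
upd-same f {i} {v} {j} eq rewrite dec-true (j ℤ.≟ i) eq = refl

upd-other : ∀ f {i v j} → j ≢ i → upd f i v j ≡ f j
upd-other f {i} {v} {j} neq rewrite dec-false (j ℤ.≟ i) neq = refl

-- An over-approximation read off the program text. It computes, so the conditions that a program
-- spares an array are mostly discharged by `refl`.
writes : Program → Array → Bool
writes skip _                         = false
writes (A [ _ ]≔ _) B                 = does (B ℕ.≟ A)
writes (p ⨾ q) B                      = writes p B ∨ writes q B
writes (when _ then p else q end) B   = writes p B ∨ writes q B
writes (while _ loop p end) B         = writes p B

record Frame (p : Program) (M M′ : Memory) : Set where
  constructor framed
  field same : ∀ A → writes p A ≡ false → ∀ i → M′ A i ≡ M A i
open Frame

∨-falseˡ : ∀ {a b} → a ∨ b ≡ false → a ≡ false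
∨-falseˡ {false} _ = refl

∨-falseʳ : ∀ {a b} → a ∨ b ≡ false → b ≡ false
∨-falseʳ {false} eq = eq

frame-refl : ∀ {p M} → Frame p M M
frame-refl .same _ _ _ = refl

frame-trans : ∀ {p M M′ M″} → Frame p M M′ → Frame p M′ M″ → Frame p M M″
frame-trans f g .same A w i = trans (same g A w i) (same f A w i)

frame : ∀ {p M M′ t} → ⟨ p , M ⟩⇓⟨ M′ , t ⟩ → Frame p M M′
frame d = framed (go d)
  where
  go : ∀ {p M M′ t} → ⟨ p , M ⟩⇓⟨ M′ , t ⟩ → ∀ A → writes p A ≡ false → ∀ i → M′ A i ≡ M A i
  go ⇓-skip _ _ _ = refl
  go ⇓-assign B w i rewrite w = refl
  go (⇓-seq d e) B w i = trans (go e B (∨-falseʳ w) i) (go d B (∨-falseˡ w) i)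
  go (⇓-then _ d) B w i = go d B (∨-falseˡ w) i
  go (⇓-else _ d) B w i = go d B (∨-falseʳ w) i
  go (⇓-stop _) B w i = refl
  go (⇓-loop _ d e) B w i = trans (go e B w i) (go d B w i)

-- The test of a loop is counted twice: once for the iterations and once for the final failing test.
-- Both branches of a conditional are added, which avoids a maximum.
weight : Program → ℕ
weight skip                        = 1
weight (A [ d ]≔ e)                = 1 + costᴱ d + costᴱ e
weight (p ⨾ q)                     = weight p + weight q
weight (when b then p else q end)  = costᵀ b + (weight p + weight q)
weight (while b loop p end)        = costᵀ b + costᵀ b + weight p

record Scale : Set where
  constructor scale
  field
    size : ℕ
    pos  : 1 ≤ size
open Scale

unit : Scale
unit = scale 1 ≤-refl

infixl 7 _·_
_·_ : Scale → Scale → Scale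
X · Y = scale (size X * size Y) (*-mono-≤ (pos X) (pos Y))

≤-scale : ∀ n X → n ≤ n * size X
≤-scale n X = ≤-trans (≤-reflexive (sym (*-identityʳ n))) (*-monoʳ-≤ n (pos X))

-- If every loop nest of p makes at most X iterations in total, then p takes
-- time at most weight p · X; the constant is thus a function of the text of p.
record Runs (p : Program) (M : Memory) (X : Scale) (Q : Memory → Set) : Set where
  constructor runs
  field
    {final} : Memory
    {time}  : ℕ
    halts   : ⟨ p , M ⟩⇓⟨ final , time ⟩
    within  : time ≤ weight p * size X
    post    : Q final

run-mono : ∀ {p M X Y Q} → size X ≤ size Y → Runs p M X Q → Runs p M Y Q
run-mono {p} X≤Y (runs d t q) = runs d (≤-trans t (*-monoʳ-≤ (weight p) X≤Y)) q

run-post : ∀ {p M X Q R} → (∀ {M′} → Frame p M M′ → Q M′ → R M′) → Runs p M X Q → Runs p M X R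
run-post f (runs d t q) = runs d t (f (frame d) q)

run-skip : ∀ {M X Q} → Q M → Runs skip M X Q
run-skip {X = X} q = runs ⇓-skip (≤-scale 1 X) q

run-seq : ∀ {p q M X Q R} → Runs p M X Q →
          (∀ {M′} → Frame p M M′ → Q M′ → Runs q M′ X R) → Runs (p ⨾ q) M X R
run-seq {p} {q} {X = X} (runs d s x) k with k (frame d) x
... | runs e t y = runs (⇓-seq d e)
  (≤-trans (+-mono-≤ s t) (≤-reflexive (sym (*-distribʳ-+ (size X) (weight p) (weight q))))) y

exec : Program → Memory → Memory
exec (A [ d ]≔ e) M = M [ A , eval d M ↦ eval e M ]
exec (p ⨾ q) M      = exec q (exec p M)
exec _ M            = M

straight : Program → Bool
straight skip         = true
straight (_ [ _ ]≔ _) = true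
straight (p ⨾ q)      = straight p ∧ straight q
straight _            = false

run-straight : ∀ p {M X} → straight p ≡ true → Runs p M X (_≡ exec p M)
run-straight skip _ = run-skip refl
run-straight (A [ d ]≔ e) {X = X} _ = runs ⇓-assign (≤-scale _ X) refl
run-straight (p ⨾ q) s with straight p in sp
... | true = run-seq (run-straight p sp) λ { _ refl → run-straight q s }

run-block : ∀ {p M X} {Q : Memory → Set} → straight p ≡ true → Q (exec p M) → Runs p M X Q
run-block {p} {Q = Q} s q = run-post (λ _ eq → subst Q (sym eq) q) (run-straight p s)

run-when : ∀ {b p q M X Q} → (test b M ≡ true → Runs p M X Q) → (test b M ≡ false → Runs q M X Q) →
           Runs (when b then p else q end) M X Q
run-when {b} {p} {q} {M} {X} f g with test b M in eq
... | true with f refl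
...   | runs d t x = runs (⇓-then eq d)
  (≤-trans (+-mono-≤ (≤-scale (costᵀ b) X) (≤-trans t (*-monoˡ-≤ (size X) (m≤m+n (weight p) (weight q)))))
    (≤-reflexive (sym (*-distribʳ-+ (size X) (costᵀ b) (weight p + weight q))))) x
run-when {b} {p} {q} {M} {X} f g | false with g refl
...   | runs d t x = runs (⇓-else eq d)
  (≤-trans (+-mono-≤ (≤-scale (costᵀ b) X) (≤-trans t (*-monoˡ-≤ (size X) (m≤n+m (weight q) (weight p)))))
    (≤-reflexive (sym (*-distribʳ-+ (size X) (costᵀ b) (weight p + weight q))))) x

does-true : ∀ {A : Set} (a? : Dec A) → does a? ≡ true → A
does-true (yes a) _ = a

does-false : ∀ {A : Set} (a? : Dec A) → does a? ≡ false → ¬ A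
does-false (no ¬a) _ = ¬a

run-≐ : ∀ {d e p q M X Q} → (eval d M ≡ eval e M → Runs p M X Q) → (eval d M ≢ eval e M → Runs q M X Q) →
        Runs (when d ≐ e then p else q end) M X Q
run-≐ f g = run-when (λ eq → f (does-true (_ ℤ.≟ _) eq)) (λ eq → g (does-false (_ ℤ.≟ _) eq))

run-≺ : ∀ {d e p q M X Q} → (eval d M ℤ.< eval e M → Runs p M X Q) →
    (¬ (eval d M ℤ.< eval e M) → Runs q M X Q) →
        Runs (when d ≺ e then p else q end) M X Q
run-≺ f g = run-when (λ eq → f (does-true (_ ℤ.<? _) eq)) (λ eq → g (does-false (_ ℤ.<? _) eq))

$ : Array → Exp
$ A = A [ lit 0ℤ ]

infix 4 _≔_
_≔_ : Array → Exp → Program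
A ≔ e = A [ lit 0ℤ ]≔ e

-- for I body  runs the body with I = n - 1, …, 1, 0, where n is the value of I
-- at the start.
for : Array → Program → Program
for I body = while lit 0ℤ ≺ $ I loop (I ≔ $ I ⊖ lit (+ 1)) ⨾ body end

loop-bound : ∀ c w n (X Y : Scale) → n ≤ size Y → n * (c + w * size X) + c ≤ (c + c + w) * size (X · Y)
loop-bound c w n X Y n≤y = begin
  n * (c + w * x) + c                 ≤⟨ +-mono-≤ (*-mono-≤ n≤y (+-mono-≤ (≤-scale c X) (≤-refl {w * x})))
      (≤-scale c (X · Y)) ⟩
  y * (c * x + w * x) + c * (x * y)   ≡⟨ solve 4
      (λ c w x y → y :* (c :* x :+ w :* x) :+ c :* (x :* y) := (c :+ c :+ w) :* (x :* y)) refl c w x y ⟩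
  (c + c + w) * (x * y)               ∎
  where
  open ℕ.≤-Reasoning
  open +-*-Solver
  x = size X
  y = size Y

-- `Inv n` holds with n iterations to go. It must survive writes to the counter cell because the
-- decrement precedes the body. Each iteration also receives the frame back to `M₀`, so facts about
-- arrays that the loop does not write can stay out of the invariant.
run-while : ∀ {I body X} (Inv : ℕ → Memory → Set) (M₀ : Memory) → writes body I ≡ false →
  (∀ {n M v} → Inv n M → Inv n (M [ I , 0ℤ ↦ v ])) →
  (∀ {n M} → Frame (for I body) M₀ M → M I 0ℤ ≡ + n → Inv (suc n) M → Runs body M X (Inv n)) →
  ∀ n {M} → Frame (for I body) M₀ M → M I 0ℤ ≡ + n → Inv n M →
  ∃[ M′ ] ∃[ t ] (⟨ for I body , M ⟩⇓⟨ M′ , t ⟩)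
    × t ≤ n * (4 + weight (I ≔ $ I ⊖ lit (+ 1) ⨾ body) * size X) + 4 × Inv 0 M′
run-while {I} {body} {X} Inv M₀ wI st step zero {M} fr eq inv =
  M , 4 , ⇓-stop (dec-false (0ℤ ℤ.<? M I 0ℤ) (λ lt → ℤ.<-irrefl refl (subst (0ℤ ℤ.<_) eq lt))) , ≤-refl , inv
run-while {I} {body} {X} Inv M₀ wI st step (suc n) {M} fr eq inv
  with run-seq {p = dec} {R = Good n}
      (run-block {p = dec} {X = X} {Q = λ M′ → M′ I 0ℤ ≡ + n × Inv (suc n) M′} refl
         (trans (self I {M}) (cong (ℤ._- + 1) eq) , st inv))
         (λ {M′} fd (e , v) → run-post {Q = Inv n} {R = Good n} (λ fb v′ → frame-trans fr
             (framed λ A w i → trans (same fb A (∨-falseʳ {does (A ℕ.≟ I)} w) i) (same fd A (∨-falseˡ w) i)) ,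
                 trans (same fb I wI 0ℤ) e , v′)
           (step (frame-trans fr (framed λ A w → same fd A (∨-falseˡ w))) e v))
  where
  dec = I ≔ $ I ⊖ lit (+ 1)
  Good : ℕ → Memory → Set
  Good n M′ = Frame (for I body) M₀ M′ × M′ I 0ℤ ≡ + n × Inv n M′
  self : ∀ I {M v} → (M [ I , 0ℤ ↦ v ]) I 0ℤ ≡ v
  self I rewrite dec-true (I ℕ.≟ I) refl = refl
... | runs d t (f , e , v) with run-while {X = X} Inv M₀ wI st step n f e v
... | M′ , t′ , d′ , le , v′ = M′ , _ , ⇓-loop
    (dec-true (0ℤ ℤ.<? M I 0ℤ) (subst (0ℤ ℤ.<_) (sym eq) (ℤ.+<+ (s≤s z≤n)))) d d′
  , ≤-trans (+-mono-≤ (+-mono-≤ (≤-refl {4}) t) le)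
      (≤-reflexive (sym (ℕ.+-assoc (4 + weight (I ≔ $ I ⊖ lit (+ 1) ⨾ body) * size X) _ 4))) , v′

run-for : ∀ {I body M₀ X} (Y : Scale) (Inv : ℕ → Memory → Set) → writes body I ≡ false →
  (∀ {n M v} → Inv n M → Inv n (M [ I , 0ℤ ↦ v ])) →
  (∀ {n M} → Frame (for I body) M₀ M → M I 0ℤ ≡ + n → Inv (suc n) M → Runs body M X (Inv n)) →
  ∀ n → M₀ I 0ℤ ≡ + n → n ≤ size Y → Inv n M₀ → Runs (for I body) M₀ (X · Y) (Inv 0)
run-for {I} {body} {M₀} {X} Y Inv wI st step n eq n≤Y inv
  with run-while {X = X} Inv M₀ wI st step n frame-refl eq inv
... | M′ , t , d , le , v = runs d (≤-trans le (loop-bound 4 (weight (I ≔ $ I ⊖ lit (+ 1) ⨾ body)) n X Y n≤Y)) v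

-- The counter runs down, so with `r` still to come it equals `length r`, the position of the
-- current element in the sense of `At`. A loop over array positions thus traverses the list from
-- its head, with the processed part reversed in `d`.
run-each : ∀ {A : Set} {I body M₀ X} (Y : Scale) (l : List A) (Inv : (done rest : List A) → Memory → Set) →
  writes body I ≡ false →
  (∀ {d r M v} → Inv d r M → Inv d r (M [ I , 0ℤ ↦ v ])) →
  (∀ {d x r M} → Frame (for I body) M₀ M → M I 0ℤ ≡ + length r → d ʳ++ (x ∷ r) ≡ l →
     Inv d (x ∷ r) M → Runs body M X (Inv (x ∷ d) r)) →
  M₀ I 0ℤ ≡ + length l → length l ≤ size Y → Inv [] l M₀ →
  Runs (for I body) M₀ (X · Y) (λ M → ∃[ d ] (d ʳ++ [] ≡ l × Inv d [] M))
run-each {A} {I} {body} {M₀} {X} Y l Inv wI st step eq l≤Y inv =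
  run-post fin (run-for Y Inv′ wI (λ { (d , r , e , e′ , v) → d , r , e , e′ , st v }) body-ok (length l) eq
      l≤Y ([] , l , refl , refl , inv))
  where
  Inv′ : ℕ → Memory → Set
  Inv′ n M = ∃[ d ] ∃[ r ] (length r ≡ n × d ʳ++ r ≡ l × Inv d r M)
  fin : ∀ {M′} → Frame (for I body) M₀ M′ → Inv′ 0 M′ → ∃[ d ] (d ʳ++ [] ≡ l × Inv d [] M′)
  fin _ (d , [] , _ , e , v) = d , e , v
  body-ok : ∀ {n M} → Frame (for I body) M₀ M → M I 0ℤ ≡ + n → Inv′ (suc n) M → Runs body M X (Inv′ n)
  body-ok fr eq (d , x ∷ r , refl , e , v) = run-post (λ _ v → x ∷ d , r , refl , e , v) (step fr eq e v)

-- The program that computes g is run on arrays shifted by base, apart from those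
-- of the algorithm.
base : ℕ
base = 60

shiftᴱ : Exp → Exp
shiftᴱ (lit z)   = lit z
shiftᴱ (A [ e ]) = (base + A) [ shiftᴱ e ]
shiftᴱ (d ⊕ e)   = shiftᴱ d ⊕ shiftᴱ e
shiftᴱ (d ⊖ e)   = shiftᴱ d ⊖ shiftᴱ e
shiftᴱ (d ⊗ e)   = shiftᴱ d ⊗ shiftᴱ e
shiftᴱ (d ⊘ e)   = shiftᴱ d ⊘ shiftᴱ e

shiftᵀ : Test → Test
shiftᵀ (d ≺ e) = shiftᴱ d ≺ shiftᴱ e
shiftᵀ (d ≐ e) = shiftᴱ d ≐ shiftᴱ e

shift : Program → Program
shift skip                       = skip
shift (A [ d ]≔ e)               = (base + A) [ shiftᴱ d ]≔ shiftᴱ e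
shift (p ⨾ q)                    = shift p ⨾ shift q
shift (when b then p else q end) = when shiftᵀ b then shift p else shift q end
shift (while b loop p end)       = while shiftᵀ b loop shift p end

record Shadow (M N : Memory) : Set where
  constructor shadow
  field at : ∀ A i → N (base + A) i ≡ M A i

shift-eval : ∀ {M N} → Shadow M N → ∀ e → eval (shiftᴱ e) N ≡ eval e M
shift-eval sh (lit z)   = refl
shift-eval sh (A [ e ]) rewrite shift-eval sh e = Shadow.at sh A _
shift-eval sh (d ⊕ e)   = cong₂ ℤ._+_ (shift-eval sh d) (shift-eval sh e)
shift-eval sh (d ⊖ e)   = cong₂ ℤ._-_ (shift-eval sh d) (shift-eval sh e)
shift-eval sh (d ⊗ e)   = cong₂ ℤ._*_ (shift-eval sh d) (shift-eval sh e)
shift-eval sh (d ⊘ e)   = cong₂ _div_ (shift-eval sh d) (shift-eval sh e)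

shift-test : ∀ {M N} → Shadow M N → ∀ b → test (shiftᵀ b) N ≡ test b M
shift-test sh (d ≺ e) rewrite shift-eval sh d | shift-eval sh e = refl
shift-test sh (d ≐ e) rewrite shift-eval sh d | shift-eval sh e = refl

shift-update : ∀ {M N} → Shadow M N → ∀ A {i i′ v v′} → i′ ≡ i → v′ ≡ v →
  Shadow (M [ A , i ↦ v ]) (N [ base + A , i′ ↦ v′ ])
Shadow.at (shift-update sh A {i} {v = v} refl refl) B j =
  cong (if does (B ℕ.≟ A) ∧ does (j ℤ.≟ i) then v else_) (Shadow.at sh B j)

-- The shifted tests read shifted arrays only, hence take the same branches. The time stays
-- existential because initialisation has no time limit.
shift-run : ∀ {p M M′ t N} → ⟨ p , M ⟩⇓⟨ M′ , t ⟩ → Shadow M N →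
  ∃[ N′ ] ∃[ t′ ] (⟨ shift p , N ⟩⇓⟨ N′ , t′ ⟩) × Shadow M′ N′
shift-run {N = N} ⇓-skip sh = N , 1 , ⇓-skip , sh
shift-run (⇓-assign {A} {d} {e}) sh = _ , _ , ⇓-assign , shift-update sh A (shift-eval sh d) (shift-eval sh e)
shift-run (⇓-seq d e) sh with shift-run d sh
... | _ , _ , d′ , sh′ with shift-run e sh′
... | _ , _ , e′ , sh″ = _ , _ , ⇓-seq d′ e′ , sh″
shift-run (⇓-then {b} eq d) sh with shift-run d sh
... | _ , _ , d′ , sh′ = _ , _ , ⇓-then (trans (shift-test sh b) eq) d′ , sh′
shift-run (⇓-else {b} eq d) sh with shift-run d sh
... | _ , _ , d′ , sh′ = _ , _ , ⇓-else (trans (shift-test sh b) eq) d′ , sh′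
shift-run (⇓-stop {b} eq) sh = _ , _ , ⇓-stop (trans (shift-test sh b) eq) , sh
shift-run (⇓-loop {b} eq d e) sh with shift-run d sh
... | _ , _ , d′ , sh′ with shift-run e sh′
... | _ , _ , e′ , sh″ = _ , _ , ⇓-loop (trans (shift-test sh b) eq) d′ e′ , sh″

shift-writes : ∀ p {A} → A < base → writes (shift p) A ≡ false
shift-writes skip lt = refl
shift-writes (B [ _ ]≔ _) {A} lt = dec-false (A ℕ.≟ base + B) λ { refl → ℕ.<⇒≱ lt (m≤m+n base B) }
shift-writes (p ⨾ q) lt = cong₂ _∨_ (shift-writes p lt) (shift-writes q lt)
shift-writes (when _ then p else q end) lt = cong₂ _∨_ (shift-writes p lt) (shift-writes q lt)
shift-writes (while _ loop p end) lt = shift-writes p lt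

-- Geometry in rational and in integer coordinates

ι : ℤ → ℚ
ι z = z ℚ./ 1

ι-injective : ∀ {a b} → ι a ≡ ι b → a ≡ b
ι-injective {a} {b} eq with ℚ.fromℚᵘ-injective {mkℚᵘ a 0} {mkℚᵘ b 0} eq
... | *≡* e = trans (sym (ℤ.*-identityʳ a)) (trans e (ℤ.*-identityʳ b))

ι-+ : ∀ a b → ι a ℚ.+ ι b ≡ ι (a ℤ.+ b)
ι-+ a b = ℚ.toℚᵘ-injective (ℚᵘ.≃-trans (ℚ.toℚᵘ-homo-+ (ι a) (ι b))
  (ℚᵘ.≃-trans (ℚᵘ.+-cong (ℚ.toℚᵘ-fromℚᵘ (mkℚᵘ a 0)) (ℚ.toℚᵘ-fromℚᵘ (mkℚᵘ b 0)))
  (ℚᵘ.≃-trans (*≡* (lem a b)) (ℚᵘ.≃-sym (ℚ.toℚᵘ-fromℚᵘ (mkℚᵘ (a ℤ.+ b) 0))))))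
  where
  lem : ∀ a b → (a ℤ.* + 1 ℤ.+ b ℤ.* + 1) ℤ.* + 1 ≡ (a ℤ.+ b) ℤ.* + 1
  lem = solve-∀

ι-* : ∀ a b → ι a ℚ.* ι b ≡ ι (a ℤ.* b)
ι-* a b = ℚ.toℚᵘ-injective (ℚᵘ.≃-trans (ℚ.toℚᵘ-homo-* (ι a) (ι b))
  (ℚᵘ.≃-trans (ℚᵘ.*-cong (ℚ.toℚᵘ-fromℚᵘ (mkℚᵘ a 0)) (ℚ.toℚᵘ-fromℚᵘ (mkℚᵘ b 0)))
  (ℚᵘ.≃-trans (*≡* refl) (ℚᵘ.≃-sym (ℚ.toℚᵘ-fromℚᵘ (mkℚᵘ (a ℤ.* b) 0))))))

clear-denominator : ∀ x → x ℚ.* ι (↧ x) ≡ ι (↥ x)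
clear-denominator x@(mkℚ n d _) = ℚ.toℚᵘ-injective (ℚᵘ.≃-trans (ℚ.toℚᵘ-homo-* x (ι (+ suc d)))
  (ℚᵘ.≃-trans (ℚᵘ.*-cong (ℚᵘ.≃-refl {toℚᵘ x}) (ℚ.toℚᵘ-fromℚᵘ (mkℚᵘ (+ suc d) 0)))
  (ℚᵘ.≃-trans (*≡* lem) (ℚᵘ.≃-sym (ℚ.toℚᵘ-fromℚᵘ (mkℚᵘ n 0))))))
  where
  lem : (n ℤ.* + suc d) ℤ.* + 1 ≡ n ℤ.* + suc (d ℕ.* 1)
  lem = trans (ℤ.*-identityʳ _) (cong (λ e → n ℤ.* + suc e) (sym (ℕ.*-identityʳ d)))

ℚ-zero-factor : ∀ {a b} → a ≢ 0ℚ → a ℚ.* b ≡ 0ℚ → b ≡ 0ℚ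
ℚ-zero-factor {a} {b} a≢0 eq = begin
  b                       ≡⟨ sym (ℚ.*-identityˡ b) ⟩
  1ℚ ℚ.* b                ≡⟨ cong (ℚ._* b) (sym (ℚ.*-inverseˡ a)) ⟩
  (ℚ.1/ a ℚ.* a) ℚ.* b    ≡⟨ ℚ.*-assoc (ℚ.1/ a) a b ⟩
  ℚ.1/ a ℚ.* (a ℚ.* b)    ≡⟨ cong (ℚ.1/ a ℚ.*_) eq ⟩
  ℚ.1/ a ℚ.* 0ℚ           ≡⟨ ℚ.*-zeroʳ (ℚ.1/ a) ⟩
  0ℚ                      ∎
  where
  open ≡-Reasoning
  instance _ = ℚ.≢-nonZero a≢0

ℚ-diff : ∀ {a b} → a ≡ b → a ℚ.- b ≡ 0ℚ
ℚ-diff {a} refl = ℚ.+-inverseʳ a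

ℚ-undiff : ∀ {a b} → a ℚ.- b ≡ 0ℚ → a ≡ b
ℚ-undiff {a} {b} eq = trans (solve 2 (λ a b → a := (a :- b) :+ b) refl a b)
  (trans (cong (ℚ._+ b) eq) (ℚ.+-identityˡ b))
  where open ℚ.+-*-Solver

ℚ-cancel : ∀ {a b c} → a ≢ 0ℚ → b ℚ.* a ≡ c ℚ.* a → b ≡ c
ℚ-cancel {a} {b} {c} a≢0 eq = ℚ-undiff (ℚ-zero-factor a≢0
  (trans (solve 3 (λ a b c → a :* (b :- c) := b :* a :- c :* a) refl a b c) (ℚ-diff eq)))
  where open ℚ.+-*-Solver

-- (X : Y : D) are homogeneous coordinates of a point.
abstract
  X Y D : Point → ℤ
  X (x , y) = ↥ x ℤ.* ↧ y
  Y (x , y) = ↥ y ℤ.* ↧ x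
  D (x , y) = ↧ x ℤ.* ↧ y

  X-def : ∀ x y → X (x , y) ≡ ↥ x ℤ.* ↧ y
  X-def x y = refl

  Y-def : ∀ x y → Y (x , y) ≡ ↥ y ℤ.* ↧ x
  Y-def x y = refl

  D-def : ∀ x y → D (x , y) ≡ ↧ x ℤ.* ↧ y
  D-def x y = refl

Coefs : Set
Coefs = ℤ × ℤ × ℤ

_onᶻ_ : Point → Coefs → Set
p onᶻ (a , b , c) = a ℤ.* X p ℤ.+ b ℤ.* Y p ≡ c ℤ.* D p

_onᶻ?_ : ∀ p t → Dec (p onᶻ t)
p onᶻ? (a , b , c) = _ ℤ.≟ _

Proper : Coefs → Set
Proper (a , b , c) = ¬ (a ≡ 0ℤ × b ≡ 0ℤ)

toLine : ∀ t → Proper t → Line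
toLine (a , b , c) nz = line (ι a) (ι b) (ι c) (λ (a≡0 , b≡0) → nz (ι-injective a≡0 , ι-injective b≡0))

ιD : ∀ x y → ι (↧ x) ℚ.* ι (↧ y) ≢ 0ℚ
ιD (mkℚ _ d _) (mkℚ _ e _) eq with ι-injective {+ suc d ℤ.* + suc e} {0ℤ}
    (trans (sym (ι-* (+ suc d) (+ suc e))) eq)
... | ()

ι-lhs : ∀ a b x y → (ι a ℚ.* x ℚ.+ ι b ℚ.* y) ℚ.* (ι (↧ x) ℚ.* ι (↧ y)) ≡ ι
    (a ℤ.* X (x , y) ℤ.+ b ℤ.* Y (x , y))
ι-lhs a b x y = begin
  (ι a ℚ.* x ℚ.+ ι b ℚ.* y) ℚ.* (dx ℚ.* dy)
    ≡⟨ solve 6 (λ a x b y dx dy → (a :* x :+ b :* y) :* (dx :* dy) :=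
         a :* ((x :* dx) :* dy) :+ b :* ((y :* dy) :* dx)) refl (ι a) x (ι b) y dx dy ⟩
  ι a ℚ.* ((x ℚ.* dx) ℚ.* dy) ℚ.+ ι b ℚ.* ((y ℚ.* dy) ℚ.* dx)
    ≡⟨ cong₂ (λ u v → ι a ℚ.* (u ℚ.* dy) ℚ.+ ι b ℚ.* (v ℚ.* dx)) (clear-denominator x) (clear-denominator y) ⟩
  ι a ℚ.* (ι (↥ x) ℚ.* dy) ℚ.+ ι b ℚ.* (ι (↥ y) ℚ.* dx)
    ≡⟨ cong₂ (λ u v → ι a ℚ.* u ℚ.+ ι b ℚ.* v) (trans (ι-* (↥ x) (↧ y)) (cong ι (sym (X-def x y))))
        (trans (ι-* (↥ y) (↧ x)) (cong ι (sym (Y-def x y)))) ⟩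
  ι a ℚ.* ι (X (x , y)) ℚ.+ ι b ℚ.* ι (Y (x , y))
    ≡⟨ cong₂ ℚ._+_ (ι-* a _) (ι-* b _) ⟩
  ι (a ℤ.* X (x , y)) ℚ.+ ι (b ℤ.* Y (x , y))
    ≡⟨ ι-+ (a ℤ.* X (x , y)) (b ℤ.* Y (x , y)) ⟩
  ι (a ℤ.* X (x , y) ℤ.+ b ℤ.* Y (x , y)) ∎
  where
  open ≡-Reasoning
  open ℚ.+-*-Solver
  dx = ι (↧ x)
  dy = ι (↧ y)

ι-rhs : ∀ c x y → ι c ℚ.* (ι (↧ x) ℚ.* ι (↧ y)) ≡ ι (c ℤ.* D (x , y))
ι-rhs c x y = trans (cong (ι c ℚ.*_) (trans (ι-* (↧ x) (↧ y)) (cong ι (sym (D-def x y))))) (ι-* c _)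

onᶻ⇒on : ∀ {p} t {nz} → p onᶻ t → p on toLine t nz
onᶻ⇒on {x , y} (a , b , c) eq = ℚ-cancel (ιD x y)
    (trans (ι-lhs a b x y) (trans (cong ι eq) (sym (ι-rhs c x y))))

on⇒onᶻ : ∀ {p} t {nz} → p on toLine t nz → p onᶻ t
on⇒onᶻ {x , y} (a , b , c) eq = ι-injective
    (trans (sym (ι-lhs a b x y)) (trans (cong (ℚ._* (ι (↧ x) ℚ.* ι (↧ y))) eq) (ι-rhs c x y)))

-- Twice the signed area of the triangle `p q r`.
cross : Point → Point → Point → ℚ
cross (px , py) (qx , qy) (rx , ry) = (qx ℚ.- px) ℚ.* (ry ℚ.- py) ℚ.- (qy ℚ.- py) ℚ.* (rx ℚ.- px)

-- The area multiplied by a, or by b if a is 0, is a combination of the three line equations.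
on⇒cross : ∀ {p q r} ℓ → p on ℓ → q on ℓ → r on ℓ → cross p q r ≡ 0ℚ
on⇒cross {px , py} {qx , qy} {rx , ry} (line a b c nz) pℓ qℓ rℓ with a ℚ.≟ 0ℚ
... | no a≢0 = ℚ-zero-factor a≢0 (trans (solve 9 (λ a b c px py qx qy rx ry →
    a :* ((qx :- px) :* (ry :- py) :- (qy :- py) :* (rx :- px)) :=
    ((a :* qx :+ b :* qy :- c) :- (a :* px :+ b :* py :- c)) :* (ry :- py)
    :- ((a :* rx :+ b :* ry :- c) :- (a :* px :+ b :* py :- c)) :* (qy :- py)) refl
    a b c px py qx qy rx ry)
  (zeros (ℚ-diff pℓ) (ℚ-diff qℓ) (ℚ-diff rℓ)))
  where
  open ℚ.+-*-Solver
  zeros : ∀ {u v w s t} → u ≡ 0ℚ → v ≡ 0ℚ → w ≡ 0ℚ → (v ℚ.- u) ℚ.* s ℚ.- (w ℚ.- u) ℚ.* t ≡ 0ℚ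
  zeros {s = s} {t} refl refl refl = trans (cong₂ (λ y z → y ℚ.- z) (ℚ.*-zeroˡ s) (ℚ.*-zeroˡ t)) refl
... | yes a≡0 = ℚ-zero-factor (λ b≡0 → nz (a≡0 , b≡0)) (trans (solve 9 (λ a b c px py qx qy rx ry →
    b :* ((qx :- px) :* (ry :- py) :- (qy :- py) :* (rx :- px)) :=
    ((a :* rx :+ b :* ry :- c) :- (a :* px :+ b :* py :- c)) :* (qx :- px)
    :- ((a :* qx :+ b :* qy :- c) :- (a :* px :+ b :* py :- c)) :* (rx :- px)) refl
    a b c px py qx qy rx ry)
  (zeros (ℚ-diff pℓ) (ℚ-diff qℓ) (ℚ-diff rℓ)))
  where
  open ℚ.+-*-Solver
  zeros : ∀ {u v w s t} → u ≡ 0ℚ → v ≡ 0ℚ → w ≡ 0ℚ → (w ℚ.- u) ℚ.* s ℚ.- (v ℚ.- u) ℚ.* t ≡ 0ℚ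
  zeros {s = s} {t} refl refl refl = trans (cong₂ (λ y z → y ℚ.- z) (ℚ.*-zeroˡ s) (ℚ.*-zeroˡ t)) refl

-- The equation at `r`, multiplied by a nonzero coordinate of q - p, is a combination of the
-- equations at `p` and `q` and of the area.
cross⇒on : ∀ {p q r} ℓ → p ≢ q → p on ℓ → q on ℓ → cross p q r ≡ 0ℚ → r on ℓ
cross⇒on {px , py} {qx , qy} {rx , ry} (line a b c nz) p≢q pℓ qℓ cr with qx ℚ.≟ px
... | no qx≢px = ℚ-undiff (ℚ-zero-factor (λ e → qx≢px (ℚ-undiff e)) (trans (solve 9 (λ a b c px py qx qy rx ry →
    (qx :- px) :* (a :* rx :+ b :* ry :- c) :=
    (a :* qx :+ b :* qy :- c) :* (rx :- px) :- (a :* px :+ b :* py :- c) :* (rx :- qx)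
    :+ b :* ((qx :- px) :* (ry :- py) :- (qy :- py) :* (rx :- px))) refl
    a b c px py qx qy rx ry)
  (zeros (ℚ-diff qℓ) (ℚ-diff pℓ) cr)))
  where
  open ℚ.+-*-Solver
  zeros : ∀ {u v w s t} → u ≡ 0ℚ → v ≡ 0ℚ → w ≡ 0ℚ → u ℚ.* s ℚ.- v ℚ.* t ℚ.+ b ℚ.* w ≡ 0ℚ
  zeros {s = s} {t} refl refl refl = trans
      (cong₂ (λ y z → y ℚ.+ z) (cong₂ (λ y z → y ℚ.- z) (ℚ.*-zeroˡ s) (ℚ.*-zeroˡ t)) (ℚ.*-zeroʳ b)) refl
... | yes qx≡px = ℚ-undiff (ℚ-zero-factor (λ e → p≢q (cong₂ _,_ (sym qx≡px) (sym (ℚ-undiff e))))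
    (trans (solve 9 (λ a b c px py qx qy rx ry →
    (qy :- py) :* (a :* rx :+ b :* ry :- c) :=
    (a :* qx :+ b :* qy :- c) :* (ry :- py) :- (a :* px :+ b :* py :- c) :* (ry :- qy)
    :+ (:- a) :* ((qx :- px) :* (ry :- py) :- (qy :- py) :* (rx :- px))) refl
    a b c px py qx qy rx ry)
  (zeros (ℚ-diff qℓ) (ℚ-diff pℓ) cr)))
  where
  open ℚ.+-*-Solver
  zeros : ∀ {u v w s t} → u ≡ 0ℚ → v ≡ 0ℚ → w ≡ 0ℚ → u ℚ.* s ℚ.- v ℚ.* t ℚ.+ ℚ.- a ℚ.* w ≡ 0ℚ
  zeros {s = s} {t} refl refl refl = trans
      (cong₂ (λ y z → y ℚ.+ z) (cong₂ (λ y z → y ℚ.- z) (ℚ.*-zeroˡ s) (ℚ.*-zeroˡ t)) (ℚ.*-zeroʳ (ℚ.- a))) refl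

-- Collinearity expressed by `cross` mentions no line, so it passes from one line to the other
-- without comparing coefficients, which are not normalised.
two-points : ∀ {p q r} ℓ ℓ′ → p ≢ q → p on ℓ → q on ℓ → p on ℓ′ → q on ℓ′ → r on ℓ → r on ℓ′
two-points ℓ ℓ′ p≢q pℓ qℓ pℓ′ qℓ′ rℓ = cross⇒on ℓ′ p≢q pℓ′ qℓ′ (on⇒cross ℓ pℓ qℓ rℓ)

-- U and V are the coordinates of q − p, multiplied by D p * D q.
U V : Point → Point → ℤ
U p q = X q ℤ.* D p ℤ.- X p ℤ.* D q
V p q = Y q ℤ.* D p ℤ.- Y p ℤ.* D q

-- The equation V (x - x_p) = U (y - y_p), multiplied by `D p` to make the coefficients integers.
join : Point → Point → Coefs
join p q = V p q ℤ.* D p , 0ℤ ℤ.- U p q ℤ.* D p , V p q ℤ.* X p ℤ.- U p q ℤ.* Y p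

ℤ-undiff : ∀ {a b} → a ℤ.- b ≡ 0ℤ → a ≡ b
ℤ-undiff {a} {b} eq = ℤ.i-j≡0⇒i≡j a b eq

ℤ-diff : ∀ {a b} → a ≡ b → a ℤ.- b ≡ 0ℤ
ℤ-diff {a} {b} eq = ℤ.i≡j⇒i-j≡0 eq

ℤ-cancel : ∀ {a b} c → c ≢ 0ℤ → c ℤ.* a ≡ c ℤ.* b → a ≡ b
ℤ-cancel {a} {b} c c≢0 eq = ℤ.*-cancelˡ-≡ c a b {{ℤ.≢-nonZero c≢0}} eq

ℤ-zero-factor : ∀ {a b} → a ≢ 0ℤ → a ℤ.* b ≡ 0ℤ → b ≡ 0ℤ
ℤ-zero-factor {a} a≢0 eq = ℤ-cancel a a≢0 (trans eq (sym (ℤ.*-zeroʳ a)))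

↧≢0 : ∀ x → ↧ x ≢ 0ℤ
↧≢0 (mkℚ _ _ _) ()

ℤ-nonzero : ∀ {a b} → a ≢ 0ℤ → b ≢ 0ℤ → a ℤ.* b ≢ 0ℤ
ℤ-nonzero a≢0 b≢0 = b≢0 ∘ ℤ-zero-factor a≢0

D≢0 : ∀ p → D p ≢ 0ℤ
D≢0 (x , y) eq = ℤ-nonzero (↧≢0 x) (↧≢0 y) (trans (sym (D-def x y)) eq)

-- `U` is the difference of the abscissae times all four denominators; cancelling the two belonging
-- to the ordinates leaves the equality of two fractions. `V` is treated alike.
U-V≡0 : ∀ {p q} → U p q ≡ 0ℤ → V p q ≡ 0ℤ → p ≡ q
U-V≡0 {x , y} {x′ , y′} eu ev rewrite X-def x y | Y-def x y | D-def x y | X-def x′ y′ | Y-def x′ y′ | D-def x′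
    y′ = cong₂ _,_
  (ℚ.≃⇒≡ (ℚ.*≡* (ℤ-cancel _ (ℤ-nonzero (↧≢0 y) (↧≢0 y′))
      (trans (lem (↥ x) (↧ x′) (↧ y) (↧ y′)) (trans (sym (ℤ-undiff eu)) (lem′ (↥ x′) (↧ x) (↧ y) (↧ y′)))))))
  (ℚ.≃⇒≡ (ℚ.*≡* (ℤ-cancel _ (ℤ-nonzero (↧≢0 x) (↧≢0 x′))
      (trans (lem″ (↥ y) (↧ y′) (↧ x) (↧ x′)) (trans (sym (ℤ-undiff ev)) (lem‴ (↥ y′) (↧ y) (↧ x) (↧ x′)))))))
  where
  lem : ∀ n d e f → (e ℤ.* f) ℤ.* (n ℤ.* d) ≡ (n ℤ.* e) ℤ.* (d ℤ.* f)
  lem = solve-∀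
  lem′ : ∀ n d e f → (n ℤ.* f) ℤ.* (d ℤ.* e) ≡ (e ℤ.* f) ℤ.* (n ℤ.* d)
  lem′ = solve-∀
  lem″ : ∀ n d e f → (e ℤ.* f) ℤ.* (n ℤ.* d) ≡ (n ℤ.* e) ℤ.* (f ℤ.* d)
  lem″ = solve-∀
  lem‴ : ∀ n d e f → (n ℤ.* f) ℤ.* (e ℤ.* d) ≡ (e ℤ.* f) ℤ.* (n ℤ.* d)
  lem‴ = solve-∀

join-proper : ∀ {p q} → p ≢ q → Proper (join p q)
join-proper {p} {q} p≢q (a≡0 , b≡0) = p≢q (U-V≡0
  (ℤ-zero-factor (D≢0 p) (trans (ℤ.*-comm (D p) (U p q)) (sym (ℤ-undiff b≡0))))
  (ℤ-zero-factor (D≢0 p) (trans (ℤ.*-comm (D p) (V p q)) a≡0)))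

join-on : ∀ p q r → V p q ℤ.* U p r ≡ U p q ℤ.* V p r → r onᶻ join p q
join-on p q r eq = ℤ-undiff (trans (lem (V p q) (U p q) (X p) (Y p) (D p) (X r) (Y r) (D r)) (ℤ-diff eq))
  where
  lem : ∀ v u x y d x′ y′ d′ → (v ℤ.* d ℤ.* x′ ℤ.+ (0ℤ ℤ.- u ℤ.* d) ℤ.* y′) ℤ.- (v ℤ.* x ℤ.- u ℤ.* y) ℤ.* d′
        ≡ v ℤ.* (x′ ℤ.* d ℤ.- x ℤ.* d′) ℤ.- u ℤ.* (y′ ℤ.* d ℤ.- y ℤ.* d′)
  lem = solve-∀

join-on⁻ : ∀ p q r → r onᶻ join p q → V p q ℤ.* U p r ≡ U p q ℤ.* V p r
join-on⁻ p q r eq = ℤ-undiff (trans (lem (V p q) (U p q) (X p) (Y p) (D p) (X r) (Y r) (D r)) (ℤ-diff eq))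
  where
  lem : ∀ v u x y d x′ y′ d′ → v ℤ.* (x′ ℤ.* d ℤ.- x ℤ.* d′) ℤ.- u ℤ.* (y′ ℤ.* d ℤ.- y ℤ.* d′)
        ≡ (v ℤ.* d ℤ.* x′ ℤ.+ (0ℤ ℤ.- u ℤ.* d) ℤ.* y′) ℤ.- (v ℤ.* x ℤ.- u ℤ.* y) ℤ.* d′
  lem = solve-∀

join-onˡ : ∀ p q → p onᶻ join p q
join-onˡ p q = join-on p q p (lem (U p q) (V p q) (X p) (Y p) (D p))
  where
  lem : ∀ u v x y d → v ℤ.* (x ℤ.* d ℤ.- x ℤ.* d) ≡ u ℤ.* (y ℤ.* d ℤ.- y ℤ.* d)
  lem = solve-∀

join-onʳ : ∀ p q → q onᶻ join p q
join-onʳ p q = join-on p q q (ℤ.*-comm (V p q) (U p q))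

-- Keys for tables

-- A variant of Cantor's pairing that needs no halving: with s = a + b, the value lies from s² up to
-- s² + s, below the next square.
pair : ℤ → ℤ → ℤ
pair a b = (a ℤ.+ b) ℤ.* (a ℤ.+ b) ℤ.+ a

pairℕ : ℕ → ℕ → ℕ
pairℕ a b = (a + b) * (a + b) + a

pair-pos : ∀ a b → pair (+ a) (+ b) ≡ + pairℕ a b
pair-pos a b = cong (ℤ._+ + a) (sym (ℤ.pos-* (a + b) (a + b)))

pairℕ-< : ∀ a b a′ b′ → a + b < a′ + b′ → pairℕ a b < pairℕ a′ b′
pairℕ-< a b a′ b′ lt = begin-strict
  s * s + a          ≤⟨ ℕ.+-monoʳ-≤ (s * s) (ℕ.m≤m+n a b) ⟩
  s * s + s          <⟨ ℕ.m<m+n (s * s + s) {suc s} (s≤s z≤n) ⟩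
  s * s + s + suc s  ≡⟨ solve 1 (λ s → s :* s :+ s :+ (con 1 :+ s) := (con 1 :+ s) :* (con 1 :+ s)) refl s ⟩
  suc s * suc s      ≤⟨ ℕ.*-mono-≤ lt lt ⟩
  s′ * s′            ≤⟨ ℕ.m≤m+n (s′ * s′) a′ ⟩
  s′ * s′ + a′       ∎
  where
  open ℕ.≤-Reasoning
  open +-*-Solver
  s = a + b
  s′ = a′ + b′

pairℕ-injective : ∀ a b a′ b′ → pairℕ a b ≡ pairℕ a′ b′ → a ≡ a′ × b ≡ b′
pairℕ-injective a b a′ b′ eq with ℕ.<-cmp (a + b) (a′ + b′)
... | tri< lt _ _ = contradiction eq (ℕ.<⇒≢ (pairℕ-< a b a′ b′ lt))
... | tri> _ _ gt = contradiction (sym eq) (ℕ.<⇒≢ (pairℕ-< a′ b′ a b gt))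
... | tri≈ _ s≡s′ _ = a≡a′ , ℕ.+-cancelˡ-≡ a b b′ (trans s≡s′ (cong (_+ b′) (sym a≡a′)))
  where
  a≡a′ : a ≡ a′
  a≡a′ = ℕ.+-cancelˡ-≡ ((a + b) * (a + b)) a a′ (trans eq (cong (λ s → s * s + a′) (sym s≡s′)))

pair-injective : ∀ {a b a′ b′} → pair (+ a) (+ b) ≡ pair (+ a′) (+ b′) → a ≡ a′ × b ≡ b′
pair-injective {a} {b} {a′} {b′} eq = pairℕ-injective a b a′ b′
  (ℤ.+-injective (trans (sym (pair-pos a b)) (trans eq (pair-pos a′ b′))))

abstract
  idx : ℕ → ℕ → ℤ
  idx b n = pair (+ b) (+ n)

  idx-def : ∀ b n → idx b n ≡ pair (+ b) (+ n)
  idx-def b n = refl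

  idx-injective : ∀ {b n b′ n′} → idx b n ≡ idx b′ n′ → b ≡ b′ × n ≡ n′
  idx-injective = pair-injective

odd≢0 : ∀ i → + 2 ℤ.* i ℤ.+ + 1 ≢ 0ℤ
odd≢0 i e = even≢one ℤ.∣ ℤ.- i ∣
  (sym (trans (cong ℤ.∣_∣ (ℤ-undiff {+ 1} {+ 2 ℤ.* (ℤ.- i)} (trans (lem i) e))) (ℤ.abs-* (+ 2) (ℤ.- i))))
  where
  lem : ∀ i → + 1 ℤ.- + 2 ℤ.* (ℤ.- i) ≡ + 2 ℤ.* i ℤ.+ + 1
  lem = solve-∀
  even≢one : ∀ n → 2 * n ≢ 1
  even≢one (suc n) e rewrite ℕ.+-suc n (n + 0) with e
  ... | ()

odd-injective : ∀ i j → + 2 ℤ.* i ℤ.+ + 1 ≡ + 2 ℤ.* j ℤ.+ + 1 → i ≡ j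
odd-injective i j eq = ℤ-undiff (ℤ-zero-factor {+ 2} (λ ()) (trans (lem i j) (ℤ-diff eq)))
  where
  lem : ∀ i j → + 2 ℤ.* (i ℤ.- j) ≡ (+ 2 ℤ.* i ℤ.+ + 1) ℤ.- (+ 2 ℤ.* j ℤ.+ + 1)
  lem = solve-∀

-- Triangular numbers embed ℤ into ℕ by a polynomial.
tri : ℤ → ℤ
tri z = z ℤ.* (+ 2 ℤ.* z ℤ.+ + 1)

tri-injective : ∀ y z → tri y ≡ tri z → y ≡ z
tri-injective y z eq = ℤ-undiff (ℤ-zero-factor (odd≢0 (y ℤ.+ z)) (trans (lem y z) (ℤ-diff eq)))
  where
  lem : ∀ y z → (+ 2 ℤ.* (y ℤ.+ z) ℤ.+ + 1) ℤ.* (y ℤ.- z) ≡ y ℤ.* (+ 2 ℤ.* y ℤ.+ + 1) ℤ.- z ℤ.*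
      (+ 2 ℤ.* z ℤ.+ + 1)
  lem = solve-∀

Natural : ℤ → Set
Natural z = ∃[ n ] z ≡ + n

tri-natural : ∀ z → Natural (tri z)
tri-natural (+ n) = _ , sym (trans (ℤ.pos-* n (2 * n + 1)) (cong (λ w → + n ℤ.* (w ℤ.+ + 1)) (ℤ.pos-* 2 n)))
tri-natural -[1+ n ] = _ , lem (+ n)
  where
  lem : ∀ n → (ℤ.- (+ 1 ℤ.+ n)) ℤ.* (+ 2 ℤ.* (ℤ.- (+ 1 ℤ.+ n)) ℤ.+ + 1) ≡ (+ 1 ℤ.+ n) ℤ.* (+ 1 ℤ.+ (n ℤ.+ n))
  lem = solve-∀

pair-natural : ∀ {a b} → Natural a → Natural b → Natural (pair a b)
pair-natural (a , refl) (b , refl) = _ , pair-pos a b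

pair-inj : ∀ {a b a′ b′} → Natural a → Natural b → Natural a′ → Natural b′ → pair a b ≡ pair a′ b′ →
    a ≡ a′ × b ≡ b′
pair-inj (a , refl) (b , refl) (a′ , refl) (b′ , refl) eq with refl ,
    refl ← pair-injective {a} {b} {a′} {b′} eq = refl , refl

abstract
  -- Iterated pairing of the four input numbers. Rationals are kept in lowest terms, so a point has
  -- the same code whenever it is entered, and the code can serve directly as an array index.
  code : Point → ℤ
  code (x , y) = pair (pair (pair (tri (↥ x)) (↧ x)) (tri (↥ y))) (↧ y)

  code-def : ∀ x y → code (x , y) ≡ pair (pair (pair (tri (↥ x)) (↧ x)) (tri (↥ y))) (↧ y)
  code-def x y = refl

  code-injective : ∀ {p q} → code p ≡ code q → p ≡ q
  code-injective {x@(mkℚ _ _ _) , y@(mkℚ _ _ _)} {x′@(mkℚ _ _ _) , y′@(mkℚ _ _ _)} eq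
    with e , yd ← pair-inj (pair-natural (pair-natural (tri-natural (↥ x)) (_ , refl)) (tri-natural (↥ y)))
        (_ , refl)
                           (pair-natural (pair-natural (tri-natural (↥ x′)) (_ , refl)) (tri-natural (↥ y′)))
                               (_ , refl) eq
    with e′ , yn ← pair-inj (pair-natural (tri-natural (↥ x)) (_ , refl)) (tri-natural (↥ y))
                            (pair-natural (tri-natural (↥ x′)) (_ , refl)) (tri-natural (↥ y′)) e
    with xn , xd ← pair-inj (tri-natural (↥ x)) (_ , refl) (tri-natural (↥ x′)) (_ , refl) e′
    = cong₂ _,_ (ℚ.≃⇒≡ (ℚ.*≡* (cong₂ ℤ._*_ (tri-injective (↥ x) (↥ x′) xn) (sym xd))))
        (ℚ.≃⇒≡ (ℚ.*≡* (cong₂ ℤ._*_ (tri-injective (↥ y) (↥ y′) yn) (sym yd))))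

floor-≤ : ∀ i d → (i div (+ suc d)) ℤ.* + suc d ℤ.≤ i
floor-≤ i d = ℤ.[n/d]*d≤n i (+ suc d)

floor-> : ∀ i d → i ℤ.< ℤ.suc (i div (+ suc d)) ℤ.* + suc d
floor-> i d = subst (λ q → i ℤ.< ℤ.suc q ℤ.* + suc d) (sym (ℤ.div-pos-is-/ℕ i (suc d)))
    (ℤ.n<s[n/ℕd]*d i (suc d))

<suc⇒≤ : ∀ {i j} → i ℤ.< ℤ.suc j → i ℤ.≤ j
<suc⇒≤ {i} {j} lt = subst (i ℤ.≤_) (ℤ.pred-suc j) (ℤ.i<j⇒i≤pred[j] lt)

-- The first floor is at most the common value of the two fractions, which is below the second floor
-- plus one.
floor-mono : ∀ a a′ d d′ → a ℤ.* + suc d′ ≡ a′ ℤ.* + suc d → a div (+ suc d) ℤ.≤ a′ div (+ suc d′)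
floor-mono a a′ d d′ eq = <suc⇒≤ (ℤ.*-cancelʳ-<-nonNeg (+ suc d ℤ.* + suc d′) (begin-strict
  q ℤ.* (+ suc d ℤ.* + suc d′)             ≡⟨ ℤ.*-assoc q _ _ ⟨
  q ℤ.* + suc d ℤ.* + suc d′               ≤⟨ ℤ.*-monoʳ-≤-nonNeg (+ suc d′) (floor-≤ a d) ⟩
  a ℤ.* + suc d′                           ≡⟨ eq ⟩
  a′ ℤ.* + suc d                           <⟨ ℤ.*-monoʳ-<-pos (+ suc d) (floor-> a′ d′) ⟩
  ℤ.suc q′ ℤ.* + suc d′ ℤ.* + suc d        ≡⟨ lem (ℤ.suc q′) (+ suc d) (+ suc d′) ⟩
  ℤ.suc q′ ℤ.* (+ suc d ℤ.* + suc d′)      ∎))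
  where
  open ℤ.≤-Reasoning
  q = a div (+ suc d)
  q′ = a′ div (+ suc d′)
  lem : ∀ q d d′ → q ℤ.* d′ ℤ.* d ≡ q ℤ.* (d ℤ.* d′)
  lem = solve-∀

floor-cong : ∀ a a′ d d′ → a ℤ.* + suc d′ ≡ a′ ℤ.* + suc d → a div (+ suc d) ≡ a′ div (+ suc d′)
floor-cong a a′ d d′ eq = ℤ.≤-antisym (floor-mono a a′ d d′ eq) (floor-mono a′ a d′ d (sym eq))

-- Fractions with a common floor differ by less than 1; here this is multiplied by both
-- denominators.
floor-near : ∀ a a′ d d′ → a div (+ suc d) ≡ a′ div (+ suc d′) →
    a ℤ.* + suc d′ ℤ.- a′ ℤ.* + suc d ℤ.< + suc d ℤ.* + suc d′
floor-near a a′ d d′ eq = begin-strict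
  a ℤ.* + suc d′ ℤ.- a′ ℤ.* + suc d
    <⟨ ℤ.+-mono-<-≤ (ℤ.*-monoʳ-<-pos (+ suc d′) (floor-> a d))
        (ℤ.neg-mono-≤ (ℤ.*-monoʳ-≤-nonNeg (+ suc d) (floor-≤ a′ d′))) ⟩
  ℤ.suc q ℤ.* + suc d ℤ.* + suc d′ ℤ.- q′ ℤ.* + suc d′ ℤ.* + suc d
    ≡⟨ cong (λ q′ → ℤ.suc q ℤ.* + suc d ℤ.* + suc d′ ℤ.- q′ ℤ.* + suc d′ ℤ.* + suc d) (sym eq) ⟩
  ℤ.suc q ℤ.* + suc d ℤ.* + suc d′ ℤ.- q ℤ.* + suc d′ ℤ.* + suc d
    ≡⟨ lem q (+ suc d) (+ suc d′) ⟩
  + suc d ℤ.* + suc d′ ∎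
  where
  open ℤ.≤-Reasoning
  q = a div (+ suc d)
  q′ = a′ div (+ suc d′)
  lem : ∀ q d d′ → (+ 1 ℤ.+ q) ℤ.* d ℤ.* d′ ℤ.- q ℤ.* d′ ℤ.* d ≡ d ℤ.* d′
  lem = solve-∀

abs-< : ∀ {z n} → z ℤ.< + n → ℤ.- z ℤ.< + n → ℤ.∣ z ∣ < n
abs-< {+ z} lt _ = ℤ.drop‿+<+ lt
abs-< { -[1+ z ]} _ lt = ℤ.drop‿+<+ lt

square-suc : ∀ {u} → u ≢ 0ℤ → ∃[ d ] u ℤ.* u ≡ + suc d
square-suc {+ zero} u≢0 = contradiction refl u≢0
square-suc {+ suc n} _ = _ , refl
square-suc { -[1+ n ]} _ = _ , refl

-- The slope v / u, rounded down to a multiple of 1 / s; odd, so that 0 is free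
-- for the vertical direction.
slope-key : (s u v : ℤ) → ℤ
slope-key s u v with u ℤ.≟ 0ℤ
... | yes _ = 0ℤ
... | no _  = + 2 ℤ.* ((v ℤ.* u ℤ.* s) div (u ℤ.* u)) ℤ.+ + 1

-- The fraction v u s / u² depends on the ratio v / u alone, and equal fractions have equal floors.
-- The squared denominator is positive, so the rounding goes down whatever the sign of u.
slope-key-cong : ∀ s {u v u′ v′} → ¬ (u ≡ 0ℤ × v ≡ 0ℤ) → ¬ (u′ ≡ 0ℤ × v′ ≡ 0ℤ) →
  v ℤ.* u′ ≡ u ℤ.* v′ → slope-key s u v ≡ slope-key s u′ v′
slope-key-cong s {u} {v} {u′} {v′} nz nz′ eq with u ℤ.≟ 0ℤ | u′ ℤ.≟ 0ℤ
... | yes refl | yes refl = refl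
... | yes refl | no u′≢0 = contradiction (refl , ℤ-zero-factor u′≢0 (trans (ℤ.*-comm u′ v) eq)) nz
... | no u≢0 | yes refl = contradiction (refl , ℤ-zero-factor u≢0 (trans (sym eq) (ℤ.*-zeroʳ v))) nz′
... | no u≢0 | no u′≢0 with square-suc u≢0 | square-suc u′≢0
...   | d , e | d′ , e′ = cong (λ q → + 2 ℤ.* q ℤ.+ + 1) (trans (cong ((v ℤ.* u ℤ.* s) div_) e) (trans
  (floor-cong (v ℤ.* u ℤ.* s) (v′ ℤ.* u′ ℤ.* s) d d′ (begin
    v ℤ.* u ℤ.* s ℤ.* + suc d′      ≡⟨ cong (v ℤ.* u ℤ.* s ℤ.*_) e′ ⟨
    v ℤ.* u ℤ.* s ℤ.* (u′ ℤ.* u′)   ≡⟨ lem s u v u′ ⟩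
    (v ℤ.* u′) ℤ.* (u ℤ.* s ℤ.* u′)       ≡⟨ cong (ℤ._* (u ℤ.* s ℤ.* u′)) eq ⟩
    (u ℤ.* v′) ℤ.* (u ℤ.* s ℤ.* u′)       ≡⟨ lem′ s u v′ u′ ⟩
    v′ ℤ.* u′ ℤ.* s ℤ.* (u ℤ.* u)   ≡⟨ cong (v′ ℤ.* u′ ℤ.* s ℤ.*_) e ⟩
    v′ ℤ.* u′ ℤ.* s ℤ.* + suc d     ∎))
  (cong ((v′ ℤ.* u′ ℤ.* s) div_) (sym e′))))
  where
  open ≡-Reasoning
  lem : ∀ s u v u′ → v ℤ.* u ℤ.* s ℤ.* (u′ ℤ.* u′) ≡ (v ℤ.* u′) ℤ.* (u ℤ.* s ℤ.* u′)
  lem = solve-∀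
  lem′ : ∀ s u v u′ → (u ℤ.* v) ℤ.* (u ℤ.* s ℤ.* u′) ≡ v ℤ.* u′ ℤ.* s ℤ.* (u ℤ.* u)
  lem′ = solve-∀

-- Two slopes whose keys agree differ by less than 1 / s; if they were different,
-- they would differ by at least 1 / |u u′| ≥ 1 / s.
slope-key-injective : ∀ s {u v u′ v′} → ℤ.∣ u ∣ * ℤ.∣ u ∣ ≤ s → ℤ.∣ u′ ∣ * ℤ.∣ u′ ∣ ≤ s →
  slope-key (+ s) u v ≡ slope-key (+ s) u′ v′ → v ℤ.* u′ ≡ u ℤ.* v′
slope-key-injective s {u} {v} {u′} {v′} u≤s u′≤s eq with u ℤ.≟ 0ℤ | u′ ℤ.≟ 0ℤ
... | yes refl | yes refl = ℤ.*-zeroʳ v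
... | yes refl | no u′≢0 = contradiction (sym eq) (odd≢0 ((v′ ℤ.* u′ ℤ.* + s) div (u′ ℤ.* u′)))
... | no u≢0 | yes refl = contradiction eq (odd≢0 ((v ℤ.* u ℤ.* + s) div (u ℤ.* u)))
... | no u≢0 | no u′≢0 with square-suc u≢0 | square-suc u′≢0
...   | d , e | d′ , e′ with v ℤ.* u′ ℤ.- u ℤ.* v′ in weq
...     | w with w ℤ.≟ 0ℤ
...       | yes refl = ℤ-undiff weq
...       | no w≢0 = contradiction small (ℕ.≤⇒≯ big)
  where
  a = v ℤ.* u ℤ.* + s
  a′ = v′ ℤ.* u′ ℤ.* + s
  equal : a div (+ suc d) ≡ a′ div (+ suc d′)
  equal = trans (cong (a div_) (sym e))
      (trans (odd-injective ((v ℤ.* u ℤ.* + s) div (u ℤ.* u)) ((v′ ℤ.* u′ ℤ.* + s) div (u′ ℤ.* u′)) eq)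
      (cong (a′ div_) e′))
  z = u ℤ.* u′ ℤ.* + s ℤ.* w
  lem : ∀ s u v u′ v′ → v ℤ.* u ℤ.* s ℤ.* (u′ ℤ.* u′) ℤ.- v′ ℤ.* u′ ℤ.* s ℤ.* (u ℤ.* u) ≡ u ℤ.* u′ ℤ.* s ℤ.*
      (v ℤ.* u′ ℤ.- u ℤ.* v′)
  lem = solve-∀
  z-eq : a ℤ.* + suc d′ ℤ.- a′ ℤ.* + suc d ≡ z
  z-eq = trans (cong₂ (λ y y′ → a ℤ.* y ℤ.- a′ ℤ.* y′) (sym e′) (sym e))
      (trans (lem (+ s) u v u′ v′) (cong (u ℤ.* u′ ℤ.* + s ℤ.*_) weq))
  small : ℤ.∣ z ∣ < suc d * suc d′
  small = abs-< (subst (ℤ._< _) z-eq (floor-near a a′ d d′ equal))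
    (subst₂ ℤ._<_ (trans (lem″ (a′ ℤ.* + suc d) (a ℤ.* + suc d′)) (cong ℤ.-_ z-eq))
        (cong +_ (ℕ.*-comm (suc d′) (suc d))) (floor-near a′ a d′ d (sym equal)))
    where
    lem″ : ∀ x y → x ℤ.- y ≡ ℤ.- (y ℤ.- x)
    lem″ = solve-∀
  m = ℤ.∣ u ∣
  m′ = ℤ.∣ u′ ∣
  mm′≤s : m * m′ ≤ s
  mm′≤s with ℕ.≤-total m m′
  ... | inj₁ le = ℕ.≤-trans (ℕ.*-monoˡ-≤ m′ le) u′≤s
  ... | inj₂ le = ℕ.≤-trans (ℕ.*-monoʳ-≤ m le) u≤s
  big : suc d * suc d′ ≤ ℤ.∣ z ∣
  big = begin
    suc d * suc d′             ≡⟨ cong₂ _*_ (trans (cong ℤ.∣_∣ (sym e)) (ℤ.abs-* u u))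
        (trans (cong ℤ.∣_∣ (sym e′)) (ℤ.abs-* u′ u′)) ⟩
    (m * m) * (m′ * m′)        ≡⟨ solve 2 (λ m m′ → (m :* m) :* (m′ :* m′) := (m :* m′) :* (m :* m′)) refl m m′
        ⟩
    (m * m′) * (m * m′)        ≤⟨ ℕ.*-monoʳ-≤ (m * m′) mm′≤s ⟩
    (m * m′) * s               ≤⟨ ℕ.m≤m*n ((m * m′) * s) ℤ.∣ w ∣ {{ℕ.≢-nonZero (w≢0 ∘ ℤ.∣i∣≡0⇒i≡0)}} ⟩
    (m * m′) * s * ℤ.∣ w ∣     ≡⟨ cong (λ y → y * s * ℤ.∣ w ∣) (ℤ.abs-* u u′) ⟨
    ℤ.∣ u ℤ.* u′ ∣ * s * ℤ.∣ w ∣  ≡⟨ cong (_* ℤ.∣ w ∣) (ℤ.abs-* (u ℤ.* u′) (+ s)) ⟨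
    ℤ.∣ u ℤ.* u′ ℤ.* + s ∣ * ℤ.∣ w ∣  ≡⟨ ℤ.abs-* (u ℤ.* u′ ℤ.* + s) w ⟨
    ℤ.∣ z ∣                    ∎
    where
    open ℕ.≤-Reasoning
    open +-*-Solver

-- Counting points on lines

_on?_ : ∀ p ℓ → Dec (p on ℓ)
(x , y) on? ℓ = _ ℚ.≟ _

module _ {A : Set} where

  count : ∀ {P : A → Set} → Decidable P → List A → ℕ
  count P? []      = 0
  count P? (x ∷ l) with P? x
  ... | yes _ = suc (count P? l)
  ... | no _  = count P? l

  count-mono : ∀ {P Q : A → Set} (P? : Decidable P) (Q? : Decidable Q) l → (∀ {x} → x ∈ l → P x → Q x) →
               count P? l ≤ count Q? l
  count-mono P? Q? [] f = z≤n
  count-mono P? Q? (x ∷ l) f with P? x | Q? x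
  ... | yes _ | yes _ = s≤s (count-mono P? Q? l (f ∘ there))
  ... | yes p | no ¬q = contradiction (f (here refl) p) ¬q
  ... | no _  | yes _ = ℕ.m≤n⇒m≤1+n (count-mono P? Q? l (f ∘ there))
  ... | no _  | no _  = count-mono P? Q? l (f ∘ there)

  count-yes : ∀ {P : A → Set} (P? : Decidable P) {x} l → P x → count P? (x ∷ l) ≡ suc (count P? l)
  count-yes P? {x} l px with P? x
  ... | yes _  = refl
  ... | no ¬px = contradiction px ¬px

  count-no : ∀ {P : A → Set} (P? : Decidable P) {x} l → ¬ P x → count P? (x ∷ l) ≡ count P? l
  count-no P? {x} l ¬px with P? x
  ... | yes px = contradiction px ¬px
  ... | no _   = refl

  count-∷-≤ : ∀ {P : A → Set} (P? : Decidable P) x l → count P? l ≤ count P? (x ∷ l)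
  count-∷-≤ P? x l with P? x
  ... | yes _ = ℕ.n≤1+n _
  ... | no _  = ℕ.≤-refl

  count-ʳ++ : ∀ {P : A → Set} (P? : Decidable P) l l′ → count P? (l ʳ++ l′) ≡ count P? l + count P? l′
  count-ʳ++ P? [] l′ = refl
  count-ʳ++ P? (x ∷ l) l′ rewrite count-ʳ++ P? l (x ∷ l′) with P? x
  ... | yes _ = ℕ.+-suc (count P? l) (count P? l′)
  ... | no _  = refl

  length-filter : ∀ {P : A → Set} (P? : Decidable P) l → length (filter P? l) ≡ count P? l
  length-filter P? [] = refl
  length-filter P? (x ∷ l) with P? x
  ... | yes _ = cong suc (length-filter P? l)
  ... | no _  = length-filter P? l

  length-split : ∀ {P : A → Set} (P? : Decidable P) l → length l ≡ count P? l + length (filter (¬? ∘ P?) l)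
  length-split P? [] = refl
  length-split P? (x ∷ l) with P? x
  ... | yes _ = cong suc (length-split P? l)
  ... | no _  = trans (cong suc (length-split P? l)) (sym (ℕ.+-suc _ _))

  count-filter : ∀ {P Q : A → Set} (P? : Decidable P) (Q? : Decidable Q) l → count P? (filter Q? l) ≤ count P? l
  count-filter P? Q? [] = z≤n
  count-filter P? Q? (x ∷ l) with Q? x
  ... | no _ = ℕ.≤-trans (count-filter P? Q? l) (count-∷-≤ P? x l)
  ... | yes _ with P? x
  ...   | yes _ = s≤s (count-filter P? Q? l)
  ...   | no _  = count-filter P? Q? l

  count-member : ∀ {P : A → Set} (P? : Decidable P) l → 1 ≤ count P? l → ∃[ x ] x ∈ l × P x
  count-member P? (x ∷ l) le with P? x
  ... | yes px = x , here refl , px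
  ... | no _ with count-member P? l le
  ...   | y , y∈l , py = y , there y∈l , py

  count-pair : ∀ {P : A → Set} (P? : Decidable P) l → Unique l → 2 ≤ count P? l →
               ∃[ x ] ∃[ y ] x ∈ l × y ∈ l × x ≢ y × P x × P y
  count-pair P? (x ∷ l) (x∉ ∷ u) le with P? x
  ... | yes px with count-member P? l (ℕ.s≤s⁻¹ le)
  ...   | y , y∈l , py = x , y , here refl , there y∈l , All.lookup x∉ y∈l , px , py
  count-pair P? (x ∷ l) (x∉ ∷ u) le | no _ with count-pair P? l u le
  ...   | y , z , y∈ , z∈ , rest = y , z , there y∈ , there z∈ , rest

  ∈-ʳ++⁻ : ∀ {x : A} l {l′} → x ∈ l ʳ++ l′ → x ∈ l ⊎ x ∈ l′
  ∈-ʳ++⁻ [] m = inj₂ m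
  ∈-ʳ++⁻ (y ∷ l) m with ∈-ʳ++⁻ l m
  ... | inj₁ m′ = inj₁ (there m′)
  ... | inj₂ (here eq) = inj₁ (here eq)
  ... | inj₂ (there m′) = inj₂ m′

  ∈-ʳ++[]⁻ : ∀ {x : A} d {l} → d ʳ++ [] ≡ l → x ∈ l → x ∈ d
  ∈-ʳ++[]⁻ d refl m with ∈-ʳ++⁻ d m
  ... | inj₁ m′ = m′

  ∈-ʳ++⁺ʳ : ∀ {x : A} l {l′} → x ∈ l′ → x ∈ l ʳ++ l′
  ∈-ʳ++⁺ʳ [] m = m
  ∈-ʳ++⁺ʳ (y ∷ l) m = ∈-ʳ++⁺ʳ l (there m)

  ∈-ʳ++⁺ˡ : ∀ {x : A} l {l′} → x ∈ l → x ∈ l ʳ++ l′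
  ∈-ʳ++⁺ˡ (y ∷ l) (here eq) = ∈-ʳ++⁺ʳ l (here eq)
  ∈-ʳ++⁺ˡ (y ∷ l) (there m) = ∈-ʳ++⁺ˡ l m

  unique-ʳ++ : ∀ (l : List A) {l′} → Unique l → Unique l′ → (∀ {x} → x ∈ l → x ∉ l′) → Unique (l ʳ++ l′)
  unique-ʳ++ [] _ u′ _ = u′
  unique-ʳ++ (x ∷ l) (x∉ ∷ u) u′ dis = unique-ʳ++ l u
    (All.tabulate (λ {y} y∈ x≡y → dis (here (sym x≡y)) y∈) ∷ u′)
    (λ { y∈l (here refl) → All.lookup x∉ y∈l refl ; y∈l (there y∈l′) → dis (there y∈l) y∈l′ })

-- The first line accounts for at most c points. Without these, the rest is covered by the other
-- lines, whose counts have not grown.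
cover-count : ∀ ls l c → (∀ {ℓ} → ℓ ∈ ls → count (_on? ℓ) l ≤ c) → (∀ {p} → p ∈ l → Any (p on_) ls) →
              length l ≤ length ls * c
cover-count [] [] c few cov = z≤n
cover-count [] (p ∷ l) c few cov with cov (here refl)
... | ()
cover-count (ℓ ∷ ls) l c few cov = begin
  length l                          ≡⟨ length-split (_on? ℓ) l ⟩
  count (_on? ℓ) l + length l′      ≤⟨ ℕ.+-mono-≤ (few (here refl)) (cover-count ls l′ c few′ cov′) ⟩
  c + length ls * c                 ∎
  where
  open ℕ.≤-Reasoning
  l′ = filter (¬? ∘ (_on? ℓ)) l
  few′ : ∀ {ℓ′} → ℓ′ ∈ ls → count (_on? ℓ′) l′ ≤ c
  few′ {ℓ′} m = ℕ.≤-trans (count-filter (_on? ℓ′) (¬? ∘ (_on? ℓ)) l) (few (there m))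
  cov′ : ∀ {p} → p ∈ l′ → Any (p on_) ls
  cov′ m with ∈-filter⁻ (¬? ∘ (_on? ℓ)) {xs = l} m
  ... | p∈l , ¬o with cov p∈l
  ...   | here o = contradiction o ¬o
  ...   | there a = a

light-bound : ∀ {m P R} → CoverableBy m P → (∀ {p} → p ∈ R → p ∈ P) → (∀ ℓ → count (_on? ℓ) R ≤ m) →
    length R ≤ m * m
light-bound {m} {R = R} (ls , le , cov) sub light =
  ℕ.≤-trans (cover-count ls R m (λ {ℓ} _ → light ℓ) (cov ∘ sub)) (ℕ.*-monoˡ-≤ m le)

-- The points are counted in a separate list without repetitions, because `P` may list a point
-- several times.
record Rich (m : ℕ) (P : PointSet) (t : Coefs) : Set where
  constructor rich
  field
    points : List Point
    unique : Unique points
    many   : suc m ≤ length points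
    within : ∀ {p} → p ∈ points → p ∈ P
    on-it  : ∀ {p} → p ∈ points → p onᶻ t
    proper : Proper t

-- m + 1 points of a line cannot lie on m other lines, so that every cover by m
-- lines contains each rich line.
rich-in-cover : ∀ {m P t} ls → IsCover m P ls → Rich m P t →
  ∃[ i ] (∀ r → r onᶻ t → r on lookup ls i) × (∀ r → r on lookup ls i → r onᶻ t)
rich-in-cover {m} {t = t} ls (le , cov) (rich l u many sub onl pr) with Fin.any?
    (λ i → 2 ≤? count (_on? lookup ls i) l)
... | yes (i , two) with count-pair (_on? lookup ls i) l u two
...   | p , q , p∈ , q∈ , p≢q , p-on , q-on = i ,
  (λ r r-on → two-points (toLine t pr) (lookup ls i) p≢q (onᶻ⇒on t {pr} (onl p∈)) (onᶻ⇒on t {pr} (onl q∈)) p-on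
      q-on (onᶻ⇒on t {pr} r-on)) ,
  (λ r r-on → on⇒onᶻ t {pr} (two-points (lookup ls i) (toLine t pr) p≢q p-on q-on (onᶻ⇒on t {pr} (onl p∈))
      (onᶻ⇒on t {pr} (onl q∈)) r-on))
rich-in-cover {m} ls (le , cov) (rich l u many sub onl pr) | no none = contradiction many (ℕ.≤⇒≯ (begin
  length l           ≤⟨ cover-count ls l 1 few (cov ∘ sub) ⟩
  length ls * 1      ≡⟨ ℕ.*-identityʳ _ ⟩
  length ls          ≤⟨ le ⟩
  m                  ∎))
  where
  open ℕ.≤-Reasoning
  few : ∀ {ℓ} → ℓ ∈ ls → count (_on? ℓ) l ≤ 1
  few {ℓ} m with 2 ≤? count (_on? ℓ) l
  ... | no ¬two = ℕ.s≤s⁻¹ (ℕ.≰⇒> ¬two)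
  ... | yes two = contradiction (index m , subst (λ ℓ → 2 ≤ count (_on? ℓ) l) (Any.lookup-index m) two) none

-- Each of the m + 1 rich lines is one of the at most m lines of a cover, so two of them are the
-- same line of the cover.
few-rich : ∀ {m P} → CoverableBy m P → (t : Fin (suc m) → Coefs) → (∀ i → Rich m P (t i)) →
  ∃[ i ] ∃[ j ] i Fin.< j × (∀ r → r onᶻ t i → r onᶻ t j) × (∀ r → r onᶻ t j → r onᶻ t i)
few-rich {m} (ls , c@(le , _)) t rs
  with Fin.pigeonhole (s≤s le) (λ i → proj₁ (rich-in-cover ls c (rs i)))
... | i , j , i<j , eq with rich-in-cover ls c (rs i) | rich-in-cover ls c (rs j)
... | x , f , g | y , f′ , g′ = i , j , i<j ,
  (λ r o → g′ r (subst (λ i → r on lookup ls i) eq (f r o))) ,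
  (λ r o → g r (subst (λ i → r on lookup ls i) (sym eq) (f′ r o)))

-- At l x n : the list l contains x with n elements after it, so that lists grow
-- at the front without changing positions.
data At {A : Set} : List A → A → ℕ → Set where
  here  : ∀ {x l} → At (x ∷ l) x (length l)
  there : ∀ {x y l n} → At l x n → At (y ∷ l) x n

module _ {A : Set} where

  at-< : ∀ {l : List A} {x n} → At l x n → n < length l
  at-< here = ℕ.≤-refl
  at-< (there a) = ℕ.m≤n⇒m≤1+n (at-< a)

  at-∈ : ∀ {l : List A} {x n} → At l x n → x ∈ l
  at-∈ here = here refl
  at-∈ (there a) = there (at-∈ a)

  ∈-at : ∀ {l : List A} {x} → x ∈ l → ∃[ n ] At l x n
  ∈-at (here refl) = _ , here
  ∈-at (there m) with ∈-at m
  ... | n , a = n , there a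

  at-ʳ++ : ∀ (d : List A) {x r} → At (d ʳ++ (x ∷ r)) x (length r)
  at-ʳ++ d = go d here
    where
    go : ∀ (d : List A) {l x n} → At l x n → At (d ʳ++ l) x n
    go [] a = a
    go (y ∷ d) a = go d (there a)

  at-unique : ∀ (l : List A) → (∀ {x n n′} → At l x n → At l x n′ → n ≡ n′) → Unique l
  at-unique [] f = []
  at-unique (x ∷ l) f = All.tabulate new ∷ at-unique l (λ a b → f (there a) (there b))
    where
    new : ∀ {y} → y ∈ l → x ≢ y
    new m refl with ∈-at m
    ... | n , a = ℕ.<⇒≢ (at-< a) (f (there a) here)

  replace : ∀ {l : List A} {x n} → At l x n → A → List A
  replace (here {l = l}) y = y ∷ l
  replace (there {y = z} a) y = z ∷ replace a y

  length-replace : ∀ {l : List A} {x n} (a : At l x n) y → length (replace a y) ≡ length l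
  length-replace here y = refl
  length-replace (there a) y = cong suc (length-replace a y)

  at-replace : ∀ {l : List A} {x n} (a : At l x n) y {z k} → At (replace a y) z k →
      (z ≡ y × k ≡ n) ⊎ (At l z k × k ≢ n)
  at-replace here y here = inj₁ (refl , refl)
  at-replace here y (there b) = inj₂ (there b , ℕ.<⇒≢ (at-< b))
  at-replace {l = z ∷ l} {n = n} (there a) y here = inj₂ (subst (At (z ∷ l) z) (sym (length-replace a y)) here ,
    λ eq → ℕ.<⇒≢ (subst (n <_) (sym (length-replace a y)) (at-< a)) (sym eq))
  at-replace (there a) y (there b) with at-replace a y b
  ... | inj₁ e = inj₁ e
  ... | inj₂ (c , neq) = inj₂ (there c , neq)

  ∈-replace : ∀ {l : List A} {x n} (a : At l x n) y {z} → z ∈ l → z ≢ x → z ∈ replace a y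
  ∈-replace here y (here refl) neq = contradiction refl neq
  ∈-replace here y (there m) neq = there m
  ∈-replace (there a) y (here eq) neq = here eq
  ∈-replace (there a) y (there m) neq = there (∈-replace a y m neq)

  ∈-replace-new : ∀ {l : List A} {x n} (a : At l x n) y → y ∈ replace a y
  ∈-replace-new here y = here refl
  ∈-replace-new (there a) y = there (∈-replace-new a y)

  count-replace : ∀ {P : A → Set} (P? : Decidable P) {l x n} (a : At l x n) y →
      count P? (replace a y) ≤ count P? (y ∷ l)
  count-replace P? (here {x} {l}) y with P? y
  ... | yes _ = s≤s (count-∷-≤ P? x l)
  ... | no _ = count-∷-≤ P? x l
  count-replace P? (there {y = z} a) y with P? y | count-replace P? a y
  ... | yes _ | le with P? z
  ...   | yes _ = s≤s le
  ...   | no _ = le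
  count-replace P? (there {y = z} a) y | no _ | le with P? z
  ...   | yes _ = s≤s le
  ...   | no _ = le

  -- Deletion from an array: the last entry is moved to the free place.
  remove : ∀ {l : List A} {x n} → At l x n → List A
  remove (here {l = l}) = l
  remove (there {y = y} a) = replace a y

  length-remove : ∀ {l : List A} {x n} (a : At l x n) → suc (length (remove a)) ≡ length l
  length-remove here = refl
  length-remove (there {y = y} a) = cong suc (length-replace a y)

  count-remove : ∀ {P : A → Set} (P? : Decidable P) {l x n} (a : At l x n) → count P? (remove a) ≤ count P? l
  count-remove P? (here {x} {l}) = count-∷-≤ P? x l
  count-remove P? (there {y = y} a) = count-replace P? a y

  ∈-remove : ∀ {l : List A} {x n} (a : At l x n) {z} → z ∈ l → z ≢ x → z ∈ remove a
  ∈-remove here (here refl) neq = contradiction refl neq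
  ∈-remove here (there m) neq = m
  ∈-remove (there {y = y} a) (here refl) neq = ∈-replace-new a y
  ∈-remove (there {y = y} a) (there m) neq = ∈-replace a y m neq

-- `y` is the head, the entry at the highest position, which `remove` moves to position n. If the
-- removed entry is itself the head, nothing moves and only the second alternative arises.
at-remove : ∀ {A : Set} {l : List A} {x n} (a : At l x n) → ∃[ y ] At l y (length (remove a)) ×
  (∀ {z k} → At (remove a) z k → (z ≡ y × k ≡ n) ⊎ (At l z k × k ≢ n))
at-remove {l = l} here = _ , here , λ c → inj₂ (there c , ℕ.<⇒≢ (at-< c))
at-remove {l = y ∷ l} (there a) = y , subst (At (y ∷ l) y) (sym (length-replace a y)) here , λ c →
    f (at-replace a y c)
  where
  f : ∀ {z k} → _ ⊎ (At l z k × _) → _ ⊎ (At (y ∷ l) z k × _)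
  f (inj₁ e) = inj₁ e
  f (inj₂ (c , neq)) = inj₂ (there c , neq)

-- Buckets of points and their representation in arrays

Buckets : Set
Buckets = ℕ → List Point

infix 9 _[_:=_]
_[_:=_] : ∀ {A : Set} → (ℕ → A) → ℕ → A → ℕ → A
(f [ b := v ]) b′ = if does (b′ ℕ.≟ b) then v else f b′

:=-same : ∀ {A : Set} (f : ℕ → A) b {v} → (f [ b := v ]) b ≡ v
:=-same f b rewrite dec-true (b ℕ.≟ b) refl = refl

:=-other : ∀ {A : Set} (f : ℕ → A) {b b′ v} → b′ ≢ b → (f [ b := v ]) b′ ≡ f b′
:=-other f {b} {b′} neq rewrite dec-false (b′ ℕ.≟ b) neq = refl

at-:= : ∀ (bs : Buckets) b {l} b′ {p n} → At ((bs [ b := l ]) b′) p n →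
    (b′ ≡ b × At l p n) ⊎ (b′ ≢ b × At (bs b′) p n)
at-:= bs b {l} b′ {p} {n} a with b′ ℕ.≟ b
... | yes refl = inj₁ (refl , subst (λ l → At l p n) (:=-same bs b′) a)
... | no neq   = inj₂ (neq , subst (λ l → At l p n) (:=-other bs neq) a)

∈-:= : ∀ (bs : Buckets) b {l} b′ {p} → p ∈ (bs [ b := l ]) b′ → (b′ ≡ b × p ∈ l) ⊎ (b′ ≢ b × p ∈ bs b′)
∈-:= bs b {l} b′ {p} a with b′ ℕ.≟ b
... | yes refl = inj₁ (refl , subst (p ∈_) (:=-same bs b′) a)
... | no neq   = inj₂ (neq , subst (p ∈_) (:=-other bs neq) a)

Stored : Buckets → Point → Set
Stored bs p = ∃[ b ] p ∈ bs b

-- Position n of bucket b is entry idx b n of the array sl. The arrays pos and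
-- wh locate a point; wh is the bucket plus one, and 0 for absent points.
record Rep (cnt sl pos wh : ℤ → ℤ) (bs : Buckets) : Set where
  constructor rep
  field
    cnt-ok : ∀ b → cnt (+ b) ≡ + length (bs b)
    sl-ok  : ∀ {b p n} → At (bs b) p n → sl (idx b n) ≡ code p
    pos-ok : ∀ {b p n} → At (bs b) p n → pos (code p) ≡ + n
    wh-ok  : ∀ {b p} → p ∈ bs b → wh (code p) ≡ + suc b
    absent : ∀ p → wh (code p) ≡ 0ℤ ⊎ Stored bs p

idx-≢ : ∀ {b n b′ n′} → ¬ (b ≡ b′ × n ≡ n′) → idx b n ≢ idx b′ n′
idx-≢ neq eq = neq (idx-injective eq)

code-≢ : ∀ {p q} → p ≢ q → code p ≢ code q
code-≢ neq eq = neq (code-injective eq)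

module _ {cnt sl pos wh : ℤ → ℤ} {bs : Buckets} (R : Rep cnt sl pos wh bs) where
  open Rep R

  -- The array `pos` has one entry per point, so a point cannot occupy two positions of a bucket. In
  -- the same way `wh` makes the buckets disjoint.
  rep-unique : ∀ b → Unique (bs b)
  rep-unique b = at-unique (bs b) (λ a a′ → ℤ.+-injective (trans (sym (pos-ok a)) (pos-ok a′)))

  rep-disjoint : ∀ {b b′ p} → p ∈ bs b → p ∈ bs b′ → b ≡ b′
  rep-disjoint m m′ = ℕ.suc-injective (ℤ.+-injective (trans (sym (wh-ok m)) (wh-ok m′)))

  wh0⇒∉ : ∀ {p} → wh (code p) ≡ 0ℤ → ¬ Stored bs p
  wh0⇒∉ eq (b , m) with () ← trans (sym (wh-ok m)) eq

  rep-push : ∀ {p} b → wh (code p) ≡ 0ℤ →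
    Rep (upd cnt (+ b) (+ suc (length (bs b)))) (upd sl (idx b (length (bs b))) (code p))
        (upd pos (code p) (+ length (bs b))) (upd wh (code p) (+ suc b)) (bs [ b := p ∷ bs b ])
  rep-push {p} b new = rep cnt′ sl′ pos′ wh′ absent′
    where
    fresh : ∀ {b q} → q ∈ bs b → code q ≢ code p
    fresh m eq with refl ← code-injective eq = wh0⇒∉ new (_ , m)
    cnt′ : ∀ b′ → upd cnt (+ b) _ (+ b′) ≡ + length ((bs [ b := p ∷ bs b ]) b′)
    cnt′ b′ with b′ ℕ.≟ b
    ... | yes refl = trans (upd-same cnt refl) (cong (λ l → + length l) (sym (:=-same bs b)))
    ... | no neq = trans (upd-other cnt (neq ∘ ℤ.+-injective))
        (trans (cnt-ok b′) (cong (λ l → + length l) (sym (:=-other bs neq))))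
    sl′ : ∀ {b′ q n} → At ((bs [ b := p ∷ bs b ]) b′) q n → _
    sl′ {b′} a with at-:= bs b b′ a
    ... | inj₁ (refl , here) = upd-same sl refl
    ... | inj₁ (refl , there a) = trans (upd-other sl (idx-≢ (λ (_ , e) → ℕ.<⇒≢ (at-< a) e))) (sl-ok a)
    ... | inj₂ (neq , a) = trans (upd-other sl (idx-≢ (λ (e , _) → neq e))) (sl-ok a)
    pos′ : ∀ {b′ q n} → At ((bs [ b := p ∷ bs b ]) b′) q n → _
    pos′ {b′} a with at-:= bs b b′ a
    ... | inj₁ (refl , here) = upd-same pos refl
    ... | inj₁ (refl , there a) = trans (upd-other pos (fresh (at-∈ a))) (pos-ok a)
    ... | inj₂ (neq , a) = trans (upd-other pos (fresh (at-∈ a))) (pos-ok a)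
    wh′ : ∀ {b′ q} → q ∈ (bs [ b := p ∷ bs b ]) b′ → upd wh (code p) (+ suc b) (code q) ≡ + suc b′
    wh′ {b′} m with ∈-:= bs b b′ m
    ... | inj₁ (refl , here refl) = upd-same wh refl
    ... | inj₁ (refl , there m) = trans (upd-other wh (fresh m)) (wh-ok m)
    ... | inj₂ (neq , m) = trans (upd-other wh (fresh m)) (wh-ok m)
    absent′ : ∀ q → upd wh (code p) (+ suc b) (code q) ≡ 0ℤ ⊎ Stored (bs [ b := p ∷ bs b ]) q
    absent′ q with q ≟ᴾ p
    ... | yes refl = inj₂ (b , subst (q ∈_) (sym (:=-same bs b)) (here refl))
    ... | no neq with absent q
    ...   | inj₁ e = inj₁ (trans (upd-other wh (code-≢ neq)) e)
    ...   | inj₂ (b′ , m) with b′ ℕ.≟ b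
    ...     | yes refl = inj₂ (b , subst (q ∈_) (sym (:=-same bs b)) (there m))
    ...     | no b′≢b = inj₂ (b′ , subst (q ∈_) (sym (:=-other bs b′≢b)) m)

  module _ {b : ℕ} {p : Point} {n : ℕ} (a : At (bs b) p n) where

    private
      y = proj₁ (at-remove a)
      y-at = proj₁ (proj₂ (at-remove a))

    remove-∈ : ∀ {q} → q ∈ remove a → q ∈ bs b × q ≢ p
    remove-∈ {q} m with ∈-at m
    ... | k , c with proj₂ (proj₂ (at-remove a)) c
    ...   | inj₁ (refl , refl) = at-∈ y-at , λ y≡p → ℕ.<⇒≢ (at-< c)
            (ℤ.+-injective (trans (sym (pos-ok a)) (trans (cong (pos ∘ code) (sym y≡p)) (pos-ok y-at))))
    ...   | inj₂ (d , neq) = at-∈ d , λ { refl → neq (ℤ.+-injective (trans (sym (pos-ok d)) (pos-ok a))) }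

    -- Every surviving entry keeps its place except the former top entry `y`. If `p` is on top, the
    -- writes to `sl` and `pos` concern an entry that is no longer in use, so the program needs no
    -- case distinction.
    rep-remove : ∀ {c} → c ≡ sl (idx b (length (remove a))) →
      Rep (upd cnt (+ b) (+ length (remove a))) (upd sl (idx b n) c) (upd pos c (+ n)) (upd wh (code p) 0ℤ)
          (bs [ b := remove a ])
    rep-remove refl rewrite sl-ok y-at = rep cnt′ sl′ pos′ wh′ absent′
      where
      old : ∀ {b′ q k} → At (bs b′) q k → ¬ (b′ ≡ b × k ≡ length (remove a)) → code q ≢ code y
      old {b′} {q} {k} d neq eq with refl ← code-injective {q} eq with refl ← rep-disjoint (at-∈ d) (at-∈ y-at)
        = neq (refl , ℤ.+-injective (trans (sym (pos-ok d)) (pos-ok y-at)))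
      cnt′ : ∀ b′ → upd cnt (+ b) _ (+ b′) ≡ + length ((bs [ b := remove a ]) b′)
      cnt′ b′ with b′ ℕ.≟ b
      ... | yes refl = trans (upd-same cnt refl) (cong (λ l → + length l) (sym (:=-same bs b)))
      ... | no neq = trans (upd-other cnt (neq ∘ ℤ.+-injective))
          (trans (cnt-ok b′) (cong (λ l → + length l) (sym (:=-other bs neq))))
      sl′ : ∀ {b′ q k} → At ((bs [ b := remove a ]) b′) q k → upd sl (idx b n) (code y) (idx b′ k) ≡ code q
      sl′ {b′} c with at-:= bs b b′ c
      ... | inj₂ (neq , d) = trans (upd-other sl (idx-≢ (λ (e , _) → neq e))) (sl-ok d)
      ... | inj₁ (refl , c) with proj₂ (proj₂ (at-remove a)) c
      ...   | inj₁ (refl , refl) = upd-same sl refl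
      ...   | inj₂ (d , neq) = trans (upd-other sl (idx-≢ (λ (_ , e) → neq e))) (sl-ok d)
      pos′ : ∀ {b′ q k} → At ((bs [ b := remove a ]) b′) q k → upd pos (code y) (+ n) (code q) ≡ + k
      pos′ {b′} c with at-:= bs b b′ c
      ... | inj₂ (neq , d) = trans (upd-other pos (old d (λ (e , _) → neq e))) (pos-ok d)
      ... | inj₁ (refl , c) with proj₂ (proj₂ (at-remove a)) c
      ...   | inj₁ (refl , refl) = upd-same pos refl
      ...   | inj₂ (d , neq) = trans (upd-other pos (old d (λ (_ , e) → ℕ.<⇒≢ (at-< c) e))) (pos-ok d)
      wh′ : ∀ {b′ q} → q ∈ (bs [ b := remove a ]) b′ → upd wh (code p) 0ℤ (code q) ≡ + suc b′
      wh′ {b′} m with ∈-:= bs b b′ m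
      ... | inj₂ (neq , m) = trans (upd-other wh (code-≢ λ { refl → neq (rep-disjoint m (at-∈ a)) })) (wh-ok m)
      ... | inj₁ (refl , m) with remove-∈ m
      ...   | m′ , neq = trans (upd-other wh (code-≢ neq)) (wh-ok m′)
      absent′ : ∀ q → upd wh (code p) 0ℤ (code q) ≡ 0ℤ ⊎ Stored (bs [ b := remove a ]) q
      absent′ q with q ≟ᴾ p
      ... | yes refl = inj₁ (upd-same wh refl)
      ... | no neq with absent q
      ...   | inj₁ e = inj₁ (trans (upd-other wh (code-≢ neq)) e)
      ...   | inj₂ (b′ , m) with b′ ℕ.≟ b
      ...     | yes refl = inj₂ (b , subst (q ∈_) (sym (:=-same bs b)) (∈-remove a m neq))
      ...     | no b′≢b = inj₂ (b′ , subst (q ∈_) (sym (:=-other bs b′≢b)) m)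

-- The data structure and the update programs

-- CNT, SL, POS and WH represent the buckets (see Rep), LA, LB and LC the lines of
-- the classes 1, 2, …; PX, PY and PD hold the homogeneous coordinates of a point,
-- indexed by its code. GG, JJ and LL contain g(k), min(k, g(k)) and the number of
-- trials of a query. KP is a stack of KN points.
CNT SL POS WH LA LB LC PX PY PD GG JJ LL : Array
CNT = 2
SL  = 3
POS = 4
WH  = 5
LA  = 6
LB  = 7
LC  = 8
PX  = 9
PY  = 10
PD  = 11
GG  = 12
JJ  = 13
LL  = 14

CUR TGT II SS QQ UU VV KEY HH FW WIT KP KN PB RB RI RN RL NN DD : Array
CUR = 15
TGT = 16
II  = 17
SS  = 18
QQ  = 19
UU  = 20
VV  = 21
KEY = 22
HH  = 23
FW  = 24
WIT = 25
KP  = 26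
KN  = 27
PB  = 28
RB  = 29
RI  = 30
RN  = 31
RL  = 32
NN  = 33
DD  = 34

zer uno : Exp
zer = lit 0ℤ
uno = lit (+ 1)

pairᴱ : Exp → Exp → Exp
pairᴱ d e = (d ⊕ e) ⊗ (d ⊕ e) ⊕ d

triᴱ : Exp → Exp
triᴱ e = e ⊗ (lit (+ 2) ⊗ e ⊕ uno)

lhsᴱ rhsᴱ : Exp → Exp → Exp
lhsᴱ b q = LA [ b ] ⊗ PX [ q ] ⊕ LB [ b ] ⊗ PY [ q ]
rhsᴱ b q = LC [ b ] ⊗ PD [ q ]

Uᴱ Vᴱ : Exp → Exp → Exp
Uᴱ p q = PX [ q ] ⊗ PD [ p ] ⊖ PX [ p ] ⊗ PD [ q ]
Vᴱ p q = PY [ q ] ⊗ PD [ p ] ⊖ PY [ p ] ⊗ PD [ q ]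

pushᴾ removeᴾ : Program
pushᴾ =
  (SL [ pairᴱ ($ PB) (CNT [ $ PB ]) ]≔ $ QQ) ⨾
  (POS [ $ QQ ]≔ CNT [ $ PB ]) ⨾
  (WH [ $ QQ ]≔ uno ⊕ $ PB) ⨾
  (CNT [ $ PB ]≔ uno ⊕ CNT [ $ PB ])
removeᴾ =
  (RB ≔ WH [ $ QQ ] ⊖ uno) ⨾
  (RI ≔ POS [ $ QQ ]) ⨾
  (RN ≔ CNT [ $ RB ] ⊖ uno) ⨾
  (RL ≔ SL [ pairᴱ ($ RB) ($ RN) ]) ⨾
  (CNT [ $ RB ]≔ $ RN) ⨾
  (SL [ pairᴱ ($ RB) ($ RI) ]≔ $ RL) ⨾
  (POS [ $ RL ]≔ $ RI) ⨾
  (WH [ $ QQ ]≔ zer)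

-- Empties bucket PB onto the stack.
drainᴾ : Program
drainᴾ = (II ≔ CNT [ $ PB ]) ⨾ for II
  ( (QQ ≔ SL [ pairᴱ ($ PB) ($ II) ]) ⨾ removeᴾ ⨾ ((KP [ $ KN ]≔ $ QQ) ⨾ (KN ≔ uno ⊕ $ KN)) )

-- A class through the point CUR, if any, becomes TGT.
scanᴾ : Program
scanᴾ = ((TGT ≔ zer) ⨾ (II ≔ $ GG)) ⨾ for II
  when zer ≺ CNT [ uno ⊕ $ II ]
  then when lhsᴱ (uno ⊕ $ II) ($ CUR) ≐ rhsᴱ (uno ⊕ $ II) ($ CUR) then TGT ≔ uno ⊕ $ II else skip end
  else skip end

-- `SS`, the sum of the squares of `U` over bucket 0, bounds each of these squares and so can serve
-- as the precision in `slope-key`. `HH` is never cleared as a whole: only the entries at keys of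
-- the present bucket are zeroed, in time linear in its size.
sumᴾ keyᴾ resetᴾ tallyᴾ detectᴾ : Program
sumᴾ = ((SS ≔ zer) ⨾ (II ≔ CNT [ zer ])) ⨾ for II
  ( (QQ ≔ SL [ pairᴱ zer ($ II) ]) ⨾ (UU ≔ Uᴱ ($ CUR) ($ QQ)) ⨾ (SS ≔ $ SS ⊕ $ UU ⊗ $ UU) )
keyᴾ =
  ((QQ ≔ SL [ pairᴱ zer ($ II) ]) ⨾ (UU ≔ Uᴱ ($ CUR) ($ QQ)) ⨾ (VV ≔ Vᴱ ($ CUR) ($ QQ))) ⨾
  when $ UU ≐ zer then KEY ≔ zer else KEY ≔ lit (+ 2) ⊗ (($ VV ⊗ $ UU ⊗ $ SS) ⊘ ($ UU ⊗ $ UU)) ⊕ uno end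
resetᴾ = (II ≔ CNT [ zer ]) ⨾ for II (keyᴾ ⨾ (HH [ $ KEY ]≔ zer))
tallyᴾ = ((FW ≔ zer) ⨾ (II ≔ CNT [ zer ])) ⨾ for II
  ( keyᴾ ⨾ (HH [ $ KEY ]≔ HH [ $ KEY ] ⊕ uno) ⨾
    when HH [ $ KEY ] ≺ $ GG then skip else (FW ≔ uno) ⨾ (WIT ≔ $ QQ) end )
detectᴾ = sumᴾ ⨾ resetᴾ ⨾ tallyᴾ

-- Opens a class for the line through CUR and WIT and moves the points of
-- bucket 0 on this line there.
freeᴾ lineᴾ splitᴾ createᴾ : Program
freeᴾ = (II ≔ $ GG) ⨾ for II
  when CNT [ uno ⊕ $ II ] ≐ zer then TGT ≔ uno ⊕ $ II else skip end
lineᴾ =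
  (UU ≔ Uᴱ ($ CUR) ($ WIT)) ⨾ (VV ≔ Vᴱ ($ CUR) ($ WIT)) ⨾
  (LA [ $ TGT ]≔ $ VV ⊗ PD [ $ CUR ]) ⨾
  (LB [ $ TGT ]≔ zer ⊖ $ UU ⊗ PD [ $ CUR ]) ⨾
  (LC [ $ TGT ]≔ $ VV ⊗ PX [ $ CUR ] ⊖ $ UU ⊗ PY [ $ CUR ])
splitᴾ = (II ≔ $ NN) ⨾ for II
  ( ((KN ≔ $ KN ⊖ uno) ⨾ (QQ ≔ KP [ $ KN ])) ⨾
    when lhsᴱ ($ TGT) ($ QQ) ≐ rhsᴱ ($ TGT) ($ QQ) then PB ≔ $ TGT else PB ≔ zer end ⨾
    pushᴾ )
createᴾ = freeᴾ ⨾ lineᴾ ⨾ ((PB ≔ zer) ⨾ (NN ≔ CNT [ zer ])) ⨾ drainᴾ ⨾ splitᴾ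

-- `TGT` is 0 if no class contains the point, and stays 0 unless a class is opened. As bucket 0 is
-- the one for remaining points, a single final push serves all three outcomes.
addᴾ : Program
addᴾ = when WH [ $ CUR ] ≐ zer
  then scanᴾ ⨾
       when $ TGT ≐ zer then detectᴾ ⨾ when $ FW ≐ zer then skip else createᴾ end else skip end ⨾
       ((PB ≔ $ TGT) ⨾ (QQ ≔ $ CUR)) ⨾ pushᴾ
  else skip end

codeᴱ : Exp
codeᴱ = pairᴱ (pairᴱ (pairᴱ (triᴱ (inp [ lit (+ 0) ])) (inp [ lit (+ 1) ])) (triᴱ (inp [ lit (+ 2) ])))
    (inp [ lit (+ 3) ])

-- `PX`, `PY` and `PD` are never erased, so a point on the stack can be inserted again from its code
-- alone. Reinsertions are counted by `DD`, since `addᴾ` uses `II` for its own loops.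
insertᴾ deleteᴾ : Program
insertᴾ =
  ( (CUR ≔ codeᴱ) ⨾ (KN ≔ zer) ⨾
    (PX [ $ CUR ]≔ inp [ lit (+ 0) ] ⊗ inp [ lit (+ 3) ]) ⨾
    (PY [ $ CUR ]≔ inp [ lit (+ 2) ] ⊗ inp [ lit (+ 1) ]) ⨾
    (PD [ $ CUR ]≔ inp [ lit (+ 1) ] ⊗ inp [ lit (+ 3) ]) ) ⨾
  addᴾ
deleteᴾ = ((QQ ≔ codeᴱ) ⨾ (KN ≔ zer)) ⨾
  when WH [ $ QQ ] ≐ zer then skip else
    removeᴾ ⨾
    when zer ≺ $ RB then
      when $ GG ≺ CNT [ $ RB ] then skip else
        (PB ≔ $ RB) ⨾ drainᴾ ⨾ (DD ≔ $ KN) ⨾ for DD (((KN ≔ $ KN ⊖ uno) ⨾ (CUR ≔ KP [ $ KN ])) ⨾ addᴾ)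
      end
    else skip end
  end

-- Memory contents and the elementary operations

RepM : Memory → Buckets → Set
RepM M bs = Rep (M CNT) (M SL) (M POS) (M WH) bs

rep-cong : ∀ {cnt sl pos wh cnt′ sl′ pos′ wh′ bs} → (∀ i → cnt′ i ≡ cnt i) → (∀ i → sl′ i ≡ sl i) →
  (∀ i → pos′ i ≡ pos i) → (∀ i → wh′ i ≡ wh i) → Rep cnt sl pos wh bs → Rep cnt′ sl′ pos′ wh′ bs
rep-cong c s p w (rep a b d e f) = rep (λ i → trans (c _) (a i)) (λ x → trans (s _) (b x))
    (λ x → trans (p _) (d x))
  (λ x → trans (w _) (e x)) (λ q → go q (f q))
  where
  go : ∀ q → _ → _
  go q (inj₁ e) = inj₁ (trans (w _) e)
  go q (inj₂ e) = inj₂ e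

rep-push-≡ : ∀ {cnt sl pos wh bs p b ib v is q vp vw} → Rep cnt sl pos wh bs → wh (code p) ≡ 0ℤ →
  ib ≡ + b → v ≡ + suc (length (bs b)) → is ≡ idx b (length (bs b)) → q ≡ code p → vp ≡ + length (bs b) →
      vw ≡ + suc b →
  Rep (upd cnt ib v) (upd sl is q) (upd pos q vp) (upd wh q vw) (bs [ b := p ∷ bs b ])
rep-push-≡ R new refl refl refl refl refl refl = rep-push R _ new

rep-remove-≡ : ∀ {cnt sl pos wh bs p b n ib v is c q vp} (R : Rep cnt sl pos wh bs) (a : At (bs b) p n) →
  ib ≡ + b → v ≡ + length (remove a) → is ≡ idx b n → c ≡ sl (idx b (length (remove a))) → q ≡ code p →
      vp ≡ + n →
  Rep (upd cnt ib v) (upd sl is c) (upd pos c vp) (upd wh q 0ℤ) (bs [ b := remove a ])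
rep-remove-≡ R a refl refl refl c refl refl = rep-remove R a c

push-run : ∀ {M X bs b p} → RepM M bs → M PB 0ℤ ≡ + b → M QQ 0ℤ ≡ code p → M WH (code p) ≡ 0ℤ →
  Runs pushᴾ M X (λ M′ → RepM M′ (bs [ b := p ∷ bs b ]))
push-run {M} {bs = bs} {b} {p} R eb eq new = run-block refl
  (rep-push-≡ R new eb (cong (ℤ._+_ (+ 1)) cnt) (trans (cong₂ pair eb cnt) (sym (idx-def b _))) eq cnt
      (cong (ℤ._+_ (+ 1)) eb))
  where
  cnt : M CNT (M PB 0ℤ) ≡ + length (bs b)
  cnt = trans (cong (M CNT) eb) (Rep.cnt-ok R b)

remove-run : ∀ {M X bs b p n} → RepM M bs → (a : At (bs b) p n) → M QQ 0ℤ ≡ code p →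
  Runs removeᴾ M X (λ M′ → RepM M′ (bs [ b := remove a ]) × M′ RB 0ℤ ≡ + b)
remove-run {M} {bs = bs} {b} {p} {n} R a eq = run-block refl
  ( rep-remove-≡ R a eb en (trans (cong₂ pair eb ei) (sym (idx-def b n)))
      (cong (M SL) (trans (cong₂ pair eb en) (sym (idx-def b _)))) eq ei
  , eb )
  where
  eb : M WH (M QQ 0ℤ) ℤ.- + 1 ≡ + b
  eb = cong (ℤ._- + 1) (trans (cong (M WH) eq) (Rep.wh-ok R (at-∈ a)))
  ei : M POS (M QQ 0ℤ) ≡ + n
  ei = trans (cong (M POS) eq) (Rep.pos-ok R a)
  en : M CNT (M WH (M QQ 0ℤ) ℤ.- + 1) ℤ.- + 1 ≡ + length (remove a)
  en = cong (ℤ._- + 1) (trans (cong (M CNT) eb) (trans (Rep.cnt-ok R b) (cong +_ (sym (length-remove a)))))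

StackM : Memory → List Point → Set
StackM M stk = M KN 0ℤ ≡ + length stk × (∀ {p n} → At stk p n → M KP (+ n) ≡ code p)

stack-push : ∀ {kp stk i p} → i ≡ + length stk → (∀ {q n} → At stk q n → kp (+ n) ≡ code q) →
  ∀ {c} → c ≡ code p → ∀ {q n} → At (p ∷ stk) q n → upd kp i c (+ n) ≡ code q
stack-push {kp} refl st refl here = upd-same kp refl
stack-push {kp} refl st refl (there a) = trans (upd-other kp (ℕ.<⇒≢ (at-< a) ∘ ℤ.+-injective)) (st a)

run-each₁ : ∀ {A : Set} {I body M₀} (Y : Scale) (l : List A) (Inv : (done rest : List A) → Memory → Set) →
  writes body I ≡ false →
  (∀ {d r M v} → Inv d r M → Inv d r (M [ I , 0ℤ ↦ v ])) →
  (∀ {d x r M} → Frame (for I body) M₀ M → M I 0ℤ ≡ + length r → d ʳ++ (x ∷ r) ≡ l →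
     Inv d (x ∷ r) M → Runs body M unit (Inv (x ∷ d) r)) →
  M₀ I 0ℤ ≡ + length l → length l ≤ size Y → Inv [] l M₀ →
  Runs (for I body) M₀ Y (λ M → ∃[ d ] (d ʳ++ [] ≡ l × Inv d [] M))
run-each₁ Y l Inv w st step e le i = run-mono (ℕ.≤-reflexive (ℕ.*-identityˡ (size Y)))
    (run-each {X = unit} Y l Inv w st step e le i)

run-for₁ : ∀ {I body M₀} (Y : Scale) (Inv : ℕ → Memory → Set) → writes body I ≡ false →
  (∀ {n M v} → Inv n M → Inv n (M [ I , 0ℤ ↦ v ])) →
  (∀ {n M} → Frame (for I body) M₀ M → M I 0ℤ ≡ + n → Inv (suc n) M → Runs body M unit (Inv n)) →
  ∀ n → M₀ I 0ℤ ≡ + n → n ≤ size Y → Inv n M₀ → Runs (for I body) M₀ Y (Inv 0)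
run-for₁ Y Inv w st step n e le i = run-mono (ℕ.≤-reflexive (ℕ.*-identityˡ (size Y)))
    (run-for {X = unit} Y Inv w st step n e le i)

-- Positions are visited from the top, so each removal takes the last entry and moves no other.
drain-run : ∀ {M bs stk b} (Y : Scale) → RepM M bs → StackM M stk → M PB 0ℤ ≡ + b → length (bs b) ≤ size Y →
  Runs drainᴾ M Y (λ M′ → ∃[ d ] d ʳ++ [] ≡ bs b × ∃[ bs′ ] RepM M′ bs′ × StackM M′ (d ++ stk) × bs′ b ≡ [] ×
      (∀ b′ → b′ ≢ b → bs′ b′ ≡ bs b′))
drain-run {M} {bs} {stk} {b} Y R st eb le = run-seq
  (run-block {Q = λ M′ → M′ II 0ℤ ≡ + length (bs b) × RepM M′ bs × StackM M′ stk} refl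
    (trans (cong (M CNT) eb) (Rep.cnt-ok R b) , R , st))
  λ {M₀} f₀ (ei , R , st) → run-each₁ Y (bs b) Inv refl id
      (λ f → body (trans (same f PB refl 0ℤ) (trans (same f₀ PB refl 0ℤ) eb)))
    ei le (bs , R , st , refl , λ _ _ → refl)
  where
  Inv : List Point → List Point → Memory → Set
  Inv d r M = ∃[ bs′ ] RepM M bs′ × StackM M (d ++ stk) × bs′ b ≡ r × (∀ b′ → b′ ≢ b → bs′ b′ ≡ bs b′)
  body : ∀ {d x r M} → M PB 0ℤ ≡ + b → M II 0ℤ ≡ + length r → d ʳ++ (x ∷ r) ≡ bs b → Inv d (x ∷ r) M →
    Runs _ M unit (Inv (x ∷ d) r)
  body {d} {x} {r} {M} eb ei _ (bs′ , R , st , top , oth) = run-seq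
    (run-block {Q = λ M′ → RepM M′ bs′ × StackM M′ (d ++ stk) × M′ QQ 0ℤ ≡ code x} refl
      (R , st , trans (cong (M SL) (trans (cong₂ pair eb ei) (sym (idx-def b _)))) (Rep.sl-ok R a)))
    λ _ (R , st , eq) → run-seq (remove-run R a eq)
    λ {M₂} f (R′ , _) → run-block refl
      ( bs′ [ b := remove a ] , R′ ,
        (cong (ℤ._+_ (+ 1)) (trans (same f KN refl 0ℤ) (proj₁ st)) ,
         stack-push {M₂ KP} (trans (same f KN refl 0ℤ) (proj₁ st))
             (λ c → trans (same f KP refl _) (proj₂ st c)) (trans (same f QQ refl 0ℤ) eq)) ,
        trans (:=-same bs′ b) (rem-top a top refl) , λ b′ neq → trans (:=-other bs′ neq) (oth b′ neq) )
    where
    a : At (bs′ b) x (length r)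
    a = subst (λ l → At l x (length r)) (sym top) here
    rem-top : ∀ {l n} (a : At l x n) → l ≡ x ∷ r → n ≡ length r → remove a ≡ r
    rem-top here refl _ = refl
    rem-top (there a) refl e = contradiction e (ℕ.<⇒≢ (at-< a))

Attr : Memory → Point → Set
Attr M p = M PX (code p) ≡ X p × M PY (code p) ≡ Y p × M PD (code p) ≡ D p

LinesM : Memory → (ℕ → Coefs) → Set
LinesM M L = ∀ b → M LA (+ b) ≡ proj₁ (L b) × M LB (+ b) ≡ proj₁ (proj₂ (L b)) × M LC (+ b) ≡ proj₂
    (proj₂ (L b))

attr-cong : ∀ {M M′ p} → (∀ i → M′ PX i ≡ M PX i) → (∀ i → M′ PY i ≡ M PY i) → (∀ i → M′ PD i ≡ M PD i) →
    Attr M p → Attr M′ p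
attr-cong x y d (ex , ey , ed) = trans (x _) ex , trans (y _) ey , trans (d _) ed

lines-cong : ∀ {M M′ L} → (∀ i → M′ LA i ≡ M LA i) → (∀ i → M′ LB i ≡ M LB i) → (∀ i → M′ LC i ≡ M LC i) →
    LinesM M L → LinesM M′ L
lines-cong x y z l b with l b
... | ea , eb , ec = trans (x _) ea , trans (y _) eb , trans (z _) ec

lhs rhs : Coefs → Point → ℤ
lhs (a , b , c) p = a ℤ.* X p ℤ.+ b ℤ.* Y p
rhs (a , b , c) p = c ℤ.* D p

lhs-eval : ∀ {M L b p d e} → LinesM M L → Attr M p → eval d M ≡ + b → eval e M ≡ code p →
    eval (lhsᴱ d e) M ≡ lhs (L b) p
lhs-eval {b = b} l (ex , ey , ed) eb ep rewrite eb | ep with l b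
... | ea , eb , ec = cong₂ ℤ._+_ (cong₂ ℤ._*_ ea ex) (cong₂ ℤ._*_ eb ey)

rhs-eval : ∀ {M L b p d e} → LinesM M L → Attr M p → eval d M ≡ + b → eval e M ≡ code p →
    eval (rhsᴱ d e) M ≡ rhs (L b) p
rhs-eval {b = b} l (ex , ey , ed) eb ep rewrite eb | ep with l b
... | ea , eb , ec = cong₂ ℤ._*_ ec ed

U-eval : ∀ {M p q d e} → Attr M p → Attr M q → eval d M ≡ code p → eval e M ≡ code q → eval (Uᴱ d e) M ≡ U p q
U-eval (px , py , pd) (qx , qy , qd) ep eq rewrite ep | eq = cong₂ ℤ._-_ (cong₂ ℤ._*_ qx pd) (cong₂ ℤ._*_ px qd)

V-eval : ∀ {M p q d e} → Attr M p → Attr M q → eval d M ≡ code p → eval e M ≡ code q → eval (Vᴱ d e) M ≡ V p q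
V-eval (px , py , pd) (qx , qy , qd) ep eq rewrite ep | eq = cong₂ ℤ._-_ (cong₂ ℤ._*_ qy pd) (cong₂ ℤ._*_ py qd)

nonempty : ∀ {l : List Point} → 0 < length l → l ≢ []
nonempty lt refl with () ← lt

empty : ∀ {l : List Point} → ¬ 0 < length l → l ≡ []
empty {[]} _ = refl
empty {x ∷ l} ¬lt = contradiction (s≤s z≤n) ¬lt

≤-split : ∀ {n i} → n ≤ i → n ≡ i ⊎ suc n ≤ i
≤-split le with ℕ.m≤n⇒m<n∨m≡n le
... | inj₁ lt = inj₂ lt
... | inj₂ e = inj₁ e

sparing : List Array → Program → Bool
sparing As p = foldr (λ A b → not (writes p A) ∧ b) true As

kept : ∀ {p M M′} As → sparing As p ≡ true → Frame p M M′ → ∀ {A} → A ∈ As → ∀ i → M′ A i ≡ M A i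
kept {p} As sp f m = same f _ (go As sp m)
  where
  go : ∀ As → sparing As p ≡ true → ∀ {A} → A ∈ As → writes p A ≡ false
  go (A ∷ As) e m with writes p A in w
  go (A ∷ As) e (here refl) | false = w
  go (A ∷ As) e (there m) | false = go As e m

RestM : ℕ → PointSet → (ℕ → Coefs) → Memory → Set
RestM m P L M = M GG 0ℤ ≡ + m × LinesM M L × (∀ {p} → p ∈ P → Attr M p)

CoreM : ℕ → PointSet → Buckets → (ℕ → Coefs) → Memory → Set
CoreM m P bs L M = RepM M bs × RestM m P L M

repArrays restArrays : List Array
repArrays = CNT ∷ SL ∷ POS ∷ WH ∷ []
restArrays = LA ∷ LB ∷ LC ∷ PX ∷ PY ∷ PD ∷ GG ∷ []

rep-frame : ∀ {p M M′ bs} → sparing repArrays p ≡ true → Frame p M M′ → RepM M bs → RepM M′ bs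
rep-frame sp f R = rep-cong (k (here refl)) (k (there (here refl))) (k (there (there (here refl))))
    (k (there (there (there (here refl))))) R
  where k = kept repArrays sp f

rest-frame : ∀ {m P L M M′ p} → sparing restArrays p ≡ true → Frame p M M′ → RestM m P L M → RestM m P L M′
rest-frame {M = M} {M′} sp f (eg , ls , at) = trans (k (s6 (here refl)) 0ℤ) eg ,
  lines-cong {M} {M′} (k (here refl)) (k (there (here refl))) (k (there (there (here refl)))) ls ,
  λ p∈ → attr-cong {M} {M′} (k (there (there (there (here refl)))))
      (k (there (there (there (there (here refl))))))
    (k (there (there (there (there (there (here refl))))))) (at p∈)
  where
  k = kept restArrays sp f
  s6 : ∀ {A : Array} {a b c d e g As} → A ∈ As → A ∈ a ∷ b ∷ c ∷ d ∷ e ∷ g ∷ As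
  s6 m = there (there (there (there (there (there m)))))

core-frame : ∀ {m P bs L M M′ p} → sparing repArrays p ≡ true → sparing restArrays p ≡ true → Frame p M M′ →
  CoreM m P bs L M → CoreM m P bs L M′
core-frame sp sp′ f (R , rest) = rep-frame sp f R , rest-frame sp′ f rest

-- Finding a class or a rich line through a new point

Scanned : ℕ → Buckets → (ℕ → Coefs) → Point → ℕ → ℤ → Set
Scanned m bs L p n t =
    (t ≡ 0ℤ × (∀ {i} → n ≤ i → i < m → bs (suc i) ≢ [] → ¬ p onᶻ L (suc i)))
  ⊎ (∃[ i ] t ≡ + suc i × i < m × bs (suc i) ≢ [] × p onᶻ L (suc i))

-- The loop counts down: with n iterations left, the classes of index n and above have been
-- examined.
scan-run : ∀ {M P bs L p m} (Z : Scale) → m ≤ size Z → CoreM m P bs L M → p ∈ P → M CUR 0ℤ ≡ code p →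
  Runs scanᴾ M Z (λ M′ → Scanned m bs L p 0 (M′ TGT 0ℤ))
scan-run {M} {P} {bs} {L} {p} {m} Z m≤Z core p∈P ep = run-seq
  (run-block {Q = λ M′ → Scanned m bs L p m (M′ TGT 0ℤ) × M′ II 0ℤ ≡ + m × CoreM m P bs L M′ × M′ CUR 0ℤ ≡ code
      p} refl
     (inj₁ (refl , λ m≤i i<m → contradiction i<m (ℕ.≤⇒≯ m≤i)) , proj₁ (proj₂ core) , core , ep))
  λ f₀ (sc , ei , core , ep) → run-post (λ _ (_ , sc) → sc)
      (run-for₁ Z (λ n M → n ≤ m × Scanned m bs L p n (M TGT 0ℤ)) refl id
    (λ f ei inv → body (core-frame refl refl f core) (trans (same f CUR refl 0ℤ) ep) ei inv)
    m ei m≤Z (ℕ.≤-refl , sc))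
  where
  step : ∀ {n t} → n < m → (bs (suc n) ≢ [] → ¬ p onᶻ L (suc n)) → Scanned m bs L p (suc n) t →
      Scanned m bs L p n t
  step n<m off (inj₁ (e , none)) = inj₁ (e , λ n≤i i<m ne o → go (≤-split n≤i) i<m ne o)
    where
    go : ∀ {i} → _ ≡ i ⊎ _ ≤ i → i < m → bs (suc i) ≢ [] → ¬ p onᶻ L (suc i)
    go (inj₁ refl) _ ne o = off ne o
    go (inj₂ lt) i<m ne o = none lt i<m ne o
  step n<m off (inj₂ x) = inj₂ x
  body : ∀ {n M} → CoreM m P bs L M → M CUR 0ℤ ≡ code p → M II 0ℤ ≡ + n →
    suc n ≤ m × Scanned m bs L p (suc n) (M TGT 0ℤ) → Runs _ M unit
        (λ M → n ≤ m × Scanned m bs L p n (M TGT 0ℤ))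
  body {n} {M} (R , _ , ls , at) ep ei (n<m , sc) = run-≺
    (λ lt → run-≐
      (λ eq → run-block refl (ℕ.<⇒≤ n<m , inj₂
          (n , eb , n<m , nonempty (ℤ.drop‿+<+ (subst (0ℤ ℤ.<_) cnt lt)) , trans (sym el) (trans eq er))))
      (λ neq → run-skip (ℕ.<⇒≤ n<m , step n<m (λ _ o → neq (trans el (trans o (sym er)))) sc)))
    (λ ¬lt → run-skip (ℕ.<⇒≤ n<m , step n<m
        (λ ne _ → ne (empty λ lt → ¬lt (subst (0ℤ ℤ.<_) (sym cnt) (ℤ.+<+ lt)))) sc))
    where
    eb : + 1 ℤ.+ M II 0ℤ ≡ + suc n
    eb = cong (ℤ._+_ (+ 1)) ei
    el = lhs-eval {M} {d = uno ⊕ $ II} {e = $ CUR} ls (at p∈P) eb ep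
    er = rhs-eval {M} {d = uno ⊕ $ II} {e = $ CUR} ls (at p∈P) eb ep
    cnt : M CNT (+ 1 ℤ.+ M II 0ℤ) ≡ + length (bs (suc n))
    cnt = trans (cong (λ i → M CNT (+ 1 ℤ.+ i)) ei) (Rep.cnt-ok R (suc n))

square : ∀ i → i ℤ.* i ≡ + (ℤ.∣ i ∣ * ℤ.∣ i ∣)
square (+ n) = sym (ℤ.pos-* n n)
square -[1+ n ] = refl

slope-key-vertical : ∀ {s u v} → u ≡ 0ℤ → slope-key s u v ≡ 0ℤ
slope-key-vertical {u = u} e with u ℤ.≟ 0ℤ
... | yes _ = refl
... | no ¬e = contradiction e ¬e

slope-key-oblique : ∀ {s u v} → u ≢ 0ℤ → slope-key s u v ≡ + 2 ℤ.* ((v ℤ.* u ℤ.* s) div (u ℤ.* u)) ℤ.+ + 1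
slope-key-oblique {u = u} ¬e with u ℤ.≟ 0ℤ
... | yes e = contradiction e ¬e
... | no _  = refl

module Detect {m : ℕ} {P : PointSet} {bs : Buckets} {L : ℕ → Coefs} {p : Point} (p∈P : p ∈ P)
              (R⊆P : ∀ {q} → q ∈ bs 0 → q ∈ P) (p∉R : p ∉ bs 0) (Z : Scale) (R≤Z : length (bs 0) ≤ size Z) where

  light : List Point
  light = bs 0

  Ctx : Memory → Set
  Ctx M = CoreM m P bs L M × M CUR 0ℤ ≡ code p

  fetch : ∀ {M q n} → Ctx M → M II 0ℤ ≡ + n → At light q n → M SL (pair 0ℤ (M II 0ℤ)) ≡ code q
  fetch {M} {q} {n} ((R , _) , _) ei a = trans (cong (M SL) (trans (cong (pair 0ℤ) ei) (sym (idx-def 0 n))))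
      (Rep.sl-ok R a)

  count-light : ∀ {M} → Ctx M → M CNT 0ℤ ≡ + length light
  count-light ((R , _) , _) = Rep.cnt-ok R 0

  SumOk : List Point → ℤ → Set
  SumOk d z = ∃[ s ] z ≡ + s × (∀ {q} → q ∈ d → ℤ.∣ U p q ∣ * ℤ.∣ U p q ∣ ≤ s)

  sum-run : ∀ {M} → Ctx M → Runs sumᴾ M Z (λ M′ → SumOk light (M′ SS 0ℤ))
  sum-run {M} c = run-seq
    (run-block {Q = λ M′ → SumOk [] (M′ SS 0ℤ) × M′ II 0ℤ ≡ + length light × Ctx M′} refl
        ((0 , refl , λ ()) , count-light {M} c , c))
    λ _ (so , ei , c) → run-post (λ { _ (d , e , s , es , so) → s , es , λ m → so (∈-ʳ++[]⁻ d e m) })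
      (run-each₁ Z light (λ d r M → SumOk d (M SS 0ℤ)) refl id
        (λ f ei e so → body (core-frame refl refl f (proj₁ c) , trans (same f CUR refl 0ℤ) (proj₂ c)) ei e so)
            ei R≤Z so)
    where
    body : ∀ {d x r M} → Ctx M → M II 0ℤ ≡ + length r → d ʳ++ (x ∷ r) ≡ light → SumOk d (M SS 0ℤ) →
      Runs _ M unit (λ M → SumOk (x ∷ d) (M SS 0ℤ))
    body {d} {x} {r} {M} c@((R , _ , _ , at) , ep) ei e (s , es , so) = run-block refl
      (s + k * k , trans (cong₂ ℤ._+_ es (trans (cong₂ ℤ._*_ eu eu) (square (U p x)))) refl , ok)
      where
      k = ℤ.∣ U p x ∣
      a : At light x (length r)
      a = subst (λ l → At l x (length r)) e (at-ʳ++ d)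
      eq : M SL (pair 0ℤ (M II 0ℤ)) ≡ code x
      eq = fetch {M} c ei a
      eu : _ ≡ U p x
      eu = U-eval {M [ QQ , 0ℤ ↦ M SL (pair 0ℤ (M II 0ℤ)) ]} {d = $ CUR} {e = $ QQ} (at p∈P)
          (at (R⊆P (at-∈ a))) ep eq
      ok : ∀ {q} → q ∈ x ∷ d → ℤ.∣ U p q ∣ * ℤ.∣ U p q ∣ ≤ s + k * k
      ok (here refl) = ℕ.m≤n+m (k * k) s
      ok (there m) = ℕ.≤-trans (so m) (ℕ.m≤m+n s (k * k))

  module Keyed (s : ℕ) (big : ∀ {q} → q ∈ light → ℤ.∣ U p q ∣ * ℤ.∣ U p q ∣ ≤ s) where

    key : Point → ℤ
    key q = slope-key (+ s) (U p q) (V p q)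

    Ctx′ : Memory → Set
    Ctx′ M = Ctx M × M SS 0ℤ ≡ + s

    key-run : ∀ {M X q n} → Ctx′ M → M II 0ℤ ≡ + n → At light q n →
        Runs keyᴾ M X (λ M′ → M′ KEY 0ℤ ≡ key q × M′ QQ 0ℤ ≡ code q)
    key-run {M} {q = q} (c@((R , _ , _ , at) , ep) , es) ei a = run-seq
      (run-block {Q = λ M′ → M′ UU 0ℤ ≡ U p q × M′ VV 0ℤ ≡ V p q × M′ QQ 0ℤ ≡ code q × M′ SS 0ℤ ≡ + s} refl
        ( U-eval {M [ QQ , 0ℤ ↦ M SL (pair 0ℤ (M II 0ℤ)) ]} {d = $ CUR} {e = $ QQ} (at p∈P) (at (R⊆P (at-∈ a)))
            ep eq
        , V-eval {M [ QQ , 0ℤ ↦ M SL (pair 0ℤ (M II 0ℤ)) ]} {d = $ CUR} {e = $ QQ} (at p∈P) (at (R⊆P (at-∈ a)))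
            ep eq
        , eq , es ))
      λ _ (eu , ev , eq , es) → run-≐
        (λ e → run-block refl (sym (slope-key-vertical {+ s} {U p q} {V p q} (trans (sym eu) e)) , eq))
        (λ e → run-block refl (trans (cong (λ y → + 2 ℤ.* y ℤ.+ + 1)
            (cong₂ _div_ (cong₂ ℤ._*_ (cong₂ ℤ._*_ ev eu) es) (cong₂ ℤ._*_ eu eu)))
                                 (sym (slope-key-oblique {+ s} {U p q} {V p q} (λ e′ → e (trans eu e′)))) , eq))
      where
      eq = fetch {M} c ei a

    reset-run : ∀ {M} → Ctx′ M → Runs resetᴾ M Z (λ M′ → ∀ {q} → q ∈ light → M′ HH (key q) ≡ 0ℤ)
    reset-run {M} c = run-seq
      (run-block {Q = λ M′ → M′ II 0ℤ ≡ + length light × Ctx′ M′} refl (count-light {M} (proj₁ c) , c))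
      λ _ (ei , c) → run-post (λ { _ (d , e , h) m → h (∈-ʳ++[]⁻ d e m) })
        (run-each₁ Z light (λ d r M → ∀ {q} → q ∈ d → M HH (key q) ≡ 0ℤ) refl id
          (λ f ei e h → body ((core-frame refl refl f (proj₁ (proj₁ c)) ,
              trans (same f CUR refl 0ℤ) (proj₂ (proj₁ c))) , trans (same f SS refl 0ℤ) (proj₂ c)) ei e h)
          ei R≤Z λ ())
      where
      body : ∀ {d x r M} → Ctx′ M → M II 0ℤ ≡ + length r → d ʳ++ (x ∷ r) ≡ light →
          (∀ {q} → q ∈ d → M HH (key q) ≡ 0ℤ) →
        Runs _ M unit (λ M → ∀ {q} → q ∈ x ∷ d → M HH (key q) ≡ 0ℤ)
      body {d} {x} {r} {M} c ei e h = run-seq (key-run {M} c ei (subst (λ l → At l x (length r)) e (at-ʳ++ d)))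
        λ {M₁} f (ek , _) → run-block refl λ
          { (here refl) → upd-same (M₁ HH) (sym ek)
          ; {q} (there m) → zero-or M₁ (key q) (trans (same f HH refl _) (h m)) }
        where
        zero-or : ∀ M k → M HH k ≡ 0ℤ → upd (M HH) (M KEY 0ℤ) 0ℤ k ≡ 0ℤ
        zero-or M k e with k ℤ.≟ M KEY 0ℤ
        ... | yes e′ = upd-same (M HH) e′
        ... | no ne = trans (upd-other (M HH) ne) e

    tally : List Point → ℤ → ℕ
    tally l h = count (λ x → key x ℤ.≟ h) l

    -- The counters are described at the keys of the whole bucket, including points not yet
    -- processed, because those counters will be incremented later.
    Tallied : List Point → Memory → Set
    Tallied d M = (∀ {q} → q ∈ light → M HH (key q) ≡ + tally d (key q)) ×
      ( (M FW 0ℤ ≡ 0ℤ × (∀ {q} → q ∈ d → tally d (key q) < m))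
      ⊎ (M FW 0ℤ ≡ + 1 × ∃[ q ] q ∈ light × M WIT 0ℤ ≡ code q × m ≤ tally d (key q)) )

    tally-run : ∀ {M} → Ctx′ M → (∀ {q} → q ∈ light → M HH (key q) ≡ 0ℤ) → Runs tallyᴾ M Z (Tallied light)
    tally-run {M} c h = run-seq
      (run-block {Q = λ M′ → M′ II 0ℤ ≡ + length light × Ctx′ M′ × Tallied [] M′} refl
          (count-light {M} (proj₁ c) , c , h , inj₁ (refl , λ ())))
      λ _ (ei , c , t) → run-post (λ { {M′} _ (d , e , t) → fin d {M′} e t })
        (run-each₁ Z light (λ d r M → Tallied d M) refl id
          (λ f ei e t → body ((core-frame refl refl f (proj₁ (proj₁ c)) ,
              trans (same f CUR refl 0ℤ) (proj₂ (proj₁ c))) , trans (same f SS refl 0ℤ) (proj₂ c)) ei e t)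
          ei R≤Z t)
      where
      fin : ∀ d {M} → d ʳ++ [] ≡ light → Tallied d M → Tallied light M
      fin d {M} e (h , w) = (λ m → trans (h m) (cong +_ (ct _))) , go w
        where
        ct : ∀ k → tally d k ≡ tally light k
        ct k = trans (sym (trans (count-ʳ++ (λ x → key x ℤ.≟ k) d []) (ℕ.+-identityʳ _)))
            (cong (λ l → tally l k) e)
        go : _ → _
        go (inj₁ (e′ , f)) = inj₁ (e′ , λ {q} m → subst (_< m′) (ct (key q)) (f (∈-ʳ++[]⁻ d e m)))
          where m′ = m
        go (inj₂ (e′ , q , q∈ , eq , le)) = inj₂ (e′ , q , q∈ , eq , subst (m ≤_) (ct (key q)) le)
      body : ∀ {d x r M} → Ctx′ M → M II 0ℤ ≡ + length r → d ʳ++ (x ∷ r) ≡ light → Tallied d M →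
          Runs _ M unit (Tallied (x ∷ d))
      body {d} {x} {r} {M} c@(((_ , eg , _) , _) , _) ei e (h , w) = run-seq (key-run {M} c ei a)
        λ {M₁} f (ek , eq) → run-seq
          (run-block {Q = λ M′ → (∀ {q} → q ∈ light → M′ HH (key q) ≡ + tally (x ∷ d) (key q)) × M′ KEY 0ℤ ≡
              key x × M′ QQ 0ℤ ≡ code x
                                  × M′ GG 0ℤ ≡ + m × M′ FW 0ℤ ≡ M FW 0ℤ × M′ WIT 0ℤ ≡ M WIT 0ℤ} refl
             (bump M₁ ek (λ m → trans (same f HH refl _) (h m)) , ek , eq , trans (same f GG refl 0ℤ) eg ,
                 same f FW refl 0ℤ , same f WIT refl 0ℤ))
          λ {M₂} _ (h , ek , eq , eg , ef , ew) → run-≺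
            (λ lt → run-skip (h , small (ℤ.drop‿+<+ (subst₂ ℤ._<_ (trans (cong (M₂ HH) ek) (h x∈)) eg lt)) ef
                ew w))
            (λ ¬lt → run-block refl (h , inj₂ (refl , x , x∈ , eq ,
               ℕ.≮⇒≥ λ lt → ¬lt (subst₂ ℤ._<_ (sym (trans (cong (M₂ HH) ek) (h x∈))) (sym eg) (ℤ.+<+ lt)))))
        where
        a : At light x (length r)
        a = subst (λ l → At l x (length r)) e (at-ʳ++ d)
        x∈ : x ∈ light
        x∈ = at-∈ a
        bump : ∀ M → M KEY 0ℤ ≡ key x → (∀ {q} → q ∈ light → M HH (key q) ≡ + tally d (key q)) →
          ∀ {q} → q ∈ light → upd (M HH) (M KEY 0ℤ) (M HH (M KEY 0ℤ) ℤ.+ + 1) (key q) ≡ + tally (x ∷ d) (key q)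
        bump M ek h {q} m with key x ℤ.≟ key q
        ... | yes e = trans (upd-same (M HH) (trans (sym e) (sym ek)))
                        (trans (cong (ℤ._+ + 1) (trans (cong (M HH) (trans ek e)) (h m)))
                            (cong +_ (ℕ.+-comm _ 1)))
        ... | no ne = trans (upd-other (M HH) (λ e → ne (trans (sym ek) (sym e)))) (h m)
        small : ∀ {f w} → tally (x ∷ d) (key x) < m → f ≡ M FW 0ℤ → w ≡ M WIT 0ℤ → _ →
          (f ≡ 0ℤ × (∀ {q} → q ∈ x ∷ d → tally (x ∷ d) (key q) < m)) ⊎
              (f ≡ + 1 × ∃[ q ] q ∈ light × w ≡ code q × m ≤ tally (x ∷ d) (key q))
        small lt ef ew (inj₁ (e , f)) = inj₁ (trans ef e , g)
          where
          g : ∀ {q} → q ∈ x ∷ d → tally (x ∷ d) (key q) < m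
          g (here refl) = lt
          g {q} (there m′) = case m′
            where
            case : q ∈ d → tally (x ∷ d) (key q) < m
            case m′ with key x ℤ.≟ key q in eqn
            ... | no _ = f m′
            ... | yes e = subst (_< m) (trans (cong (tally (x ∷ d)) e) (count-yes (λ y → key y ℤ.≟ key q) d e))
                lt
        small lt ef ew (inj₂ (e , q , q∈ , eq , le)) = inj₂
            (trans ef e , q , q∈ , trans ew eq , ℕ.≤-trans le (count-∷-≤ (λ y → key y ℤ.≟ key q) x d))

    p≢ : ∀ {q} → q ∈ light → ¬ (U p q ≡ 0ℤ × V p q ≡ 0ℤ)
    p≢ m (eu , ev) = p∉R (subst (_∈ light) (sym (U-V≡0 eu ev)) m)

    -- `big` makes `s` a precision at which keys separate slopes. Together with `on⇒key` this shows
    -- that points of the bucket share a key when they lie on a common line through `p`, so the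
    -- table counts points per line.
    key⇒on : ∀ {q x} → q ∈ light → x ∈ light → key x ≡ key q → x onᶻ join p q
    key⇒on {q} {x} q∈ x∈ e = join-on p q x
        (slope-key-injective s {U p q} {V p q} {U p x} {V p x} (big q∈) (big x∈) (sym e))

    on⇒key : ∀ {q x} → q ∈ light → x ∈ light → x onᶻ join p q → key x ≡ key q
    on⇒key {q} {x} q∈ x∈ o = sym (slope-key-cong (+ s) {U p q} {V p q} {U p x} {V p x} (p≢ q∈) (p≢ x∈)
        (join-on⁻ p q x o))

  -- The threshold is m and not m + 1 because `p` itself, still outside the bucket, is one more
  -- point of the line.
  Detected : ℤ → ℤ → Set
  Detected f w = (f ≡ 0ℤ × (∀ {q} → q ∈ light → count (_onᶻ? join p q) light < m))
    ⊎ (f ≡ + 1 × ∃[ q ] q ∈ light × w ≡ code q × m ≤ count (_onᶻ? join p q) light)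

  detect-run : ∀ {M} → Ctx M → Runs detectᴾ M Z (λ M′ → Detected (M′ FW 0ℤ) (M′ WIT 0ℤ))
  detect-run {M} c@(core , ep) = run-seq (sum-run {M} c) λ f (s , es , big) → let open Keyed s big in
    let c₁ = core-frame refl refl f core , trans (same f CUR refl 0ℤ) ep in
    run-seq (reset-run (c₁ , es)) λ f′ h →
    run-post (λ { _ (_ , inj₁ (e , few)) → inj₁
        (e , λ {q} m → ℕ.≤-<-trans (count-mono (_onᶻ? join p q) (λ x → key x ℤ.≟ key q) light
        (λ x∈ o → on⇒key m x∈ o)) (few m))
                ; _ (_ , inj₂ (e , q , q∈ , eq , le)) → inj₂
                    (e , q , q∈ , eq , ℕ.≤-trans le
                    (count-mono (λ x → key x ℤ.≟ key q) (_onᶻ? join p q) light (λ x∈ e → key⇒on q∈ x∈ e))) })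
      (tally-run ((core-frame refl refl f′ (proj₁ c₁) , trans (same f′ CUR refl 0ℤ) (proj₂ c₁)) ,
          trans (same f′ SS refl 0ℤ) es) h)

-- Only nonempty classes are constrained; an empty one is free for a new line, whatever coefficients
-- are left in memory. Lines are told apart as sets of points, since their coefficients are not
-- normalised.
record Good (m : ℕ) (bs : Buckets) (L : ℕ → Coefs) : Set where
  constructor good
  field
    heavy : ∀ i → bs (suc i) ≢ [] →
            i < m × suc m ≤ length (bs (suc i)) × Proper (L (suc i)) ×
                (∀ {q} → q ∈ bs (suc i) → q onᶻ L (suc i))
    apart : ∀ {i j} → i ≢ j → bs (suc i) ≢ [] → bs (suc j) ≢ [] →
            ¬ ((∀ r → r onᶻ L (suc i) → r onᶻ L (suc j)) × (∀ r → r onᶻ L (suc j) → r onᶻ L (suc i)))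
    light : ∀ ℓ → count (_on? ℓ) (bs 0) ≤ m

-- Opening a class

[]? : (l : List Point) → Dec (l ≡ [])
[]? [] = yes refl
[]? (x ∷ l) = no λ ()

-- If all m classes were occupied, their lines and the new one would be m + 1 rich lines, two of
-- which coincide by `few-rich`. Class lines differ by `apart`, and the new line contains `p`, which
-- lies on no class line.
free-class : ∀ {m P bs L p t} → CoverableBy m P → Good m bs L → (∀ b → Unique (bs b)) →
    (∀ {b q} → q ∈ bs b → q ∈ P) →
  Rich m P t → p onᶻ t → (∀ {i} → i < m → bs (suc i) ≢ [] → ¬ p onᶻ L (suc i)) → ∃[ i ] i < m × bs (suc i) ≡ []
free-class {m} {P} {bs} {L} {p} {t} cov (good heavy apart light) uniq sub r p-on off
  with Fin.any? (λ (i : Fin m) → []? (bs (suc (toℕ i))))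
... | yes (i , e) = toℕ i , Fin.toℕ<n i , e
... | no full = contradiction (few-rich cov ts rs) λ (i , j , i<j , f , g) → clash i j i<j f g
  where
  ts : Fin (suc m) → Coefs
  ts Fin.zero = t
  ts (Fin.suc i) = L (suc (toℕ i))
  rs : ∀ i → Rich m P (ts i)
  rs Fin.zero = r
  rs (Fin.suc i) with heavy (toℕ i) (λ e → full (i , e))
  ... | _ , many , proper , ons = rich (bs (suc (toℕ i))) (uniq _) many sub ons proper
  clash : ∀ i j → i Fin.< j → (∀ r → r onᶻ ts i → r onᶻ ts j) → (∀ r → r onᶻ ts j → r onᶻ ts i) → _
  clash Fin.zero (Fin.suc j) _ f _ = off (Fin.toℕ<n j) (λ e → full (j , e)) (f p p-on)
  clash (Fin.suc i) (Fin.suc j) i<j f g = apart (ℕ.<⇒≢ (ℕ.s≤s⁻¹ i<j)) (λ e → full (i , e)) (λ e → full (j , e))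
      (f , g)

ʳ++-flip : ∀ {A : Set} (d : List A) {l} → d ʳ++ [] ≡ l → d ≡ l ʳ++ []
ʳ++-flip d {l} e = trans (sym (++-identityʳ d)) (trans (sym (ʳ++-ʳ++ d {[]} {[]})) (cong (_ʳ++ []) e))

free-run : ∀ {M m P bs L} (Z : Scale) → m ≤ size Z → CoreM m P bs L M → (∃[ i ] i < m × bs (suc i) ≡ []) →
  Runs freeᴾ M Z (λ M′ → ∃[ i ] M′ TGT 0ℤ ≡ + suc i × i < m × bs (suc i) ≡ [])
free-run {M} {m} {P} {bs} {L} Z m≤Z core (i₀ , i₀<m , e₀) = run-seq
  (run-block {Q = λ M′ → M′ II 0ℤ ≡ + m × CoreM m P bs L M′} refl (proj₁ (proj₂ core) , core))
  λ f₀ (ei , core) → run-post (λ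
      { _ (_ , inj₁ found) → found ; _ (_ , inj₂ none) → contradiction e₀ (none z≤n i₀<m) })
    (run-for₁ Z Inv refl id (λ f ei inv → body (core-frame refl refl f core) ei inv) m ei m≤Z
      (ℕ.≤-refl , inj₂ λ m≤i i<m → contradiction i<m (ℕ.≤⇒≯ m≤i)))
  where
  Found : ℕ → ℤ → Set
  Found n t = (∃[ i ] t ≡ + suc i × i < m × bs (suc i) ≡ []) ⊎ (∀ {i} → n ≤ i → i < m → bs (suc i) ≢ [])
  Inv : ℕ → Memory → Set
  Inv n M = n ≤ m × Found n (M TGT 0ℤ)
  body : ∀ {n M} → CoreM m P bs L M → M II 0ℤ ≡ + n → Inv (suc n) M → Runs _ M unit (Inv n)
  body {n} {M} (R , _) ei (n<m , w) = run-≐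
    (λ e → run-block refl (ℕ.<⇒≤ n<m , inj₁
        (n , cong (ℤ._+_ (+ 1)) ei , n<m , empty (λ lt → ℕ.<⇒≢ lt (sym (ℤ.+-injective (trans (sym cnt) e)))))))
    (λ ne → run-skip (ℕ.<⇒≤ n<m , step (λ e → ne (trans cnt (cong (λ l → + length l) e))) w))
    where
    cnt : M CNT (+ 1 ℤ.+ M II 0ℤ) ≡ + length (bs (suc n))
    cnt = trans (cong (λ i → M CNT (+ 1 ℤ.+ i)) ei) (Rep.cnt-ok R (suc n))
    step : ∀ {t} → bs (suc n) ≢ [] → Found (suc n) t → Found n t
    step ne (inj₁ x) = inj₁ x
    step ne (inj₂ none) = inj₂ λ n≤i → go (≤-split n≤i)
      where
      go : ∀ {i} → n ≡ i ⊎ suc n ≤ i → i < m → bs (suc i) ≢ []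
      go (inj₁ refl) _ = ne
      go (inj₂ lt) i<m = none lt i<m

lines-upd : ∀ {M M′ : Memory} {L b t} → LinesM M L → ∀ {i x y z} → i ≡ + b → x ≡ proj₁ t →
    y ≡ proj₁ (proj₂ t) → z ≡ proj₂ (proj₂ t) →
  (∀ j → M′ LA j ≡ upd (M LA) i x j) → (∀ j → M′ LB j ≡ upd (M LB) i y j) →
      (∀ j → M′ LC j ≡ upd (M LC) i z j) → LinesM M′ (L [ b := t ])
lines-upd {M} {L = L} {b} {t} ls refl refl refl refl ea eb ec b′ with b′ ℕ.≟ b
... | yes refl = trans (ea _) (trans (upd-same (M LA) refl) (cong proj₁ e)) ,
    trans (eb _) (trans (upd-same (M LB) refl) (cong (proj₁ ∘ proj₂) e)) ,
                 trans (ec _) (trans (upd-same (M LC) refl) (cong (proj₂ ∘ proj₂) e))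
  where
  e : t ≡ (L [ b := t ]) b
  e = sym (:=-same L b)
... | no ne with ls b′
...   | la , lb , lc = trans (ea _) (trans (upd-other (M LA) (ne ∘ ℤ.+-injective)) (trans la (cong proj₁ e))) ,
                       trans (eb _) (trans (upd-other (M LB) (ne ∘ ℤ.+-injective))
                           (trans lb (cong (proj₁ ∘ proj₂) e))) ,
                       trans (ec _) (trans (upd-other (M LC) (ne ∘ ℤ.+-injective))
                           (trans lc (cong (proj₂ ∘ proj₂) e)))
  where
  e : L b′ ≡ (L [ b := t ]) b′
  e = sym (:=-other L ne)

line-run : ∀ {M X m P bs L p q b} → CoreM m P bs L M → p ∈ P → q ∈ P → M CUR 0ℤ ≡ code p → M WIT 0ℤ ≡ code q →
    M TGT 0ℤ ≡ + b →
  Runs lineᴾ M X (CoreM m P bs (L [ b := join p q ]))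
line-run {M} {p = p} {q} (R , eg , ls , at) p∈ q∈ ep eq et = run-block refl
  (R , eg , lines-upd {M} {exec lineᴾ M} ls et (cong₂ ℤ._*_ ev ed) (cong (ℤ._-_ 0ℤ) (cong₂ ℤ._*_ eu ed))
      (cong₂ ℤ._-_ (cong₂ ℤ._*_ ev ex) (cong₂ ℤ._*_ eu ey))
     (λ _ → refl) (λ _ → refl) (λ _ → refl) , at)
  where
  eu = U-eval {M} {d = $ CUR} {e = $ WIT} (at p∈) (at q∈) ep eq
  ev = V-eval {M} {d = $ CUR} {e = $ WIT} (at p∈) (at q∈) ep eq
  ex : M PX (M CUR 0ℤ) ≡ X p
  ex = trans (cong (M PX) ep) (proj₁ (at p∈))
  ey : M PY (M CUR 0ℤ) ≡ Y p
  ey = trans (cong (M PY) ep) (proj₁ (proj₂ (at p∈)))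
  ed : M PD (M CUR 0ℤ) ≡ D p
  ed = trans (cong (M PD) ep) (proj₂ (proj₂ (at p∈)))

core-push : ∀ {m P bs bs′ L M M′} → Frame pushᴾ M M′ → RepM M′ bs′ → CoreM m P bs L M → CoreM m P bs′ L M′
core-push f R′ (_ , rest) = R′ , rest-frame refl f rest

stack-frame : ∀ {M M′ stk p} → writes p KN ≡ false → writes p KP ≡ false → Frame p M M′ → StackM M stk →
    StackM M′ stk
stack-frame w w′ f (e , st) = trans (same f KN w 0ℤ) e , λ a → trans (same f KP w′ _) (st a)

stack-pop : ∀ {M p stk} → StackM M (p ∷ stk) → M KN 0ℤ ℤ.- + 1 ≡ + length stk × M KP (M KN 0ℤ ℤ.- + 1) ≡ code p
stack-pop {M} (e , st) = cong (ℤ._- + 1) e , trans (cong (λ i → M KP (i ℤ.- + 1)) e) (st here)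

-- The points of `dn` have been distributed over buckets 0 and T, those of `r` are still on the
-- stack. `many` will make the new class large enough, and `fewer` carries over the bound for bucket
-- 0.
record Parted (t : Coefs) (T : ℕ) (bs : Buckets) (dn r : List Point) (bs′ : Buckets) : Set where
  field
    others  : ∀ b → b ≢ 0 → b ≢ T → bs′ b ≡ bs b
    from    : ∀ {q} → q ∈ bs′ 0 → q ∈ dn
    fromT   : ∀ {q} → q ∈ bs′ T → q ∈ dn × q onᶻ t
    into    : ∀ {q} → q ∈ dn → q ∈ bs′ 0 ⊎ q ∈ bs′ T
    many    : count (_onᶻ? t) dn ≤ length (bs′ T)
    fewer   : ∀ ℓ → count (_on? ℓ) (bs′ 0) ≤ count (_on? ℓ) dn
    pending : ∀ {q} → q ∈ r → ¬ Stored bs′ q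
    unique  : Unique r

-- The stack may hold further points `stk` below `pend`: during a deletion these await reinsertion
-- and must be left in place.
module Split {m : ℕ} {P : PointSet} {L : ℕ → Coefs} {stk : List Point} {T : ℕ} {bs : Buckets} (T≢0 : T ≢ 0)
    (empty₀ : bs 0 ≡ []) (emptyT : bs T ≡ []) (pend : List Point)
  (pend⊆P : ∀ {q} → q ∈ pend → q ∈ P) where

  open Parted

  start : (∀ {q} → q ∈ pend → ¬ Stored bs q) → Unique pend → Parted (L T) T bs [] pend bs
  start new u .others b _ _ = refl
  start new u .from m = contradiction (subst (_ ∈_) empty₀ m) λ ()
  start new u .fromT m = contradiction (subst (_ ∈_) emptyT m) λ ()
  start new u .into ()
  start new u .many = z≤n
  start new u .fewer ℓ rewrite empty₀ = z≤n
  start new u .pending = new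
  start new u .unique = u

  stored-push : ∀ {bs : Buckets} {b p q} → Stored (bs [ b := p ∷ bs b ]) q → q ≡ p ⊎ Stored bs q
  stored-push {bs} {b} (b′ , m) with ∈-:= bs b b′ m
  ... | inj₁ (refl , here e) = inj₁ e
  ... | inj₁ (refl , there m) = inj₂ (b′ , m)
  ... | inj₂ (_ , m) = inj₂ (b′ , m)

  next-pending : ∀ {dn x r b} {bs′ : Buckets} → Parted (L T) T bs dn (x ∷ r) bs′ → ∀ {q} → q ∈ r →
      ¬ Stored (bs′ [ b := x ∷ bs′ b ]) q
  next-pending {b = b} {bs′} pt {q} m st with stored-push {bs′} {b} st
  ... | inj₂ st′ = pending pt (there m) st′
  ... | inj₁ refl with unique pt
  ...   | x∉ ∷ _ = All.lookup x∉ m refl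

  next-unique : ∀ {x : Point} {r} → Unique (x ∷ r) → Unique r
  next-unique (_ ∷ u) = u

  to-class : ∀ {dn x r bs′} → x onᶻ L T → Parted (L T) T bs dn (x ∷ r) bs′ →
      Parted (L T) T bs (x ∷ dn) r (bs′ [ T := x ∷ bs′ T ])
  to-class {dn} {x} {r} {bs′} o pt = record
    { others = λ b b≢0 b≢T → trans (:=-other bs′ b≢T) (others pt b b≢0 b≢T)
    ; from = λ m → there (from pt (subst (_ ∈_) e₀ m))
    ; fromT = fT
    ; into = λ { (here refl) → inj₂ (subst (x ∈_) (sym eT) (here refl)) ; (there m) → i (into pt m) }
    ; many = subst₂ _≤_ (sym (count-yes {P = _onᶻ L T} (_onᶻ? L T) dn o)) (cong length (sym eT)) (s≤s (many pt))
    ; fewer = λ ℓ → ℕ.≤-trans (subst (λ l → count (_on? ℓ) l ≤ count (_on? ℓ) dn) (sym e₀) (fewer pt ℓ))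
        (count-∷-≤ (_on? ℓ) x dn)
    ; pending = next-pending pt
    ; unique = next-unique (unique pt) }
    where
    e₀ : (bs′ [ T := x ∷ bs′ T ]) 0 ≡ bs′ 0
    e₀ = :=-other bs′ (T≢0 ∘ sym)
    eT : (bs′ [ T := x ∷ bs′ T ]) T ≡ x ∷ bs′ T
    eT = :=-same bs′ T
    fT : ∀ {q} → q ∈ (bs′ [ T := x ∷ bs′ T ]) T → q ∈ x ∷ dn × q onᶻ L T
    fT {q} m with subst (q ∈_) eT m
    ... | here refl = here refl , o
    ... | there m′ with fromT pt m′
    ...   | d , o′ = there d , o′
    i : ∀ {q} → q ∈ bs′ 0 ⊎ q ∈ bs′ T → q ∈ (bs′ [ T := x ∷ bs′ T ]) 0 ⊎ q ∈ (bs′ [ T := x ∷ bs′ T ]) T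
    i (inj₁ m) = inj₁ (subst (_ ∈_) (sym e₀) m)
    i (inj₂ m) = inj₂ (subst (_ ∈_) (sym eT) (there m))

  to-light : ∀ {dn x r bs′} → ¬ x onᶻ L T → Parted (L T) T bs dn (x ∷ r) bs′ →
      Parted (L T) T bs (x ∷ dn) r (bs′ [ 0 := x ∷ bs′ 0 ])
  to-light {dn} {x} {r} {bs′} ¬o pt = record
    { others = λ b b≢0 b≢T → trans (:=-other bs′ b≢0) (others pt b b≢0 b≢T)
    ; from = f₀
    ; fromT = λ m → let d , o = fromT pt (subst (_ ∈_) eT m) in there d , o
    ; into = λ { (here refl) → inj₁ (here refl) ; (there m) → i (into pt m) }
    ; many = subst₂ _≤_ (sym (count-no {P = _onᶻ L T} (_onᶻ? L T) dn ¬o)) (cong length (sym eT)) (many pt)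
    ; fewer = fw
    ; pending = next-pending pt
    ; unique = next-unique (unique pt) }
    where
    eT : (bs′ [ 0 := x ∷ bs′ 0 ]) T ≡ bs′ T
    eT = :=-other bs′ T≢0
    f₀ : ∀ {q} → q ∈ x ∷ bs′ 0 → q ∈ x ∷ dn
    f₀ (here e) = here e
    f₀ (there m) = there (from pt m)
    fw : ∀ ℓ → count (_on? ℓ) (x ∷ bs′ 0) ≤ count (_on? ℓ) (x ∷ dn)
    fw ℓ with x on? ℓ
    ... | yes _ = s≤s (fewer pt ℓ)
    ... | no _ = fewer pt ℓ
    i : ∀ {q} → q ∈ bs′ 0 ⊎ q ∈ bs′ T → q ∈ x ∷ bs′ 0 ⊎ q ∈ (bs′ [ 0 := x ∷ bs′ 0 ]) T
    i (inj₁ m) = inj₁ (there m)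
    i (inj₂ m) = inj₂ (subst (_ ∈_) (sym eT) m)

  split-run : ∀ {M} (Z : Scale) → length pend ≤ size Z → CoreM m P bs L M → StackM M (pend ++ stk) →
    M TGT 0ℤ ≡ + T → M NN 0ℤ ≡ + length pend → (∀ {q} → q ∈ pend → ¬ Stored bs q) → Unique pend →
    Runs splitᴾ M Z (λ M′ → ∃[ dn ] dn ʳ++ [] ≡ pend × ∃[ bs′ ] CoreM m P bs′ L M′ × StackM M′ stk × Parted
        (L T) T bs dn [] bs′)
  split-run {M} Z le core st et en new u = run-seq
    (run-block {Q = λ M′ → M′ II 0ℤ ≡ + length pend × M′ TGT 0ℤ ≡ + T × Inv [] pend M′} refl
        (en , et , bs , core , st , start new u))
    λ f₀ (ei , et , inv) → run-each₁ Z pend Inv refl id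
        (λ f _ e inv → body (trans (same f TGT refl 0ℤ) et) e inv) ei le inv
    where
    Inv : List Point → List Point → Memory → Set
    Inv dn r M = ∃[ bs′ ] CoreM m P bs′ L M × StackM M (r ++ stk) × Parted (L T) T bs dn r bs′
    body : ∀ {dn x r M} → M TGT 0ℤ ≡ + T → dn ʳ++ (x ∷ r) ≡ pend → Inv dn (x ∷ r) M →
        Runs _ M unit (Inv (x ∷ dn) r)
    body {dn} {x} {r} {M} et e (bs′ , core , st , pt) = run-seq
      (run-block {Q = λ M′ → CoreM m P bs′ L M′ × StackM M′ (r ++ stk) × M′ QQ 0ℤ ≡ code x × M′ TGT 0ℤ ≡ + T}
          refl
        (core , (proj₁ (stack-pop {M} st) , proj₂ st ∘ there) , proj₂ (stack-pop {M} st) , et))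
      λ {M₁} _ (core@(R , _ , ls , at) , st , eq , et) →
        let el = lhs-eval {M₁} {d = $ TGT} {e = $ QQ} ls (at (pend⊆P x∈)) et eq
            er = rhs-eval {M₁} {d = $ TGT} {e = $ QQ} ls (at (pend⊆P x∈)) et eq in
        run-seq (run-≐ {Q = Chosen}
          (λ e → run-block refl (core , st , eq , T , et , inj₁ (refl , trans (sym el) (trans e er))))
          (λ ne → run-block refl (core , st , eq , 0 , refl ,
              inj₂ (refl , λ o → ne (trans el (trans o (sym er)))))))
      λ { {M₂} f (core@(R , _) , st , eq , _ , eb , inj₁ (refl , o)) → run-post
            (λ f R′ → _ , core-push f R′ core , stack-frame refl refl f st , to-class o pt)
                (push-run {M₂} R eb eq (wh0 {M₂} R))
        ; {M₂} f (core@(R , _) , st , eq , _ , eb , inj₂ (refl , ¬o)) → run-post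
            (λ f R′ → _ , core-push f R′ core , stack-frame refl refl f st , to-light ¬o pt)
                (push-run {M₂} R eb eq (wh0 {M₂} R)) }
      where
      x∈ : x ∈ pend
      x∈ = subst (x ∈_) e (∈-ʳ++⁺ʳ dn (here refl))
      Chosen : Memory → Set
      Chosen M = CoreM m P bs′ L M × StackM M (r ++ stk) × M QQ 0ℤ ≡ code x ×
        ∃[ b ] M PB 0ℤ ≡ + b × ((b ≡ T × x onᶻ L T) ⊎ (b ≡ 0 × ¬ x onᶻ L T))
      wh0 : ∀ {M} → RepM M bs′ → M WH (code x) ≡ 0ℤ
      wh0 R with Rep.absent R x
      ... | inj₁ e = e
      ... | inj₂ st = contradiction st (pending pt (here refl))

≢[] : ∀ {x : Point} {l} → l ≡ [] → x ∉ l
≢[] refl ()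

module _ {m : ℕ} {bs : Buckets} {L : ℕ → Coefs} (G : Good m bs L) where
  open Good G

  -- Joining a class, opening one and deleting from one all change a single class. Its line differs
  -- from another class line for one of two reasons: it contains `p` and the other does not, or it
  -- is the line that the class had before.
  good-class : ∀ {p T i} {bs′ : Buckets} {L′ : ℕ → Coefs} → T ≡ suc i → i < m →
    (∀ j → j ≢ i → bs′ (suc j) ≡ bs (suc j) × L′ (suc j) ≡ L (suc j)) → suc m ≤ length (bs′ T) → Proper (L′ T) →
    (∀ {q} → q ∈ bs′ T → q onᶻ L′ T) →
        (∀ j → j ≢ i → bs (suc j) ≢ [] → p onᶻ L′ T × ¬ p onᶻ L (suc j) ⊎ (L′ T ≡ L T × bs T ≢ [])) →
    (∀ ℓ → count (_on? ℓ) (bs′ 0) ≤ count (_on? ℓ) (bs 0)) → Good m bs′ L′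
  good-class {p} {T} {i} {bs′} {L′} refl i<m oth many pr ons sep fewer =
      good h a (λ ℓ → ℕ.≤-trans (fewer ℓ) (light ℓ))
    where
    h : ∀ j → bs′ (suc j) ≢ [] → j < m × suc m ≤ length (bs′ (suc j)) × Proper (L′ (suc j)) ×
        (∀ {q} → q ∈ bs′ (suc j) → q onᶻ L′ (suc j))
    h j ne with j ℕ.≟ i
    ... | yes refl = i<m , many , pr , ons
    ... | no j≢i with oth j j≢i
    ...   | eb , el = subst₂ (λ l t → j < m × suc m ≤ length l × Proper t × (∀ {q} → q ∈ l → q onᶻ t)) (sym eb)
        (sym el)
                        (heavy j (λ e → ne (trans eb e)))
    sep′ : ∀ j → j ≢ i → bs (suc j) ≢ [] → ¬
        ((∀ r → r onᶻ L′ (suc i) → r onᶻ L (suc j)) × (∀ r → r onᶻ L (suc j) → r onᶻ L′ (suc i)))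
    sep′ j j≢i ne (f , g) with sep j j≢i ne
    ... | inj₁ (o , ¬o) = ¬o (f p o)
    ... | inj₂ (e , ne′) = apart (j≢i ∘ sym) ne′ ne
        (subst (λ t → (∀ r → r onᶻ t → r onᶻ L (suc j)) × (∀ r → r onᶻ L (suc j) → r onᶻ t)) e (f , g))
    a : ∀ {j k} → j ≢ k → bs′ (suc j) ≢ [] → bs′ (suc k) ≢ [] →
        ¬ ((∀ r → r onᶻ L′ (suc j) → r onᶻ L′ (suc k)) × (∀ r → r onᶻ L′ (suc k) → r onᶻ L′ (suc j)))
    a {j} {k} j≢k nj nk fg with j ℕ.≟ i | k ℕ.≟ i
    ... | yes refl | yes refl = j≢k refl
    ... | yes refl | no k≢i with oth k k≢i
    ...   | eb , el = sep′ k k≢i (λ e → nk (trans eb e))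
                        (subst (λ t → (∀ r → r onᶻ L′ (suc j) → r onᶻ t) × (∀ r → r onᶻ t → r onᶻ L′ (suc j)))
                            el fg)
    a {j} {k} j≢k nj nk (f , g) | no j≢i | yes refl with oth j j≢i
    ...   | eb , el = sep′ j j≢i (λ e → nj (trans eb e))
                        (subst (λ t → (∀ r → r onᶻ L′ (suc k) → r onᶻ t) × (∀ r → r onᶻ t → r onᶻ L′ (suc k)))
                            el (g , f))
    a {j} {k} j≢k nj nk fg | no j≢i | no k≢i with oth j j≢i | oth k k≢i
    ...   | eb , el | eb′ , el′ = apart j≢k (λ e → nj (trans eb e)) (λ e → nk (trans eb′ e))
                        (subst₂ (λ t u → (∀ r → r onᶻ t → r onᶻ u) × (∀ r → r onᶻ u → r onᶻ t)) el el′ fg)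

  good-join : ∀ {p i} → bs (suc i) ≢ [] → p onᶻ L (suc i) → Good m (bs [ suc i := p ∷ bs (suc i) ]) L
  good-join {p} {i} ne o with heavy i ne
  ... | i<m , many , pr , ons = good-class {p} refl i<m (λ j j≢i → :=-other bs (j≢i ∘ ℕ.suc-injective) , refl)
    (subst (λ l → suc m ≤ length l) (sym e) (ℕ.m≤n⇒m≤1+n many)) pr
    (λ {q} q∈ → on′ (subst (q ∈_) e q∈)) (λ _ _ _ → inj₂ (refl , ne)) (λ ℓ → ℕ.≤-refl)
    where
    e : (bs [ suc i := p ∷ bs (suc i) ]) (suc i) ≡ p ∷ bs (suc i)
    e = :=-same bs (suc i)
    on′ : ∀ {q} → q ∈ p ∷ bs (suc i) → q onᶻ L (suc i)
    on′ (here refl) = o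
    on′ (there q∈) = ons q∈

  -- Counts grow only on lines through `p`. Such a line either meets bucket 0 in no point, so that
  -- its count becomes 1, or meets it in some `q`; then it is the join of `p` and `q`, with fewer
  -- than m points of bucket 0 so far.
  good-light : ∀ {p} → 1 ≤ m → p ∉ bs 0 → (∀ {q} → q ∈ bs 0 → count (_onᶻ? join p q) (bs 0) < m) →
      Good m (bs [ 0 := p ∷ bs 0 ]) L
  good-light {p} 1≤m p∉ few = good heavy apart light′
    where
    light′ : ∀ ℓ → count (_on? ℓ) (p ∷ bs 0) ≤ m
    light′ ℓ with p on? ℓ
    ... | no _ = light ℓ
    ... | yes p-on with 1 ℕ.≤? count (_on? ℓ) (bs 0)
    ...   | no none = ℕ.≤-trans (s≤s (ℕ.s≤s⁻¹ (ℕ.≰⇒> none))) 1≤m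
    ...   | yes some with count-member (_on? ℓ) (bs 0) some
    ...     | q , q∈ , q-on = ℕ.≤-<-trans (count-mono (_on? ℓ) (_onᶻ? join p q) (bs 0) (λ {r} _ r-on →
              on⇒onᶻ (join p q) {pr} (two-points ℓ (toLine (join p q) pr) p≢q p-on q-on
                (onᶻ⇒on (join p q) {pr} (join-onˡ p q)) (onᶻ⇒on (join p q) {pr} (join-onʳ p q)) r-on))) (few q∈)
      where
      p≢q : p ≢ q
      p≢q refl = p∉ q∈
      pr = join-proper p≢q

-- Adding one point

Linked : Buckets → Buckets → Set
Linked bs bs′ = (∀ {x} → Stored bs x → Stored bs′ x) × (∀ {x} → Stored bs′ x → Stored bs x)

module Add {m : ℕ} {P : PointSet} (1≤m : 1 ≤ m) (cov : CoverableBy m P) where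

  Z : Scale
  Z = scale (m * m) (ℕ.*-mono-≤ 1≤m 1≤m)

  m≤Z : m ≤ size Z
  m≤Z = ℕ.≤-trans (ℕ.≤-reflexive (sym (ℕ.*-identityˡ m))) (ℕ.*-monoˡ-≤ m 1≤m)

  -- `Good` is stated for the buckets with `p` already pushed: a class just opened for `p` may hold
  -- exactly m points before the push, one too few.
  Ready : Buckets → Point → List Point → Memory → Set
  Ready bs p stk M = ∃[ T ] M TGT 0ℤ ≡ + T × ∃[ bs′ ] ∃[ L′ ] CoreM m P bs′ L′ M × StackM M stk × Linked bs bs′
      × Good m (bs′ [ T := p ∷ bs′ T ]) L′

  module _ {bs : Buckets} {L : ℕ → Coefs} {stk : List Point} (G : Good m bs L)
      (sub : ∀ {b q} → q ∈ bs b → q ∈ P)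
           {p : Point} (p∈P : p ∈ P) (new : ¬ Stored bs p) where

    module _ (off : ∀ {i} → i < m → bs (suc i) ≢ [] → ¬ p onᶻ L (suc i)) {q : Point} (q∈ : q ∈ bs 0)
             (many : m ≤ count (_onᶻ? join p q) (bs 0)) where

      private
        t = join p q

      p≢q : p ≢ q
      p≢q refl = new (0 , q∈)

      new-rich : Unique (bs 0) → Rich m P t
      new-rich u = rich (p ∷ filter (_onᶻ? t) (bs 0))
        (All.tabulate (λ x∈ → λ { refl → new (0 , proj₁ (∈-filter⁻ (_onᶻ? t) {xs = bs 0} x∈)) }) ∷
            Unique.filter⁺ (_onᶻ? t) u)
        (s≤s (subst (m ≤_) (sym (length-filter (_onᶻ? t) (bs 0))) many))
        (λ { (here refl) → p∈P ; (there x∈) → sub (proj₁ (∈-filter⁻ (_onᶻ? t) {xs = bs 0} x∈)) })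
        (λ { (here refl) → join-onˡ p q ; (there x∈) → proj₂ (∈-filter⁻ (_onᶻ? t) {xs = bs 0} x∈) })
        (join-proper p≢q)

      create-run : ∀ {M} → CoreM m P bs L M → StackM M stk → M CUR 0ℤ ≡ code p → M WIT 0ℤ ≡ code q →
          Runs createᴾ M Z (Ready bs p stk)
      create-run {M} core st ep eq = run-seq
        (free-run Z m≤Z core (free-class cov G (rep-unique (proj₁ core)) sub
            (new-rich (rep-unique (proj₁ core) 0)) (join-onˡ p q) off))
        λ f (i , et , i<m , e) → let core = core-frame refl refl f core; ep = trans (same f CUR refl 0ℤ) ep
                                     eq = trans (same f WIT refl 0ℤ) eq; st = stack-frame refl refl f st in
        run-seq (line-run core p∈P (sub q∈) ep eq et)
        λ f core → let et = trans (same f TGT refl 0ℤ) et; st = stack-frame refl refl f st in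
        run-seq (run-block {Q = λ M′ → M′ PB 0ℤ ≡ 0ℤ × M′ NN 0ℤ ≡ + length (bs 0) × CoreM m P bs
            (L [ suc i := t ]) M′ × StackM M′ stk × M′ TGT 0ℤ ≡ + suc i}
                  refl (refl , Rep.cnt-ok (proj₁ core) 0 , core , st , et))
        λ _ (eb , en , core@(R , rest) , st , et) →
        run-seq (drain-run Z R st eb (light-bound cov sub (Good.light G)))
        λ f (d , rev , bs₁ , R₁ , st , e₀ , oth) →
        let d⇒ = λ {x} (x∈ : x ∈ d) → subst (x ∈_) rev (∈-ʳ++⁺ˡ d x∈)
            len = trans (sym (trans (length-ʳ++ d {[]}) (ℕ.+-identityʳ _))) (cong length rev)
            open Split {m} {P} {L [ suc i := t ]} {stk} {suc i} {bs₁} (λ ()) e₀ (trans (oth (suc i) (λ ())) e)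
                d (sub ∘ d⇒) in
        run-post (λ f′ (dn , rev′ , bs′ , core , st , pt) →
            suc i , trans (same f′ TGT refl 0ℤ) (trans (same f TGT refl 0ℤ) et) , bs′ , L [ suc i := t ] ,
                core , st ,
            Done.linked e d rev oth dn rev′ pt , Done.ready e d rev oth dn rev′ pt i<m)
          (split-run Z (ℕ.≤-trans (ℕ.≤-reflexive len) (light-bound cov sub (Good.light G)))
              (R₁ , rest-frame refl f rest) st
            (trans (same f TGT refl 0ℤ) et) (trans (same f NN refl 0ℤ) (trans en (cong +_ (sym len))))
            -- Bucket 0 has been emptied and the other buckets are disjoint from it, so a drained
            -- point is stored nowhere and may be pushed.
            (λ {x} x∈ (b , m) → fresh R (d⇒ x∈) b m e₀ oth)
            (subst Unique (sym (ʳ++-flip d rev)) (unique-ʳ++ (bs 0) (rep-unique R 0) [] (λ _ ()))))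
        where
        fresh : ∀ {cnt sl pos wh x} {bs₁ : Buckets} → Rep cnt sl pos wh bs → x ∈ bs 0 → ∀ b → x ∈ bs₁ b →
            bs₁ 0 ≡ [] →
          (∀ b′ → b′ ≢ 0 → bs₁ b′ ≡ bs b′) → ⊥
        fresh R x∈ zero m e₀ oth = ≢[] e₀ m
        fresh {x = x} R x∈ (suc b) m e₀ oth with () ← rep-disjoint R x∈ (subst (x ∈_) (oth (suc b) (λ ())) m)

        module Done {i : ℕ} (e : bs (suc i) ≡ []) (d : List Point) (rev : d ʳ++ [] ≡ bs 0) {bs₁ : Buckets}
            (oth : ∀ b′ → b′ ≢ 0 → bs₁ b′ ≡ bs b′)
          (dn : List Point) (rev′ : dn ʳ++ [] ≡ d) {bs′ : Buckets} (pt : Parted ((L [ suc i := t ]) (suc i)) (suc i) bs₁ dn [] bs′) where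
          open Parted pt hiding (many)

          back : ∀ {x} → x ∈ dn → x ∈ bs 0
          back {x} x∈ = subst (x ∈_) rev (∈-ʳ++⁺ˡ d (subst (x ∈_) rev′ (∈-ʳ++⁺ˡ dn x∈)))

          forth : ∀ {x} → x ∈ bs 0 → x ∈ dn
          forth x∈ = ∈-ʳ++[]⁻ dn rev′ (∈-ʳ++[]⁻ d rev x∈)

          same-count : ∀ {Q : Point → Set} (Q? : ∀ x → Dec (Q x)) → count Q? dn ≡ count Q? (bs 0)
          same-count Q? = trans (sym (trans (count-ʳ++ Q? dn []) (ℕ.+-identityʳ _)))
              (trans (cong (count Q?) rev′)
            (trans (sym (trans (count-ʳ++ Q? d []) (ℕ.+-identityʳ _))) (cong (count Q?) rev)))

          other : ∀ b → b ≢ 0 → b ≢ suc i → bs′ b ≡ bs b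
          other b b≢0 b≢T = trans (others b b≢0 b≢T) (oth b b≢0)

          linked : Linked bs bs′
          linked = to , fro
            where
            to : ∀ {x} → Stored bs x → Stored bs′ x
            to (zero , x∈) with into (forth x∈)
            ... | inj₁ y = 0 , y
            ... | inj₂ y = suc i , y
            to {x} (suc j , x∈) with j ℕ.≟ i
            ... | yes refl = contradiction x∈ (≢[] e)
            ... | no j≢i = suc j , subst (x ∈_) (sym (other (suc j) (λ ()) (j≢i ∘ ℕ.suc-injective))) x∈
            fro : ∀ {x} → Stored bs′ x → Stored bs x
            fro (zero , x∈) = 0 , back (from x∈)
            fro {x} (suc j , x∈) with j ℕ.≟ i
            ... | yes refl = 0 , back (proj₁ (fromT x∈))
            ... | no j≢i = suc j , subst (x ∈_) (other (suc j) (λ ()) (j≢i ∘ ℕ.suc-injective)) x∈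

          ready : i < m → Good m (bs′ [ suc i := p ∷ bs′ (suc i) ]) (L [ suc i := t ])
          ready i<m = good-class G {p} refl i<m
            (λ j j≢i → trans (:=-other bs′ (j≢i ∘ ℕ.suc-injective))
                (other (suc j) (λ ()) (j≢i ∘ ℕ.suc-injective)) , :=-other L (j≢i ∘ ℕ.suc-injective))
            (subst (λ l → suc m ≤ length l) (sym eb) (s≤s (ℕ.≤-trans (ℕ.≤-trans many (ℕ.≤-reflexive
               (trans (sym (same-count (_onᶻ? t))) (cong (λ t → count (_onᶻ? t) dn) (sym el))))) many′)))
            (subst Proper (sym el) (join-proper p≢q))
            (λ {x} x∈ → ons (subst (x ∈_) eb x∈))
            -- `p` lies on the new line, and the scan found it off the lines of all other classes.
            (λ j j≢i ne → inj₁ (subst (p onᶻ_) (sym el) (join-onˡ p q) , off (proj₁ (Good.heavy G j ne)) ne))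
            (λ ℓ → ℕ.≤-trans (fewer ℓ) (ℕ.≤-reflexive (same-count (_on? ℓ))))
            where
            many′ = Parted.many pt
            eb : (bs′ [ suc i := p ∷ bs′ (suc i) ]) (suc i) ≡ p ∷ bs′ (suc i)
            eb = :=-same bs′ (suc i)
            el : (L [ suc i := t ]) (suc i) ≡ t
            el = :=-same L (suc i)
            ons : ∀ {x} → x ∈ p ∷ bs′ (suc i) → x onᶻ (L [ suc i := t ]) (suc i)
            ons (here refl) = subst (p onᶻ_) (sym el) (join-onˡ p q)
            ons (there x∈) = proj₂ (fromT x∈)

    ready-run : ∀ {M} → CoreM m P bs L M → StackM M stk → M CUR 0ℤ ≡ code p → Scanned m bs L p 0 (M TGT 0ℤ) →
      Runs (when $ TGT ≐ zer then detectᴾ ⨾ when $ FW ≐ zer then skip else createᴾ end else skip end) M Z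
          (Ready bs p stk)
    ready-run {M} core st ep (inj₂ (i , et , i<m , ne , o)) = run-≐
      (λ e → contradiction (trans (sym et) e) λ ())
      (λ _ → run-skip (suc i , et , bs , L , core , st , ((λ s → s) , λ s → s) , good-join G ne o))
    ready-run {M} core st ep (inj₁ (et , off)) = run-≐
      (λ _ → run-seq (Detect.detect-run {m} {P} {bs} {L} p∈P sub (λ m → new (0 , m)) Z
          (light-bound cov sub (Good.light G)) {M} (core , ep))
        λ { f (inj₁ (ef , few)) → run-≐
              (λ _ → run-skip (0 , trans (same f TGT refl 0ℤ) et , bs , L , core-frame refl refl f core ,
                  stack-frame refl refl f st , ((λ s → s) , λ s → s) ,
                 good-light G 1≤m (λ m → new (0 , m)) few))
              (λ ne → contradiction ef ne)
          ; f (inj₂ (ef , q , q∈ , ew , many)) → run-≐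
              (λ e → contradiction (trans (sym ef) e) λ ())
              (λ _ → create-run (off z≤n) q∈ many (core-frame refl refl f core) (stack-frame refl refl f st)
                  (trans (same f CUR refl 0ℤ) ep) ew) })
      (λ ne → contradiction et ne)

  Added : Buckets → Point → List Point → Memory → Set
  Added bs p stk M = ∃[ bs′ ] ∃[ L′ ] CoreM m P bs′ L′ M × StackM M stk × Good m bs′ L′ ×
    (∀ {x} → Stored bs x → Stored bs′ x) × Stored bs′ p × (∀ {x} → Stored bs′ x → x ≡ p ⊎ Stored bs x)

  -- `P` may exceed the set of stored points together with `p`: a deletion reinserts points with the
  -- set before the deletion as `P`, for which a cover is at hand.
  add-run : ∀ {M bs L stk p} → CoreM m P bs L M → StackM M stk → Good m bs L → (∀ {b q} → q ∈ bs b → q ∈ P) →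
      p ∈ P →
    M CUR 0ℤ ≡ code p → Runs addᴾ M Z (Added bs p stk)
  add-run {M} {bs} {L} {stk} {p} core@(R , _) st G sub p∈P ep = run-≐ absent present
    where
    present : M WH (M CUR 0ℤ) ≢ 0ℤ → Runs skip M Z (Added bs p stk)
    present ne with Rep.absent R p
    ... | inj₁ e = contradiction (trans (cong (M WH) ep) e) ne
    ... | inj₂ st′ = run-skip (bs , L , core , st , G , (λ s → s) , st′ , λ s → inj₂ s)
    absent : M WH (M CUR 0ℤ) ≡ 0ℤ → Runs _ M Z (Added bs p stk)
    absent e = run-seq (scan-run Z m≤Z core p∈P ep)
      λ f sc → run-seq {R = Added bs p stk}
          (ready-run G sub p∈P new (core-frame refl refl f core) (stack-frame refl refl f st)
          (trans (same f CUR refl 0ℤ) ep) sc)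
      λ f′ (T , et , bs′ , L′ , core , st , (to , fro) , G′) → run-seq
        (run-block {Q = λ M′ → M′ PB 0ℤ ≡ + T × M′ QQ 0ℤ ≡ code p × CoreM m P bs′ L′ M′ × StackM M′ stk} refl
          (et , trans (same f′ CUR refl 0ℤ) (trans (same f CUR refl 0ℤ) ep) , core , st))
      λ {M₁} _ (eb , eq , core@(R , _) , st) → run-post
        (λ f R′ → bs′ [ T := p ∷ bs′ T ] , L′ , core-push f R′ core , stack-frame refl refl f st , G′ ,
           (λ s → keep T bs′ (to s)) , (T , subst (p ∈_) (sym (:=-same bs′ T)) (here refl)) , λ s →
               back T bs′ (λ {x} → fro {x}) s)
        (push-run {M₁} R eb eq (wh0 (Rep.absent R p) (λ s → new (fro s))))
      where
      new : ¬ Stored bs p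
      new = wh0⇒∉ R (trans (cong (M WH) (sym ep)) e)
      wh0 : ∀ {z : ℤ} {bs′} → z ≡ 0ℤ ⊎ Stored bs′ p → ¬ Stored bs′ p → z ≡ 0ℤ
      wh0 (inj₁ e) _ = e
      wh0 (inj₂ s) ¬s = contradiction s ¬s
      keep : ∀ T bs′ {x} → Stored bs′ x → Stored (bs′ [ T := p ∷ bs′ T ]) x
      keep T bs′ {x} (b , m) with b ℕ.≟ T
      ... | yes refl = b , subst (x ∈_) (sym (:=-same bs′ b)) (there m)
      ... | no b≢T = b , subst (x ∈_) (sym (:=-other bs′ b≢T)) m
      back : ∀ T bs′ → (∀ {x} → Stored bs′ x → Stored bs x) → ∀ {x} → Stored (bs′ [ T := p ∷ bs′ T ]) x →
          x ≡ p ⊎ Stored bs x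
      back T bs′ fro (b , m) with ∈-:= bs′ T b m
      ... | inj₁ (refl , here e) = inj₁ e
      ... | inj₁ (refl , there m) = inj₂ (fro (b , m))
      ... | inj₂ (_ , m) = inj₂ (fro (b , m))

-- The two update operations

StateM : ℕ → PointSet → Memory → Set
StateM m P M = ∃[ bs ] ∃[ L ] CoreM m P bs L M × Good m bs L × (∀ {x} → Stored bs x → x ∈ P) ×
    (∀ {x} → x ∈ P → Stored bs x)

cover-pos : ∀ {m P p} → p ∈ P → CoverableBy m P → 1 ≤ m
cover-pos {suc m} _ _ = s≤s z≤n
cover-pos {zero} p∈ ([] , _ , cov) with cov p∈
... | ()

-- The point may have been entered before; rewriting its attribute then stores the same value.
attr-upd : ∀ {f : ℤ → ℤ} {g : Point → ℤ} {i p v} → i ≡ code p → v ≡ g p → ∀ q → q ≡ p ⊎ f (code q) ≡ g q →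
    upd f i v (code q) ≡ g q
attr-upd {f} refl refl q (inj₁ refl) = upd-same f refl
attr-upd {f} {g} {p = p} refl refl q (inj₂ e) with q ≟ᴾ p
... | yes refl = upd-same f refl
... | no ne = trans (upd-other f (code-≢ ne)) e

-- The promise is used for the set after the insertion. This set contains `p`, which yields 1 ≤ m.
insert-run : ∀ {m P p M} (cov : CoverableBy m (p ∷ P)) → StateM m P M →
  Runs insertᴾ (loadPoint p M) (Add.Z (cover-pos (here refl) cov) cov) (StateM m (p ∷ P))
insert-run {m} {P} {p@(x , y)} {M} cov (bs , L , (R , eg , ls , at) , G , sub , sup) = run-seq
  (run-block {Q = λ M′ → CoreM m (p ∷ P) bs L M′ × StackM M′ [] × M′ CUR 0ℤ ≡ code p} refl
    ( (R , eg , ls , λ {q} q∈ → attr-upd {M PX} {X} ec (sym (X-def x y)) q (old (λ a → proj₁ a) q∈) ,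
                                attr-upd {M PY} {Y} ec (sym (Y-def x y)) q (old (λ a → proj₁ (proj₂ a)) q∈) ,
                                attr-upd {M PD} {D} ec (sym (D-def x y)) q (old (λ a → proj₂ (proj₂ a)) q∈))
    , (refl , λ ()) , ec ))
  λ _ (core , st , ec) → run-post
    (λ { _ (bs′ , L′ , core , _ , G , to , s , fro) → bs′ , L′ , core , G ,
           (λ s → pts (fro s)) , (λ { (here refl) → s ; (there q∈) → to (sup q∈) }) })
    (Add.add-run (cover-pos (here refl) cov) cov core st G (λ q∈ → there (sub (_ , q∈))) (here refl) ec)
  where
  ec = sym (code-def x y)
  old : ∀ {S : Set} {q} → (Attr M q → S) → q ∈ p ∷ P → q ≡ p ⊎ S
  old f (here e) = inj₁ e
  old f (there q∈) = inj₂ (f (at q∈))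
  pts : ∀ {q} → q ≡ p ⊎ Stored bs q → q ∈ p ∷ P
  pts (inj₁ e) = here e
  pts (inj₂ s) = there (sub s)

-- The promise is used for the set before the deletion. It allows m = 0 if that set is empty, hence
-- the budget `W` is any positive number that is at least m³.
module Delete {m : ℕ} {P : PointSet} {p : Point} (cov : CoverableBy m P) (W : Scale) (m³≤W : m * m * m ≤ size W) where

  Kept : Buckets → Set
  Kept bs = (∀ {x} → Stored bs x → x ∈ P × x ≢ p) × (∀ {x} → x ∈ P → x ≢ p → Stored bs x)

  kept-state : ∀ M {bs L} → CoreM m P bs L M → Good m bs L → Kept bs → StateM m (delete p P) M
  kept-state M {bs} {L} (R , eg , ls , at) G (sub , sup) = bs , L ,
    (R , eg , ls , λ q∈ → at (proj₁ (∈-filter⁻ ≢p? {xs = P} q∈))) , G ,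
    (λ s → let x∈ , x≢ = sub s in ∈-filter⁺ ≢p? x∈ x≢) ,
    (λ q∈ → let x∈ , x≢ = ∈-filter⁻ ≢p? {xs = P} q∈ in sup x∈ x≢)
    where
    ≢p? = λ q → ¬? (q ≟ᴾ p)

  Refill : List Point → List Point → Memory → Set
  Refill dn r M = ∃[ bs ] ∃[ L ] CoreM m P bs L M × Good m bs L × StackM M r ×
    (∀ {x} → Stored bs x → x ∈ P × x ≢ p) × (∀ {x} → x ∈ P → x ≢ p → Stored bs x ⊎ x ∈ r)

  refill-run : ∀ {M} → 1 ≤ m → (d : List Point) → length d ≤ m → (∀ {x} → x ∈ d → x ∈ P × x ≢ p) →
      Refill [] d M →
    Runs ((DD ≔ $ KN) ⨾ for DD (((KN ≔ $ KN ⊖ uno) ⨾ (CUR ≔ KP [ $ KN ])) ⨾ addᴾ)) M W (StateM m (delete p P))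
  refill-run {M} 1≤m d d≤m d⊆ inv = run-seq
    (run-block {Q = λ M′ → M′ DD 0ℤ ≡ + length d × Refill [] d M′} refl
        (proj₁ (proj₁ (proj₂ (proj₂ (proj₂ (proj₂ inv))))) , inv))
    λ _ (ed , inv) → run-mono m³≤W (run-post fin
      (run-each {X = Add.Z 1≤m cov} (scale m 1≤m) d Refill refl id (λ {dn} _ _ e inv → body {dn} e inv) ed d≤m
          inv))
    where
    fin : ∀ {M M′ : Memory} → Frame _ M M′ → _ → StateM m (delete p P) M′
    fin {M′ = M′} _ (_ , _ , bs , L , core , G , _ , sub , sup) =
        kept-state M′ core G ((λ s → sub s) , λ x∈ x≢ → only (sup x∈ x≢))
      where
      only : ∀ {S : Set} {x : Point} → S ⊎ x ∈ [] → S
      only (inj₁ s) = s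
    body : ∀ {dn x r M} → dn ʳ++ (x ∷ r) ≡ d → Refill dn (x ∷ r) M →
        Runs _ M (Add.Z 1≤m cov) (Refill (x ∷ dn) r)
    body {dn} {x} {r} {M} e (bs , L , core , G , st , sub , sup) = run-seq
      (run-block {Q = λ M′ → CoreM m P bs L M′ × StackM M′ r × M′ CUR 0ℤ ≡ code x} refl
        (core , (proj₁ (stack-pop {M} st) , proj₂ st ∘ there) , proj₂ (stack-pop {M} st)))
      λ _ (core , st , ec) → run-post
        (λ _ (bs′ , L′ , core , st , G , to , s , fro) → bs′ , L′ , core , G , st , (λ y → sub′ (fro y)) ,
            λ y∈ y≢ → sup′ to s (sup y∈ y≢))
        (Add.add-run 1≤m cov core st G (λ q∈ → proj₁ (sub (_ , q∈))) (proj₁ x∈) ec)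
      where
      x∈ : x ∈ P × x ≢ p
      x∈ = d⊆ (subst (x ∈_) e (∈-ʳ++⁺ʳ dn (here refl)))
      sub′ : ∀ {y} → y ≡ x ⊎ Stored bs y → y ∈ P × y ≢ p
      sub′ (inj₁ refl) = x∈
      sub′ (inj₂ s) = sub s
      sup′ : ∀ {bs′} → (∀ {y} → Stored bs y → Stored bs′ y) → Stored bs′ x → ∀ {y} → Stored bs y ⊎ y ∈ x ∷ r →
          Stored bs′ y ⊎ y ∈ r
      sup′ to s (inj₁ y) = inj₁ (to y)
      sup′ to s (inj₂ (here refl)) = inj₁ s
      sup′ to s (inj₂ (there y∈)) = inj₂ y∈

  module _ {bs : Buckets} {L : ℕ → Coefs} (G : Good m bs L) (sub : ∀ {x} → Stored bs x → x ∈ P)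
      (sup : ∀ {x} → x ∈ P → Stored bs x)
           {b n : ℕ} (a : At (bs b) p n) where

    private
      bs₁ = bs [ b := remove a ]
      p∈P = sub (b , at-∈ a)
      1≤m = cover-pos p∈P cov

    removed : ∀ {cnt sl pos wh} → Rep cnt sl pos wh bs → Kept bs₁
    removed R = from , to
      where
      from : ∀ {x} → Stored bs₁ x → x ∈ P × x ≢ p
      from (b′ , m₀) with ∈-:= bs b b′ m₀
      ... | inj₁ (refl , m) with remove-∈ R a m
      ...   | m′ , x≢p = sub (b′ , m′) , x≢p
      from (b′ , _) | inj₂ (b′≢b , m) = sub (b′ , m) , λ { refl → b′≢b (rep-disjoint R m (at-∈ a)) }
      to : ∀ {x} → x ∈ P → x ≢ p → Stored bs₁ x
      to {x} x∈ x≢p with sup x∈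
      ... | b′ , m with b′ ℕ.≟ b
      ...   | yes refl = b , subst (x ∈_) (sym (:=-same bs b)) (∈-remove a m x≢p)
      ...   | no b′≢b = b′ , subst (x ∈_) (sym (:=-other bs b′≢b)) m

    still-good : ∀ {cnt sl pos wh} → Rep cnt sl pos wh bs → b ≡ 0 ⊎ m < length (remove a) → Good m bs₁ L
    still-good R (inj₁ refl) = good (Good.heavy G) (Good.apart G) λ ℓ →
        ℕ.≤-trans (count-remove (_on? ℓ) a) (Good.light G ℓ)
    still-good R (inj₂ lt) = go b refl
      where
      go : ∀ b′ → b′ ≡ b → Good m bs₁ L
      go zero refl = still-good R (inj₁ refl)
      go (suc i) refl = good-class G {p} refl (proj₁ h) (λ j j≢i → :=-other bs (j≢i ∘ ℕ.suc-injective) , refl)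
        (subst (λ l → suc m ≤ length l) (sym e) lt) (proj₁ (proj₂ (proj₂ h)))
        (λ {q} q∈ → proj₂ (proj₂ (proj₂ h)) (proj₁ (remove-∈ R a (subst (q ∈_) e q∈))))
            (λ _ _ _ → inj₂ (refl , ne)) (λ ℓ → ℕ.≤-refl)
        where
        e : bs₁ (suc i) ≡ remove a
        e = :=-same bs (suc i)
        ne : bs (suc i) ≢ []
        ne e = ≢[] e (at-∈ a)
        h = Good.heavy G i ne

    -- Emptying a class leaves bucket 0 and the other classes as they were, and `Good` asserts
    -- nothing about an empty class.
    dissolved : ∀ {i} {bs₂ : Buckets} → b ≡ suc i → bs₂ b ≡ [] → (∀ b′ → b′ ≢ b → bs₂ b′ ≡ bs₁ b′) →
        Good m bs₂ L
    dissolved {i} {bs₂} refl e oth = good h s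
        (λ ℓ → subst (λ l → count (_on? ℓ) l ≤ m) (sym (eq 0 (λ ()))) (Good.light G ℓ))
      where
      eq : ∀ b′ → b′ ≢ b → bs₂ b′ ≡ bs b′
      eq b′ ne = trans (oth b′ ne) (:=-other bs ne)
      eq′ : ∀ {j} → bs₂ (suc j) ≢ [] → bs₂ (suc j) ≡ bs (suc j)
      eq′ {j} ne with j ℕ.≟ i
      ... | yes refl = contradiction e ne
      ... | no j≢i = eq (suc j) (j≢i ∘ ℕ.suc-injective)
      h : ∀ j → bs₂ (suc j) ≢ [] → j < m × suc m ≤ length (bs₂ (suc j)) × Proper (L (suc j)) ×
          (∀ {q} → q ∈ bs₂ (suc j) → q onᶻ L (suc j))
      h j ne = subst (λ l → j < m × suc m ≤ length l × Proper (L (suc j)) × (∀ {q} → q ∈ l → q onᶻ L (suc j)))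
          (sym (eq′ ne))
        (Good.heavy G j (λ e → ne (trans (eq′ ne) e)))
      s : ∀ {j k} → j ≢ k → bs₂ (suc j) ≢ [] → bs₂ (suc k) ≢ [] → _
      s j≢k nj nk = Good.apart G j≢k (λ e → nj (trans (eq′ nj) e)) (λ e → nk (trans (eq′ nk) e))

    found-run : ∀ {M} → CoreM m P bs L M → StackM M [] → M QQ 0ℤ ≡ code p →
      Runs (removeᴾ ⨾ when zer ≺ $ RB then
        when $ GG ≺ CNT [ $ RB ] then skip else
          (PB ≔ $ RB) ⨾ drainᴾ ⨾ (DD ≔ $ KN) ⨾ for DD (((KN ≔ $ KN ⊖ uno) ⨾ (CUR ≔ KP [ $ KN ])) ⨾ addᴾ)
        end else skip end) M W (StateM m (delete p P))
    found-run {M} core@(R₀ , rest) st eq = run-seq (remove-run R₀ a eq)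
      λ {M₁} f (R , eb) → let core = R , rest-frame refl f rest; st = stack-frame refl refl f st; eg = proj₁ (proj₂ core)
                              cnt = trans (cong (M₁ CNT) eb)
                                  (trans (Rep.cnt-ok R b) (cong (λ l → + length l) (:=-same bs b))) in
      run-≺
        (λ 0<b → run-≺
          (λ lt → run-skip (kept-state M₁ core (still-good R₀ (inj₂ (ℤ.drop‿+<+ (subst₂ ℤ._<_ eg cnt lt))))
              (removed R₀)))
          -- At most m points remain in the class, so draining it and inserting them anew at a cost
          -- of m² each stays within m³.
          (λ ¬lt → let small = ℕ.≮⇒≥ (λ lt → ¬lt (subst₂ ℤ._<_ (sym eg) (sym cnt) (ℤ.+<+ lt))) in
            run-seq (run-block {Q = λ M′ → M′ PB 0ℤ ≡ + b × CoreM m P bs₁ L M′ × StackM M′ []} refl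
                (eb , core , st))
            λ _ (eb′ , (R , rest) , st) → run-seq
                (drain-run W R st eb′ (ℕ.≤-trans (subst (λ l → length l ≤ m) (sym (:=-same bs b)) small) m≤W))
            λ {M₂} f (d , rev , bs₂ , R₂ , st , e , oth) →
                refill R₀ small (ℤ.drop‿+<+ (subst (0ℤ ℤ.<_) eb 0<b)) M₂ d rev bs₂
              (R₂ , rest-frame refl f rest) st e oth))
        (λ 0≮b → run-skip (kept-state M₁ core
            (still-good R₀ (inj₁ (ℕ.n≤0⇒n≡0 (ℕ.≮⇒≥ λ lt → 0≮b (subst (0ℤ ℤ.<_) (sym eb) (ℤ.+<+ lt))))))
            (removed R₀)))
      where
      m≤W : m ≤ size W
      m≤W = ℕ.≤-trans (ℕ.≤-trans (ℕ.≤-reflexive (sym (ℕ.*-identityˡ m))) (ℕ.*-monoˡ-≤ m (ℕ.*-mono-≤ 1≤m 1≤m)))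
          m³≤W
      refill : ∀ {cnt sl pos wh} → Rep cnt sl pos wh bs → length (remove a) ≤ m → 0 < b → ∀ M₂ d →
          d ʳ++ [] ≡ bs₁ b → ∀ bs₂ → CoreM m P bs₂ L M₂ →
        StackM M₂ (d ++ []) → bs₂ b ≡ [] → (∀ b′ → b′ ≢ b → bs₂ b′ ≡ bs₁ b′) →
            Runs _ M₂ W (StateM m (delete p P))
      refill R₀ small 0<b M₂ d rev bs₂ core st e oth = refill-run {M₂} 1≤m d
        (subst (_≤ m) (trans (cong length (sym (trans rev (:=-same bs b))))
            (trans (length-ʳ++ d {[]}) (ℕ.+-identityʳ _))) small)
        (λ x∈ → proj₁ (removed R₀) (b , subst (_ ∈_) rev (∈-ʳ++⁺ˡ d x∈)))
        (bs₂ , L , core , dissolved (sym (ℕ.suc-pred b {{ℕ.>-nonZero 0<b}})) e oth ,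
            subst (StackM M₂) (++-identityʳ d) st ,
         (λ s → proj₁ (removed R₀) (below s)) , λ x∈ x≢p → above (proj₂ (removed R₀) x∈ x≢p))
        where
        below : ∀ {x} → Stored bs₂ x → Stored bs₁ x
        below {x} (b′ , m) with b′ ℕ.≟ b
        ... | yes refl = contradiction m (≢[] e)
        ... | no ne = b′ , subst (x ∈_) (oth b′ ne) m
        above : ∀ {x} → Stored bs₁ x → Stored bs₂ x ⊎ x ∈ d
        above {x} (b′ , m) with b′ ℕ.≟ b
        ... | no ne = inj₁ (b′ , subst (x ∈_) (sym (oth b′ ne)) m)
        ... | yes refl = inj₂ (∈-ʳ++[]⁻ d rev m)

  delete-run : ∀ {M} → StateM m P M → Runs deleteᴾ (loadPoint p M) W (StateM m (delete p P))
  delete-run {M} (bs , L , core , G , sub , sup) = run-seq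
    (run-block {Q = λ M′ → CoreM m P bs L M′ × StackM M′ [] × M′ QQ 0ℤ ≡ code p} refl
        (core , (refl , λ ()) , sym (code-def (proj₁ p) (proj₂ p))))
    λ {M₁} _ (core@(R , _) , st , eq) → run-≐
      (λ e → run-skip (kept-state M₁ core G (absent R (trans (cong (M₁ WH) (sym eq)) e))))
      (λ ne → present {M₁} core st eq (Rep.absent R p) ne)
    where
    absent : ∀ {cnt sl pos wh} → Rep cnt sl pos wh bs → wh (code p) ≡ 0ℤ → Kept bs
    absent R e = (λ s → sub s , λ { refl → wh0⇒∉ R e s }) , λ x∈ _ → sup x∈
    present : ∀ {M₁} → CoreM m P bs L M₁ → StackM M₁ [] → M₁ QQ 0ℤ ≡ code p →
        M₁ WH (code p) ≡ 0ℤ ⊎ Stored bs p → M₁ WH (M₁ QQ 0ℤ) ≢ 0ℤ → Runs _ M₁ W _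
    present {M₁} core st eq (inj₁ e) ne = contradiction (trans (cong (M₁ WH) eq) e) ne
    present core st eq (inj₂ (b , p∈)) ne = found-run G sub sup (proj₂ (∈-at p∈)) core st eq

-- Searching for a cover

-- A line of the cover to be found: no point, one point or two points of it
-- have been fixed.
data Slot : Set where
  free : Slot
  one  : Point → Slot
  two  : Point → Point → Slot

fixed : Slot → ℕ
fixed free      = 0
fixed (one _)   = 1
fixed (two _ _) = 2

-- The answer consists of proper lines even where a slot is not fully determined: the x-axis for a
-- free slot, and the horizontal line through the point for a slot with one point.
coefs : Slot → Coefs
coefs free      = 0ℤ , + 1 , 0ℤ
coefs (one p)   = 0ℤ , D p , Y p
coefs (two p q) = join p q

Slots : Set
Slots = ℕ → Slot

-- Only a slot with two points counts. The provisional line of any other slot may still change, so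
-- lying on it does not settle a point.
data Determined (q : Point) : Slot → Set where
  determined : ∀ {p p′} → q onᶻ join p p′ → Determined q (two p p′)

determined? : ∀ q s → Dec (Determined q s)
determined? q free = no λ ()
determined? q (one _) = no λ ()
determined? q (two p p′) = map′ determined (λ { (determined o) → o }) (q onᶻ? join p p′)

Covered : ℕ → Slots → Point → Set
Covered j s q = ∃[ t ] t < j × Determined q (s t)

covered? : ∀ j s q → Dec (Covered j s q)
covered? zero s q = no λ ()
covered? (suc j) s q with determined? q (s j)
... | yes d = yes (j , ℕ.≤-refl , d)
... | no ¬d with covered? j s q
...   | yes (t , t<j , d) = yes (t , ℕ.m≤n⇒m≤1+n t<j , d)
...   | no ¬c = no go
  where
  go : ¬ Covered (suc j) s q
  go (t , t<sj , d) with ℕ.m≤n⇒m<n∨m≡n (ℕ.s≤s⁻¹ t<sj)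
  ... | inj₁ t<j = ¬c (t , t<j , d)
  ... | inj₂ refl = ¬d d

-- The values for base 0 are those the machine computes, where division by zero yields zero. No
-- digit is then below the base, so every trial on a nonempty kernel fails.
quo rem : ℕ → ℕ → ℕ
quo w zero = 0
quo w (suc j) = w ℕ./ suc j
rem w zero = w
rem w (suc j) = w ℕ.% suc j

fill : Slot → Point → Maybe Slot
fill free q = just (one q)
fill (one p) q = just (two p q)
fill (two _ _) q = nothing

-- Points not yet covered are assigned to slots; the choices are the digits of w
-- in base j.
search : ℕ → List Point → Slots → ℕ → Maybe Slots
search j [] s w = just s
search j (q ∷ l) s w with covered? j s q
... | yes _ = search j l s w
... | no _ with rem w j <? j
...   | no _ = nothing
...   | yes _ with fill (s (rem w j)) q
...     | nothing = nothing
...     | just σ = search j l (s [ rem w j := σ ]) (quo w j)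

search-covered : ∀ j q l s w → Covered j s q → search j (q ∷ l) s w ≡ search j l s w
search-covered j q l s w c with covered? j s q
... | yes _ = refl
... | no ¬c = contradiction c ¬c

search-range : ∀ j q l s w → ¬ Covered j s q → ¬ rem w j < j → search j (q ∷ l) s w ≡ nothing
search-range j q l s w ¬c ¬r with covered? j s q
... | yes c = contradiction c ¬c
... | no _ with rem w j <? j
...   | no _ = refl
...   | yes r = contradiction r ¬r

search-full : ∀ j q l s w → ¬ Covered j s q → fill (s (rem w j)) q ≡ nothing → search j (q ∷ l) s w ≡ nothing
search-full j q l s w ¬c e with covered? j s q
... | yes c = contradiction c ¬c
... | no _ with rem w j <? j
...   | no _ = refl
...   | yes _ rewrite e = refl

search-fill : ∀ j q l s w {σ} → ¬ Covered j s q → rem w j < j → fill (s (rem w j)) q ≡ just σ →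
  search j (q ∷ l) s w ≡ search j l (s [ rem w j := σ ]) (quo w j)
search-fill j q l s w ¬c r e with covered? j s q
... | yes c = contradiction c ¬c
... | no _ with rem w j <? j
...   | no ¬r = contradiction r ¬r
...   | yes _ rewrite e = refl

data Fixes : Slot → Point → Set where
  one  : ∀ {p} → Fixes (one p) p
  two₁ : ∀ {p q} → Fixes (two p q) p
  two₂ : ∀ {p q} → Fixes (two p q) q

data Sane : Slot → Set where
  free : Sane free
  one  : ∀ {p} → Sane (one p)
  two  : ∀ {p q} → p ≢ q → Sane (two p q)

data Holds : Slot → Point → Set where
  one  : ∀ {p} → Holds (one p) p
  two  : ∀ {p p′ q} → q onᶻ join p p′ → Holds (two p p′) q

holds-on : ∀ {s q} → Holds s q → q onᶻ coefs s
holds-on {q = q} one = trans (ℤ.+-identityˡ (D q ℤ.* Y q)) (ℤ.*-comm (D q) (Y q))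
holds-on (two o) = o

sane-proper : ∀ {s} → Sane s → Proper (coefs s)
sane-proper free (_ , ())
sane-proper (one {p}) (_ , e) = D≢0 p e
sane-proper (two p≢q) = join-proper p≢q

fill-sane : ∀ {s q σ} → Sane s → (∀ {p} → Fixes s p → p ≢ q) → fill s q ≡ just σ → Sane σ
fill-sane {free} sn f refl = one
fill-sane {one p} sn f refl = two (f one)

fill-holds : ∀ {s q σ} → fill s q ≡ just σ → Holds σ q
fill-holds {free} refl = one
fill-holds {one p} {q} refl = two (join-onʳ p q)

fill-keeps : ∀ {s q σ r} → fill s q ≡ just σ → Holds s r → Holds σ r
fill-keeps {one p} {q} refl one = two (join-onˡ p q)

fill-fixes : ∀ {s q σ p} → fill s q ≡ just σ → Fixes σ p → p ≡ q ⊎ Fixes s p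
fill-fixes {free} refl one = inj₁ refl
fill-fixes {one p} refl two₁ = inj₂ one
fill-fixes {one p} refl two₂ = inj₁ refl

-- Together with the distinctness of the remaining points, this ensures that a slot receives two
-- different points and their join is a proper line.
Disjoint : Slots → List Point → Set
Disjoint s l = ∀ {t p} → Fixes (s t) p → p ∉ l

disjoint-fill : ∀ {s q l d σ} → Unique (q ∷ l) → Disjoint s (q ∷ l) → fill (s d) q ≡ just σ →
    Disjoint (s [ d := σ ]) l
disjoint-fill {s} {q} {l} {d} {σ} (q∉ ∷ _) dis e {t} {p} fx p∈ with t ℕ.≟ d
... | no t≢d = dis (subst (λ x → Fixes x p) (:=-other s t≢d) fx) (there p∈)
... | yes refl with fill-fixes e (subst (λ x → Fixes x p) (:=-same s t) fx)
...   | inj₁ refl = All.lookup q∉ p∈ refl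
...   | inj₂ fx′ = dis fx′ (there p∈)

Held : ℕ → Slots → Point → Set
Held j s q = ∃[ t ] t < j × Holds (s t) q

-- A point is held from the moment it is processed, either by a slot already determined or by the
-- slot it enters. It stays held: a single fixed point lies on the join with the second one.
search-sound : ∀ j l s w {s′} → Unique l → Disjoint s l → (∀ t → Sane (s t)) → search j l s w ≡ just s′ →
  (∀ t → Sane (s′ t)) × (∀ {q} → Held j s q → Held j s′ q) × (∀ {q} → q ∈ l → Held j s′ q)
search-sound j [] s w u dis sn refl = sn , (λ h → h) , λ ()
search-sound j (q ∷ l) s w u@(_ ∷ u′) dis sn e with covered? j s q
... | yes (t , t<j , d) with search-sound j l s w u′ (λ fx p∈ → dis fx (there p∈)) sn e
...   | sn′ , keep , get = sn′ , keep , λ { (here refl) → keep (t , t<j , held d) ; (there q∈) → get q∈ }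
  where
  held : ∀ {σ} → Determined q σ → Holds σ q
  held (determined o) = two o
search-sound j (q ∷ l) s w u@(_ ∷ u′) dis sn e | no _ with rem w j <? j
... | yes r with fill (s (rem w j)) q in fe
...   | just σ with search-sound j l (s [ rem w j := σ ]) (quo w j) u′
    (λ {t} → disjoint-fill {s} {q} {l} {rem w j} u dis fe {t}) sn₁ e
  where
  sn₁ : ∀ t → Sane ((s [ rem w j := σ ]) t)
  sn₁ t with t ℕ.≟ rem w j
  ... | yes refl = subst Sane (sym (:=-same s t)) (fill-sane (sn t) (λ fx p≡q → dis fx (here p≡q)) fe)
  ... | no ne = subst Sane (sym (:=-other s ne)) (sn t)
...     | sn′ , keep , get = sn′ , (λ h → keep (keep₁ h)) ,
    λ { (here refl) → keep (rem w j , r , subst (λ σ → Holds σ q) (sym (:=-same s (rem w j))) (fill-holds fe))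
                                                              ; (there q∈) → get q∈ }
  where
  keep₁ : ∀ {r} → Held j s r → Held j (s [ rem w j := σ ]) r
  keep₁ {r} (t , t<j , h) with t ℕ.≟ rem w j
  ... | yes refl = t , t<j , subst (λ σ → Holds σ r) (sym (:=-same s t)) (fill-keeps fe h)
  ... | no ne = t , t<j , subst (λ σ → Holds σ r) (sym (:=-other s ne)) h

-- Completeness of the search and the number of trials

room : Slot → ℕ
room σ = 2 ∸ fixed σ

-- The number of points that the first j slots can still take. Every assignment consumes one digit
-- and lowers it by one, so it bounds the number of digits that matter.
capacity : ℕ → Slots → ℕ
capacity zero s = 0
capacity (suc j) s = room (s j) + capacity j s

capacity-other : ∀ j s {d σ} → j ≤ d → capacity j (s [ d := σ ]) ≡ capacity j s
capacity-other zero s le = refl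
capacity-other (suc j) s le = cong₂ _+_ (cong room (:=-other s (ℕ.<⇒≢ le))) (capacity-other j s (ℕ.<⇒≤ le))

capacity-fill : ∀ j s {d σ} → d < j → room (s d) ≡ suc (room σ) → capacity j s ≡ suc (capacity j (s [ d := σ ]))
capacity-fill (suc j) s {d} {σ} d<sj e with ℕ.m≤n⇒m<n∨m≡n (ℕ.s≤s⁻¹ d<sj)
... | inj₁ d<j = trans (cong₂ _+_ (cong room (sym (:=-other s (ℕ.<⇒≢ d<j ∘ sym)))) (capacity-fill j s d<j e))
    (ℕ.+-suc _ _)
... | inj₂ refl = trans (cong (_+ capacity j s) e)
    (cong suc (cong₂ _+_ (cong room (sym (:=-same s d))) (sym (capacity-other j s ℕ.≤-refl))))

capacity-free : ∀ j → capacity j (λ _ → free) ≡ 2 * j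
capacity-free zero = refl
capacity-free (suc j) = trans (cong (λ c → 2 + c) (capacity-free j)) (sym (ℕ.*-suc 2 j))

fill-room : ∀ {s q σ} → fill s q ≡ just σ → room s ≡ suc (room σ)
fill-room {free} refl = refl
fill-room {one p} refl = refl

rem-digit : ∀ {j d} w → d < j → rem (d + w * j) j ≡ d
rem-digit {suc j} {d} w lt = trans (ℕ.[m+kn]%n≡m%n d w (suc j)) (ℕ.m<n⇒m%n≡m lt)

quo-digit : ∀ {j d} w → d < j → quo (d + w * j) j ≡ w
quo-digit {suc j} {d} w lt = trans
    (ℕ.+-distrib-/ d (w * suc j) (subst (_< suc j) (sym (cong₂ _+_ (ℕ.m<n⇒m%n≡m lt) (ℕ.m*n%n≡0 w (suc j))))
    (subst (_< suc j) (sym (ℕ.+-identityʳ d)) lt)))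
  (trans (cong₂ _+_ (ℕ.m<n⇒m/n≡0 lt) (ℕ.m*n/n≡m w (suc j))) refl)

module Complete (j : ℕ) (ℓ : ℕ → Line) where

  data Obeys (t : ℕ) : Slot → Set where
    free : Obeys t free
    one  : ∀ {p} → p on ℓ t → Obeys t (one p)
    two  : ∀ {p q} → p ≢ q → p on ℓ t → q on ℓ t → Obeys t (two p q)

  -- A full slot has two distinct points of `ℓ t` and so determines that line; a point `q` on it
  -- would already be covered.
  obeys-fill : ∀ {t s q} → Obeys t s → q on ℓ t → (∀ {p} → Fixes s p → p ≢ q) → ¬ Determined q s →
      ∃[ σ ] fill s q ≡ just σ × Obeys t σ
  obeys-fill free o _ _ = _ , refl , one o
  obeys-fill (one o′) o f _ = _ , refl , two (f one) o′ o
  obeys-fill {t} {two p p′} {q} (two p≢p′ op op′) o _ ¬d = contradiction (determined (on⇒onᶻ (join p p′) {pr}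
    (two-points (ℓ t) (toLine (join p p′) pr) p≢p′ op op′ (onᶻ⇒on (join p p′) {pr} (join-onˡ p p′))
        (onᶻ⇒on (join p p′) {pr} (join-onʳ p p′)) o))) ¬d
    where pr = join-proper p≢p′

  place : ∀ {q l s d} → Unique (q ∷ l) → Disjoint s (q ∷ l) → (∀ t → Obeys t (s t)) → ¬ Covered j s q → d < j →
      q on ℓ d →
    ∃[ σ ] fill (s d) q ≡ just σ × Disjoint (s [ d := σ ]) l × (∀ t → Obeys t ((s [ d := σ ]) t)) ×
      capacity j s ≡ suc (capacity j (s [ d := σ ]))
  place {q} {l} {s} {d} u dis ob ¬c d<j o with obeys-fill (ob d) o (λ fx p≡q → dis fx (here p≡q))
      (λ dt → ¬c (d , d<j , dt))
  ... | σ , fe , oσ = σ , fe , (λ {t} → disjoint-fill {s} {q} {l} {d} u dis fe {t}) , ob′ ,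
      capacity-fill j s d<j (fill-room fe)
    where
    ob′ : ∀ t → Obeys t ((s [ d := σ ]) t)
    ob′ t with t ℕ.≟ d
    ... | yes refl = subst (Obeys t) (sym (:=-same s t)) oσ
    ... | no ne = subst (Obeys t) (sym (:=-other s ne)) (ob t)

  search-digit : ∀ q l s d w {σ} → ¬ Covered j s q → d < j → fill (s d) q ≡ just σ →
      search j (q ∷ l) s (d + w * j) ≡ search j l (s [ d := σ ]) w
  search-digit q l s d w {σ} ¬c d<j fe = trans
      (search-fill j q l s (d + w * j) ¬c (subst (_< j) (sym e) d<j) (trans (cong (λ d → fill (s d) q) e) fe))
    (cong₂ (λ d w → search j l (s [ d := σ ]) w) e (quo-digit w d<j))
    where e = rem-digit w d<j

  -- Each uncovered point is sent to the slot of a cover line through it, and covered points use up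
  -- no digit. The digit string is therefore no longer than `capacity`.
  search-complete : ∀ l s → Unique l → Disjoint s l → (∀ t → Obeys t (s t)) →
      (∀ {q} → q ∈ l → ∃[ t ] t < j × q on ℓ t) →
    ∃[ w ] w < j ^ capacity j s × ∃[ s′ ] search j l s w ≡ just s′
  search-complete [] s u dis ob cov = 0 , some j s , s , refl
    where
    some : ∀ j s → 0 < j ^ capacity j s
    some zero s = s≤s z≤n
    some (suc j) s = ℕ.m^n>0 (suc j) (capacity (suc j) s)
  search-complete (q ∷ l) s u@(_ ∷ u′) dis ob cov = go (covered? j s q)
    where
    go : Dec (Covered j s q) → ∃[ w ] w < j ^ capacity j s × ∃[ s′ ] search j (q ∷ l) s w ≡ just s′
    go (yes c) with search-complete l s u′ (λ fx p∈ → dis fx (there p∈)) ob (cov ∘ there)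
    ... | w , w< , s′ , e = w , w< , s′ , trans (search-covered j q l s w c) e
    go (no ¬c) with cov (here refl)
    ... | d , d<j , o with place {q} {l} {s} {d} u dis ob ¬c d<j o
    ...   | σ , fe , dis′ , ob′ , cap with search-complete l (s [ d := σ ]) u′ (λ {t} → dis′ {t}) ob′
        (cov ∘ there)
    -- The current choice becomes the lowest digit, since the search reads digits by repeated
    -- division.
    ...     | w , w< , s′ , e = d + w * j ,
      subst (λ c → d + w * j < j ^ c) (sym cap)
          (ℕ.<-≤-trans (ℕ.+-monoˡ-< (w * j) d<j) (ℕ.≤-trans (ℕ.*-monoˡ-≤ j w<) (ℕ.≤-reflexive (ℕ.*-comm _ j))))
          ,
      s′ , trans (search-digit q l s d w ¬c d<j fe) e

  -- The slots are interchangeable, so the first digit may be taken to be 0.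
  search-first : ∀ q l → Unique (q ∷ l) → (∀ {r} → r ∈ q ∷ l → ∃[ t ] t < j × r on ℓ t) → 0 < j → q on ℓ 0 →
    ∃[ w ] w < j ^ (2 * j ∸ 1) × ∃[ s′ ] search j (q ∷ l) (λ _ → free) (w * j) ≡ just s′
  search-first q l u@(_ ∷ u′) cov 0<j o
    with place {q} {l} {λ _ → free} {0} u (λ ()) (λ _ → free) (λ ()) 0<j o
  ... | σ , fe , dis′ , ob′ , cap with search-complete l ((λ _ → free) [ 0 := σ ]) u′ (λ {t} → dis′ {t}) ob′
      (cov ∘ there)
  ...   | w , w< , s′ , e = w , subst (λ c → w < j ^ c) (cong ℕ.pred (trans (sym cap) (capacity-free j))) w< ,
      s′ ,
          trans (search-digit q l (λ _ → free) 0 w (λ ()) 0<j fe) e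

-- Of 2j digits the first is fixed. For j = 0 the value is 1, so one trial is made and an empty
-- kernel is recognised.
choices : ℕ → ℕ
choices j = j ^ (2 * j ∸ 1)

choices-pos : ∀ j → 0 < choices j
choices-pos zero = s≤s z≤n
choices-pos (suc j) = ℕ.m^n>0 (suc j) (2 * suc j ∸ 1)

search-exists : ∀ j (ℓ : ℕ → Line) l → Unique l → (∀ {q} → q ∈ l → ∃[ t ] t < j × q on ℓ t) →
  ∃[ w ] w < choices j × ∃[ s′ ] search j l (λ _ → free) (w * j) ≡ just s′
search-exists j ℓ [] u cov = 0 , choices-pos j , _ , refl
search-exists j ℓ (q ∷ l) u cov with cov (here refl)
... | d , d<j , o = Complete.search-first j ℓ′ q l u (λ r∈ → swap (cov r∈)) 0<j o
  where
  ℓ′ : ℕ → Line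
  ℓ′ = (ℓ [ d := ℓ 0 ]) [ 0 := ℓ d ]
  0<j : 0 < j
  0<j = ℕ.≤-<-trans z≤n d<j
  swap : ∀ {r} → ∃[ t ] t < j × r on ℓ t → ∃[ t ] t < j × r on ℓ′ t
  swap {r} (t , t<j , o) with t ℕ.≟ d
  ... | yes refl = 0 , 0<j , o
  ... | no t≢d with t ℕ.≟ 0
  ...   | yes refl = d , d<j , subst (r on_)
      (sym (trans (:=-other (ℓ [ d := ℓ 0 ]) (t≢d ∘ sym)) (:=-same ℓ d))) o
  ...   | no t≢0 = t , t<j , subst (r on_) (sym (trans (:=-other (ℓ [ d := ℓ 0 ]) t≢0) (:=-other ℓ t≢d))) o

-- Slot t has SC[t] fixed points, the first of which is SP[t], and the line
-- SA[t] x + SB[t] y = SX[t].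
SC SP SA SB SX OK WD TT COV DG FND CC NT : Array
SC  = 35
SP  = 36
SA  = 37
SB  = 38
SX  = 39
OK  = 40
WD  = 41
TT  = 42
COV = 43
DG  = 44
FND = 45
CC  = 46
NT  = 47

-- `copyᴾ` takes the positions below `II`. Bucket 0 is copied entirely; of a class, m + 1 positions
-- are copied, which exist because a nonempty class has more than m points.
copyᴾ kernelᴾ : Program
copyᴾ = for II ((KP [ $ KN ]≔ SL [ pairᴱ ($ PB) ($ II) ]) ⨾ (KN ≔ uno ⊕ $ KN))
kernelᴾ =
  ((KN ≔ zer) ⨾ (PB ≔ zer) ⨾ (II ≔ CNT [ zer ])) ⨾ copyᴾ ⨾
  (CC ≔ $ GG) ⨾ for CC
    when zer ≺ CNT [ uno ⊕ $ CC ]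
    then ((PB ≔ uno ⊕ $ CC) ⨾ (II ≔ uno ⊕ $ GG)) ⨾ copyᴾ
    else skip end

-- A `for` loop cannot be left early. Once `OK` is 0, the remaining iterations of the trial do
-- nothing; likewise `FND` makes the search skip the trials after a success.
clearᴾ coverᴾ firstᴾ secondᴾ placeᴾ trialᴾ : Program
clearᴾ = (TT ≔ $ JJ) ⨾ for TT
  ((SC [ $ TT ]≔ zer) ⨾ (SA [ $ TT ]≔ zer) ⨾ (SB [ $ TT ]≔ uno) ⨾ (SX [ $ TT ]≔ zer))
coverᴾ = ((COV ≔ zer) ⨾ (TT ≔ $ JJ)) ⨾ for TT
  when SC [ $ TT ] ≐ lit (+ 2)
  then when SA [ $ TT ] ⊗ PX [ $ QQ ] ⊕ SB [ $ TT ] ⊗ PY [ $ QQ ] ≐ SX [ $ TT ] ⊗ PD [ $ QQ ] then COV ≔ uno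
      else skip end
  else skip end
firstᴾ =
  (SC [ $ DG ]≔ uno) ⨾ (SP [ $ DG ]≔ $ QQ) ⨾
  (SA [ $ DG ]≔ zer) ⨾ (SB [ $ DG ]≔ PD [ $ QQ ]) ⨾ (SX [ $ DG ]≔ PY [ $ QQ ])
secondᴾ =
  (WIT ≔ SP [ $ DG ]) ⨾ (UU ≔ Uᴱ ($ WIT) ($ QQ)) ⨾ (VV ≔ Vᴱ ($ WIT) ($ QQ)) ⨾
  (SC [ $ DG ]≔ lit (+ 2)) ⨾
  (SA [ $ DG ]≔ $ VV ⊗ PD [ $ WIT ]) ⨾
  (SB [ $ DG ]≔ zer ⊖ $ UU ⊗ PD [ $ WIT ]) ⨾
  (SX [ $ DG ]≔ $ VV ⊗ PX [ $ WIT ] ⊖ $ UU ⊗ PY [ $ WIT ])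
placeᴾ = ((DG ≔ $ WD ⊖ ($ WD ⊘ $ JJ) ⊗ $ JJ) ⨾ (WD ≔ $ WD ⊘ $ JJ)) ⨾
  when $ DG ≺ $ JJ
  then when SC [ $ DG ] ≐ zer then firstᴾ else when SC [ $ DG ] ≐ uno then secondᴾ else OK ≔ zer end end
  else OK ≔ zer end
trialᴾ = clearᴾ ⨾ ((OK ≔ uno) ⨾ (CC ≔ $ KN)) ⨾ for CC
  when $ OK ≐ zer then skip
  else (QQ ≔ KP [ $ CC ]) ⨾ coverᴾ ⨾ when $ COV ≐ zer then placeᴾ else skip end end

searchᴾ answerᴾ queryᴾ : Program
searchᴾ = ((FND ≔ zer) ⨾ (NT ≔ $ LL)) ⨾ for NT
  when $ FND ≐ zer then (WD ≔ $ NT ⊗ $ JJ) ⨾ trialᴾ ⨾ (FND ≔ $ OK) else skip end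
answerᴾ = when $ FND ≐ zer then out [ zer ]≔ lit -1ℤ
  else ((TT ≔ $ JJ) ⨾ (out [ zer ]≔ $ JJ)) ⨾ for TT
    ( (out [ uno ⊕ lit (+ 3) ⊗ $ TT ]≔ SA [ $ TT ]) ⨾
      (out [ lit (+ 2) ⊕ lit (+ 3) ⊗ $ TT ]≔ SB [ $ TT ]) ⨾
      (out [ lit (+ 3) ⊕ lit (+ 3) ⊗ $ TT ]≔ SX [ $ TT ]) ) end
queryᴾ = kernelᴾ ⨾ searchᴾ ⨾ answerᴾ

-- The search on the machine

quo-eval : ∀ w j → (+ w) div (+ j) ≡ + quo w j
quo-eval w zero = refl
quo-eval w (suc j) = ℤ.div-pos-is-/ℕ (+ w) (suc j)

rem-eval : ∀ w j → + w ℤ.- (+ w) div (+ j) ℤ.* + j ≡ + rem w j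
rem-eval w zero = ℤ.+-identityʳ (+ w)
rem-eval w (suc j) = trans (cong (λ z → + w ℤ.- z ℤ.* + suc j) (quo-eval w (suc j)))
  (trans (cong₂ ℤ._-_ (cong +_ (ℕ.m≡m%n+[m/n]*n w (suc j))) (sym (ℤ.pos-* (w ℕ./ suc j) (suc j))))
    (lem (+ (w ℕ.% suc j)) (+ (w ℕ./ suc j * suc j))))
  where
  lem : ∀ a b → a ℤ.+ b ℤ.- b ≡ a
  lem = solve-∀

-- The point `sp` is tied to slots with exactly one point, where the join with a second point is
-- still to be formed; from then on the coefficients describe the slot.
record SlotM (sc sp sa sb sx : ℤ → ℤ) (t : ℕ) (σ : Slot) : Set where
  constructor slotM
  field
    sc-ok : sc (+ t) ≡ + fixed σ
    sa-ok : sa (+ t) ≡ proj₁ (coefs σ)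
    sb-ok : sb (+ t) ≡ proj₁ (proj₂ (coefs σ))
    sx-ok : sx (+ t) ≡ proj₂ (proj₂ (coefs σ))
    sp-ok : ∀ {p} → σ ≡ one p → sp (+ t) ≡ code p

slot-cong : ∀ {sc sp sa sb sx sc′ sp′ sa′ sb′ sx′ t σ} → (∀ i → sc′ i ≡ sc i) → (∀ i → sp′ i ≡ sp i) →
    (∀ i → sa′ i ≡ sa i) →
  (∀ i → sb′ i ≡ sb i) → (∀ i → sx′ i ≡ sx i) → SlotM sc sp sa sb sx t σ → SlotM sc′ sp′ sa′ sb′ sx′ t σ
slot-cong c p a b x (slotM e₁ e₂ e₃ e₄ e₅) = slotM (trans (c _) e₁) (trans (a _) e₂) (trans (b _) e₃)
    (trans (x _) e₄) (λ e → trans (p _) (e₅ e))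

slot-other : ∀ {sc sp sa sb sx i t σ v₁ v₂ v₃ v₄ v₅} → + t ≢ i → SlotM sc sp sa sb sx t σ →
  SlotM (upd sc i v₁) (upd sp i v₂) (upd sa i v₃) (upd sb i v₄) (upd sx i v₅) t σ
slot-other {sc} {sp} {sa} {sb} {sx} ne (slotM e₁ e₂ e₃ e₄ e₅) =
    slotM (trans (upd-other sc ne) e₁) (trans (upd-other sa ne) e₂)
  (trans (upd-other sb ne) e₃) (trans (upd-other sx ne) e₄) (λ e → trans (upd-other sp ne) (e₅ e))

slotArrays : List Array
slotArrays = SC ∷ SP ∷ SA ∷ SB ∷ SX ∷ []

SlotsM : ℕ → Memory → Slots → Set
SlotsM j M s = ∀ {t} → t < j → SlotM (M SC) (M SP) (M SA) (M SB) (M SX) t (s t)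

slots-frame : ∀ {j p M M′ s} → sparing slotArrays p ≡ true → Frame p M M′ → SlotsM j M s → SlotsM j M′ s
slots-frame sp f sm t<j = slot-cong (k (here refl)) (k (there (here refl))) (k (there (there (here refl))))
    (k (there (there (there (here refl)))))
  (k (there (there (there (there (here refl)))))) (sm t<j)
  where k = kept slotArrays sp f

slots-:= : ∀ {j d σ} {s : Slots} {sc sp sa sb sx sc′ sp′ sa′ sb′ sx′} →
  (∀ {t} → t < j → SlotM sc sp sa sb sx t (s t)) →
      (∀ {t} → t ≢ d → SlotM sc sp sa sb sx t (s t) → SlotM sc′ sp′ sa′ sb′ sx′ t (s t)) →
  SlotM sc′ sp′ sa′ sb′ sx′ d σ → ∀ {t} → t < j → SlotM sc′ sp′ sa′ sb′ sx′ t ((s [ d := σ ]) t)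
slots-:= {d = d} {σ} {s} sm oth new {t} t<j with t ℕ.≟ d
... | yes refl = subst (SlotM _ _ _ _ _ t) (sym (:=-same s t)) new
... | no ne = subst (SlotM _ _ _ _ _ t) (sym (:=-other s ne)) (oth ne (sm t<j))

module Trial {P : PointSet} {j : ℕ} {K : List Point} (K⊆P : ∀ {q} → q ∈ K → q ∈ P) (J : Scale) (j≤J : j ≤ size J) where

  CtxM : Memory → Set
  CtxM M = M JJ 0ℤ ≡ + j × (∀ {p} → p ∈ P → Attr M p) × StackM M K

  ctxArrays : List Array
  ctxArrays = JJ ∷ PX ∷ PY ∷ PD ∷ KN ∷ KP ∷ []

  ctx-frame : ∀ {p M M′} → sparing ctxArrays p ≡ true → Frame p M M′ → CtxM M → CtxM M′
  ctx-frame {M = M} {M′} sp f (ej , at , en , st) = trans (k (here refl) 0ℤ) ej ,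
    (λ p∈ → attr-cong {M} {M′} (k (there (here refl))) (k (there (there (here refl))))
        (k (there (there (there (here refl))))) (at p∈)) ,
    trans (k (there (there (there (there (here refl))))) 0ℤ) en , λ a →
        trans (k (there (there (there (there (there (here refl)))))) _) (st a)
    where k = kept ctxArrays sp f

  clear-run : ∀ {M} → CtxM M → Runs clearᴾ M J (λ M′ → SlotsM j M′ (λ _ → free))
  clear-run {M} c = run-seq (run-block {Q = λ M′ → M′ TT 0ℤ ≡ + j} refl (proj₁ c))
    λ _ et → run-post (λ _ inv t<j → inv z≤n t<j)
      (run-for₁ J (λ n M → ∀ {t} → n ≤ t → t < j → SlotM (M SC) (M SP) (M SA) (M SB) (M SX) t free) refl id
        (λ {n} {M} f et inv → run-block refl λ n≤t t<j → step {n} {M} et inv (≤-split n≤t) t<j) j et j≤J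
        (λ j≤t t<j → contradiction t<j (ℕ.≤⇒≯ j≤t)))
    where
    step : ∀ {n M} → M TT 0ℤ ≡ + n →
        (∀ {t} → suc n ≤ t → t < j → SlotM (M SC) (M SP) (M SA) (M SB) (M SX) t free) →
      ∀ {t} → n ≡ t ⊎ suc n ≤ t → t < j →
      SlotM (upd (M SC) (M TT 0ℤ) 0ℤ) (M SP) (upd (M SA) (M TT 0ℤ) 0ℤ) (upd (M SB) (M TT 0ℤ) (+ 1))
          (upd (M SX) (M TT 0ℤ) 0ℤ) t free
    step {n} {M} et inv (inj₁ refl) t<j = slotM (upd-same (M SC) (sym et)) (upd-same (M SA) (sym et))
        (upd-same (M SB) (sym et)) (upd-same (M SX) (sym et)) λ ()
    step {n} {M} et inv {t} (inj₂ lt) t<j with inv lt t<j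
    ... | slotM e₁ e₂ e₃ e₄ e₅ = slotM (trans (upd-other (M SC) ne) e₁) (trans (upd-other (M SA) ne) e₂)
        (trans (upd-other (M SB) ne) e₃) (trans (upd-other (M SX) ne) e₄) e₅
      where
      ne : + t ≢ M TT 0ℤ
      ne e = ℕ.<⇒≢ lt (sym (ℤ.+-injective (trans e et)))

  CoverOk : Slots → Point → ℕ → ℤ → Set
  CoverOk s q n c = (c ≡ + 1 × Covered j s q) ⊎ (c ≡ 0ℤ × (∀ {t} → n ≤ t → t < j → ¬ Determined q (s t)))

  cover-run : ∀ {M s q} → CtxM M → SlotsM j M s → M QQ 0ℤ ≡ code q → q ∈ P →
      Runs coverᴾ M J (λ M′ → CoverOk s q 0 (M′ COV 0ℤ))
  cover-run {M} {s} {q} c sm eq q∈ = run-seq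
    (run-block {Q = λ M′ → M′ TT 0ℤ ≡ + j × CoverOk s q j (M′ COV 0ℤ) × CtxM M′ × SlotsM j M′ s × M′ QQ 0ℤ ≡
        code q} refl
      (proj₁ c , inj₂ (refl , λ j≤t t<j → contradiction t<j (ℕ.≤⇒≯ j≤t)) , c , sm , eq))
    λ _ (et , co , c , sm , eq) → run-post (λ _ (_ , co) → co)
      (run-for₁ J (λ n M → n ≤ j × CoverOk s q n (M COV 0ℤ)) refl id
        (λ {n} {M} f et inv → body {n} {M} (proj₁ (proj₂ (ctx-frame refl f c)) q∈) (slots-frame refl f sm)
            (trans (same f QQ refl 0ℤ) eq) et inv) j et j≤J (ℕ.≤-refl , co))
    where
    body : ∀ {n M} → Attr M q → SlotsM j M s → M QQ 0ℤ ≡ code q → M TT 0ℤ ≡ + n →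
        suc n ≤ j × CoverOk s q (suc n) (M COV 0ℤ) →
      Runs _ M unit (λ M → n ≤ j × CoverOk s q n (M COV 0ℤ))
    body {n} {M} at sm eq et (n<j , co) = run-≐ yes-two no-two
      where
      slot = sm n<j
      keep : ¬ Determined q (s n) → ∀ {c} → CoverOk s q (suc n) c → CoverOk s q n c
      keep ¬d (inj₁ x) = inj₁ x
      keep ¬d (inj₂ (e , none)) = inj₂ (e , λ n≤t t<j → go (≤-split n≤t) t<j)
        where
        go : ∀ {t} → n ≡ t ⊎ suc n ≤ t → t < j → ¬ Determined q (s t)
        go (inj₁ refl) _ = ¬d
        go (inj₂ lt) t<j = none lt t<j
      esc : M SC (M TT 0ℤ) ≡ + fixed (s n)
      esc = trans (cong (M SC) et) (SlotM.sc-ok slot)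
      el : M SA (M TT 0ℤ) ℤ.* M PX (M QQ 0ℤ) ℤ.+ M SB (M TT 0ℤ) ℤ.* M PY (M QQ 0ℤ) ≡ lhs (coefs (s n)) q
      el = cong₂ ℤ._+_ (cong₂ ℤ._*_ (trans (cong (M SA) et) (SlotM.sa-ok slot))
          (trans (cong (M PX) eq) (proj₁ at)))
                       (cong₂ ℤ._*_ (trans (cong (M SB) et) (SlotM.sb-ok slot))
                           (trans (cong (M PY) eq) (proj₁ (proj₂ at))))
      er : M SX (M TT 0ℤ) ℤ.* M PD (M QQ 0ℤ) ≡ rhs (coefs (s n)) q
      er = cong₂ ℤ._*_ (trans (cong (M SX) et) (SlotM.sx-ok slot)) (trans (cong (M PD) eq) (proj₂ (proj₂ at)))
      det : ∀ σ → + fixed σ ≡ + 2 → lhs (coefs σ) q ≡ rhs (coefs σ) q → Determined q σ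
      det (two p p′) _ e = determined e
      undet : ∀ {σ} → Determined q σ → + fixed σ ≡ + 2 × lhs (coefs σ) q ≡ rhs (coefs σ) q
      undet (determined e) = refl , e
      yes-two : M SC (M TT 0ℤ) ≡ + 2 → Runs _ M unit _
      yes-two e = run-≐
        (λ e′ → run-block refl (ℕ.<⇒≤ n<j , inj₁
            (refl , n , n<j , det (s n) (trans (sym esc) e) (trans (sym el) (trans e′ er)))))
        (λ off → run-skip (ℕ.<⇒≤ n<j , keep (λ d → off (trans el (trans (proj₂ (undet d)) (sym er)))) co))
      no-two : M SC (M TT 0ℤ) ≢ + 2 → Runs _ M unit _
      no-two ne = run-skip (ℕ.<⇒≤ n<j , keep (λ d → ne (trans esc (proj₁ (undet d)))) co)

  -- Forming a join reads the stored coordinates of the first point of the slot, and these are known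
  -- for the points of `P`.
  Ones : Slots → Set
  Ones s = ∀ {t p} → s t ≡ one p → p ∈ P

  ones-:= : ∀ {s d σ} → Ones s → (∀ {p} → σ ≡ one p → p ∈ P) → Ones (s [ d := σ ])
  ones-:= {s} {d} o o′ {t} e with t ℕ.≟ d
  ... | yes refl = o′ (trans (sym (:=-same s t)) e)
  ... | no ne = o (trans (sym (:=-other s ne)) e)

  -- The result `res` of the entire search is fixed in advance; the loop maintains that continuing
  -- `search` with the present slots, digits and remaining points still yields it.
  Outcome : Maybe Slots → List Point → Memory → Set
  Outcome res l M = (M OK 0ℤ ≡ + 1 × ∃[ s ] ∃[ w ] M WD 0ℤ ≡ + w × SlotsM j M s × Ones s × res ≡ search j l s
      w) ⊎ (M OK 0ℤ ≡ 0ℤ × res ≡ nothing)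

  place-run : ∀ {M Z s q l w} → CtxM M → SlotsM j M s → M QQ 0ℤ ≡ code q → q ∈ P → M WD 0ℤ ≡ + w →
      M OK 0ℤ ≡ + 1 →
    Ones s → ¬ Covered j s q → Runs placeᴾ M Z (Outcome (search j (q ∷ l) s w) l)
  place-run {M} {Z} {s} {q} {l} {w} c sm eq q∈ ew eo one∈ ¬c = run-seq
    (run-block {Q = λ M′ → M′ DG 0ℤ ≡ + d × M′ WD 0ℤ ≡ + quo w j × M′ JJ 0ℤ ≡ + j × (∀ {p} → p ∈ P → Attr M′ p)
        × SlotsM j M′ s × M′ QQ 0ℤ ≡ code q × M′ OK 0ℤ ≡ + 1} refl
      ( trans (cong₂ (λ x y → x ℤ.- x div y ℤ.* y) ew (proj₁ c)) (rem-eval w j)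
      , trans (cong₂ _div_ ew (proj₁ c)) (quo-eval w j) , proj₁ c , proj₁ (proj₂ c) , sm , eq , eo ))
    λ {M₁} _ (ed , ew , ej , at , sm , eq , eo) → run-≺
      (λ lt → let d<j = ℤ.drop‿+<+ (subst₂ ℤ._<_ ed ej lt) in choose {M₁} d<j ed ew at sm eq eo (s d) refl)
      (λ ¬lt → run-block refl (inj₂ (refl , search-range j q l s w ¬c
          (λ d<j → ¬lt (subst₂ ℤ._<_ (sym ed) (sym ej) (ℤ.+<+ d<j))))))
    where
    d = rem w j
    choose : ∀ {M} → d < j → M DG 0ℤ ≡ + d → M WD 0ℤ ≡ + quo w j → (∀ {p} → p ∈ P → Attr M p) → SlotsM j M s →
        M QQ 0ℤ ≡ code q → M OK 0ℤ ≡ + 1 →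
      ∀ σ → s d ≡ σ → Runs (when SC [ $ DG ] ≐ zer then firstᴾ else when SC [ $ DG ] ≐ uno then secondᴾ else OK
          ≔ zer end end) M Z (Outcome (search j (q ∷ l) s w) l)
    choose {M} d<j ed ew at sm eq eo σ es = run-≐
      (λ e → is-free σ es (trans (sym esc) e))
      (λ ne → run-≐ (λ e → is-one σ es (trans (sym esc) e))
          (λ ne′ → is-two σ es (ne ∘ trans esc) (ne′ ∘ trans esc)))
      where
      slot : SlotM (M SC) (M SP) (M SA) (M SB) (M SX) d σ
      slot = subst (SlotM _ _ _ _ _ d) es (sm d<j)
      esc : M SC (M DG 0ℤ) ≡ + fixed σ
      esc = trans (cong (M SC) ed) (SlotM.sc-ok slot)
      ne : ∀ {t} → t ≢ d → + t ≢ M DG 0ℤ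
      ne t≢d e = t≢d (ℤ.+-injective (trans e ed))
      is-free : ∀ σ → s d ≡ σ → + fixed σ ≡ 0ℤ → Runs firstᴾ M Z (Outcome (search j (q ∷ l) s w) l)
      is-free free es _ = run-block refl (inj₁ (eo , s [ d := one q ] , quo w j , ew ,
        slots-:= {d = d} {one q} {s} sm (λ t≢d → slot-other (ne t≢d))
          (slotM (upd-same (M SC) (sym ed)) (upd-same (M SA) (sym ed))
              (trans (upd-same (M SB) (sym ed)) (trans (cong (M PD) eq) (proj₂ (proj₂ (at q∈)))))
            (trans (upd-same (M SX) (sym ed)) (trans (cong (M PY) eq) (proj₁ (proj₂ (at q∈)))))
                λ { refl → trans (upd-same (M SP) (sym ed)) eq }) ,
        (λ {t} → ones-:= {s} {d} one∈ (λ { refl → q∈ }) {t}) ,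
            search-fill j q l s w ¬c d<j (cong (λ σ → fill σ q) es)))
      is-one : ∀ σ → s d ≡ σ → + fixed σ ≡ + 1 → Runs secondᴾ M Z (Outcome (search j (q ∷ l) s w) l)
      is-one (one p) es _ = run-block refl (inj₁ (eo , s [ d := two p q ] , quo w j , ew ,
        slots-:= {d = d} {two p q} {s} sm
          (λ { t≢d (slotM e₁ e₂ e₃ e₄ e₅) → slotM (trans (upd-other (M SC) (ne t≢d)) e₁)
              (trans (upd-other (M SA) (ne t≢d)) e₂)
                 (trans (upd-other (M SB) (ne t≢d)) e₃) (trans (upd-other (M SX) (ne t≢d)) e₄) e₅ })
          (slotM (upd-same (M SC) (sym ed)) (trans (upd-same (M SA) (sym ed)) (cong₂ ℤ._*_ ev epd))
             (trans (upd-same (M SB) (sym ed)) (cong (ℤ._-_ 0ℤ) (cong₂ ℤ._*_ eu epd)))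
             (trans (upd-same (M SX) (sym ed)) (cong₂ ℤ._-_ (cong₂ ℤ._*_ ev epx) (cong₂ ℤ._*_ eu epy))) λ ()) ,
        (λ {t} → ones-:= {s} {d} one∈ (λ ()) {t}) , search-fill j q l s w ¬c d<j (cong (λ σ → fill σ q) es)))
        where
        ep : M SP (M DG 0ℤ) ≡ code p
        ep = trans (cong (M SP) ed) (SlotM.sp-ok (sm d<j) es)
        ap : Attr M p
        ap = at (one∈ es)
        M₁ : Memory
        M₁ = M [ WIT , 0ℤ ↦ M SP (M DG 0ℤ) ]
        eu = U-eval {M₁} {d = $ WIT} {e = $ QQ} ap (at q∈) ep eq
        ev = V-eval {M₁} {d = $ WIT} {e = $ QQ} ap (at q∈) ep eq
        epx : M PX (M SP (M DG 0ℤ)) ≡ X p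
        epx = trans (cong (M PX) ep) (proj₁ ap)
        epy : M PY (M SP (M DG 0ℤ)) ≡ Y p
        epy = trans (cong (M PY) ep) (proj₁ (proj₂ ap))
        epd : M PD (M SP (M DG 0ℤ)) ≡ D p
        epd = trans (cong (M PD) ep) (proj₂ (proj₂ ap))
      is-two : ∀ σ → s d ≡ σ → + fixed σ ≢ 0ℤ → + fixed σ ≢ + 1 →
          Runs (OK ≔ zer) M Z (Outcome (search j (q ∷ l) s w) l)
      is-two free _ ne _ = contradiction refl ne
      is-two (one _) _ _ ne = contradiction refl ne
      is-two (two _ _) es _ _ = run-block refl
          (inj₂ (refl , search-full j q l s w ¬c (cong (λ σ → fill σ q) es)))

  start : Slots
  start _ = free

  Tried : Maybe Slots → Memory → Set
  Tried res M = (M OK 0ℤ ≡ + 1 × ∃[ s ] SlotsM j M s × res ≡ just s) ⊎ (M OK 0ℤ ≡ 0ℤ × res ≡ nothing)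

  module _ (KS : Scale) (K≤KS : length K ≤ size KS) where

    trial-run : ∀ {M w} → CtxM M → M WD 0ℤ ≡ + w → Runs trialᴾ M (J · KS) (Tried (search j K start w))
    trial-run {M} {w} c ew = run-seq
        (run-mono (ℕ.≤-trans (ℕ.≤-reflexive (sym (ℕ.*-identityʳ _))) (ℕ.*-monoʳ-≤ (size J) (pos KS)))
        (clear-run {M} c))
      λ {M₁} f sm → run-seq
        (run-block {Q = λ M′ → M′ CC 0ℤ ≡ + length K × Outcome (search j K start w) K M′ × CtxM M′} refl
          (trans (same f KN refl 0ℤ) (proj₁ (proj₂ (proj₂ c))) ,
              inj₁ (refl , start , w , trans (same f WD refl 0ℤ) ew , sm , (λ ()) , refl) , ctx-frame refl f c))
      λ _ (ec , o , c) → run-post (λ { {M′} _ (_ , _ , o) → fin {M′} o })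
        (run-each {X = J} KS K (λ _ r M → Outcome (search j K start w) r M) refl id
            (λ {d} {x} {r} {M} f ec e o → body {d} {x} {r} {M} (ctx-frame refl f c) ec e o) ec K≤KS o)
      where
      fin : ∀ {M} → Outcome (search j K start w) [] M → Tried (search j K start w) M
      fin (inj₁ (eo , s , _ , _ , sm , _ , e)) = inj₁ (eo , s , sm , e)
      fin (inj₂ x) = inj₂ x
      body : ∀ {d x r M} → CtxM M → M CC 0ℤ ≡ + length r → d ʳ++ (x ∷ r) ≡ K →
          Outcome (search j K start w) (x ∷ r) M →
        Runs _ M J (Outcome (search j K start w) r)
      body {d} {x} {r} {M} c ec e (inj₂ (eo , none)) = run-≐ (λ _ → run-skip (inj₂ (eo , none)))
          (λ ne → contradiction eo ne)
      body {d} {x} {r} {M} c ec e (inj₁ (eo , s , w′ , ew , sm , os , es)) =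
          run-≐ (λ e → contradiction (trans (sym eo) e) λ ())
        λ _ → run-seq
          (run-block {Q = λ M′ → M′ QQ 0ℤ ≡ code x × CtxM M′ × SlotsM j M′ s × M′ WD 0ℤ ≡ + w′ × M′ OK 0ℤ ≡ +
              1} refl
            (trans (cong (M KP) ec) (proj₂ (proj₂ (proj₂ c)) a) , c , sm , ew , eo))
          λ {M₁} _ (eq , c , sm , ew , eo) → run-seq (cover-run {M₁} c sm eq x∈)
          λ { {M₂} f (inj₁ (eco , cv)) → run-≐ (λ e → contradiction (trans (sym eco) e) λ ())
                (λ _ → run-skip (inj₁ (trans (same f OK refl 0ℤ) eo , s , w′ , trans (same f WD refl 0ℤ) ew ,
                    slots-frame refl f sm , (λ {t} → os {t}) ,
                   trans es (search-covered j x r s w′ cv))))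
            ; {M₂} f (inj₂ (eco , un)) → run-≐
                (λ _ → run-post (λ { {M₃} _ o → via {M₃} o })
                    (place-run {M₂} (ctx-frame refl f c) (slots-frame refl f sm) (trans (same f QQ refl 0ℤ) eq)
                    x∈ (trans (same f WD refl 0ℤ) ew)
                   (trans (same f OK refl 0ℤ) eo) (λ {t} → os {t}) (λ (t , t<j , dt) → un z≤n t<j dt)))
                (λ ne → contradiction eco ne) }
        where
        a : At K x (length r)
        a = subst (λ l → At l x (length r)) e (at-ʳ++ d)
        x∈ : x ∈ P
        x∈ = K⊆P (at-∈ a)
        via : ∀ {M} → Outcome (search j (x ∷ r) s w′) r M → Outcome (search j K start w) r M
        via (inj₁ (eo , s′ , w″ , ew , sm , os , e)) = inj₁
            (eo , s′ , w″ , ew , sm , (λ {t} → os {t}) , trans es e)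
        via (inj₂ (eo , e)) = inj₂ (eo , trans es e)

    Searched : ℕ → ℕ → Memory → Set
    Searched N n M = (M FND 0ℤ ≡ + 1 × ∃[ s ] ∃[ w ] SlotsM j M s × search j K start (w * j) ≡ just s)
      ⊎ (M FND 0ℤ ≡ 0ℤ × (∀ {w} → n ≤ w → w < N → search j K start (w * j) ≡ nothing))

    search-run : ∀ {M N} (NS : Scale) → N ≤ size NS → CtxM M → M LL 0ℤ ≡ + N →
        Runs searchᴾ M (J · KS · NS) (Searched N 0)
    search-run {M} {N} NS N≤ c el = run-seq
      (run-block {Q = λ M′ → M′ NT 0ℤ ≡ + N × Searched N N M′ × CtxM M′} refl
        (el , inj₂ (refl , λ N≤w w<N → contradiction w<N (ℕ.≤⇒≯ N≤w)) , c))
      λ _ (en , sd , c) → run-for {X = J · KS} NS (Searched N) refl id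
          (λ {n} {M} f en sd → body {n} {M} (ctx-frame refl f c) en sd) N en N≤ sd
      where
      body : ∀ {n M} → CtxM M → M NT 0ℤ ≡ + n → Searched N (suc n) M → Runs _ M (J · KS) (Searched N n)
      body c en (inj₁ x@(ef , _)) = run-≐ (λ e → contradiction (trans (sym ef) e) λ ())
          (λ _ → run-skip (inj₁ x))
      body {n} {M} c en (inj₂ (ef , none)) = run-≐
        (λ _ → run-seq
          (run-block {Q = λ M′ → M′ WD 0ℤ ≡ + (n * j) × CtxM M′} refl
              (trans (cong₂ ℤ._*_ en (proj₁ c)) (sym (ℤ.pos-* n j)) , c))
          λ {M₁} _ (ew , c) → run-seq (trial-run {M₁} c ew)
          λ { f (inj₁ (eo , s , sm , e)) → run-block refl (inj₁ (eo , s , n , sm , e))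
            ; f (inj₂ (eo , e)) → run-block refl (inj₂ (eo , λ n≤w → go e (≤-split n≤w))) })
        (λ ne → contradiction ef ne)
        where
        go : search j K start (n * j) ≡ nothing → ∀ {w} → n ≡ w ⊎ suc n ≤ w → w < N →
            search j K start (w * j) ≡ nothing
        go e (inj₁ refl) _ = e
        go e (inj₂ lt) w<N = none lt w<N

-- The kernel of a query

suffix : ∀ {A : Set} n (l : List A) → n ≤ length l → ∃[ l′ ] length l′ ≡ n × (∀ {x k} → At l′ x k → At l x k)
suffix n [] le = [] , sym (ℕ.n≤0⇒n≡0 le) , λ ()
suffix n (x ∷ l) le with ℕ.m≤n⇒m<n∨m≡n le
... | inj₂ e = x ∷ l , sym e , λ a → a
... | inj₁ lt with suffix n l (ℕ.s≤s⁻¹ lt)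
...   | l′ , e , f = l′ , e , λ a → there (f a)

copy-run : ∀ {M bs b stk} (Y : Scale) (l : List Point) → RepM M bs → M PB 0ℤ ≡ + b → M II 0ℤ ≡ + length l →
  (∀ {p n} → At l p n → At (bs b) p n) → StackM M stk → length l ≤ size Y →
      Runs copyᴾ M Y (λ M′ → StackM M′ (l ʳ++ stk))
copy-run {M} {bs} {b} {stk} Y l R eb ei sub st le = run-post
  (λ { {M′} _ (d , e , st) → subst (StackM M′) (trans (cong (_++ stk) (ʳ++-flip d e)) (sym (ʳ++-defn l))) st })
  (run-each₁ Y l (λ d r M → StackM M (d ++ stk)) refl id
    (λ {d} {x} {r} {M} f ei e st → run-block refl
      ( cong (ℤ._+_ (+ 1)) (proj₁ st)
      , stack-push {M KP} (proj₁ st) (proj₂ st)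
          (trans (cong (M SL) (trans (cong₂ pair (trans (same f PB refl 0ℤ) eb) ei) (sym (idx-def b _))))
          (trans (same f SL refl _) (Rep.sl-ok R (sub (subst (λ l → At l x (length r)) e (at-ʳ++ d)))))) ))
    ei le st)

module Kernel {m : ℕ} {P : PointSet} {bs : Buckets} {L : ℕ → Coefs} (G : Good m bs L) (cov : CoverableBy m P)
  (sub : ∀ {x} → Stored bs x → x ∈ P) (sup : ∀ {x} → x ∈ P → Stored bs x) where

  -- The classes of index n and above have been copied. `small` reserves m + 1 places for each class
  -- still to come, so the same bound serves at every stage.
  record KernelFrom (n : ℕ) (K : List Point) : Set where
    field
      unique : Unique K
      origin : ∀ {q} → q ∈ K → q ∈ bs 0 ⊎ ∃[ i ] n ≤ i × q ∈ bs (suc i)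
      light  : ∀ {q} → q ∈ bs 0 → q ∈ K
      heavy  : ∀ i → n ≤ i → bs (suc i) ≢ [] → ∃[ l ] Unique l × length l ≡ suc m ×
               (∀ {q} → q ∈ l → q ∈ bs (suc i)) × (∀ {q} → q ∈ l → q ∈ K)
      small  : length K + n * suc m ≤ m * m + m * suc m
  open KernelFrom

  kernel-sub : ∀ {n K} → KernelFrom n K → ∀ {q} → q ∈ K → q ∈ P
  kernel-sub k q∈ with origin k q∈
  ... | inj₁ m = sub (0 , m)
  ... | inj₂ (i , _ , m) = sub (suc i , m)

  -- The m + 1 kernel points of a class make its line rich with respect to the kernel itself. A
  -- cover of the kernel by at most m lines thus contains this line, and with it the points that
  -- were left out.
  kernel-cover : ∀ {K ls} → KernelFrom 0 K → IsCover m K ls → ∀ {q} → q ∈ P → Any (q on_) ls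
  kernel-cover {K} {ls} k c@(_ , cv) {q} q∈ with sup q∈
  ... | zero , m₀ = cv (light k m₀)
  ... | suc i , m₀ with heavy k i z≤n (λ e → ≢[] e m₀) | Good.heavy G i (λ e → ≢[] e m₀)
  ...   | l , u , e , l⊆ , l⊆K | _ , _ , pr , ons
    with rich-in-cover ls c (rich {m} {K} {L (suc i)} l u (ℕ.≤-reflexive (sym e)) l⊆K (ons ∘ l⊆) pr)
  ...     | ix , f , _ = Any.map (λ { refl → f q (ons m₀) }) (∈-lookup ix)

  module _ {cnt sl pos wh : ℤ → ℤ} (R : Rep cnt sl pos wh bs) where

    kernel-start : KernelFrom m (bs 0 ʳ++ [])
    kernel-start = record
      { unique = unique-ʳ++ (bs 0) (rep-unique R 0) [] (λ _ ())
      ; origin = λ q∈ → inj₁ (only (∈-ʳ++⁻ (bs 0) q∈))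
      ; light = ∈-ʳ++⁺ˡ (bs 0)
      ; heavy = λ i m≤i ne → contradiction (proj₁ (Good.heavy G i ne)) (ℕ.≤⇒≯ m≤i)
      ; small = ℕ.+-monoˡ-≤ (m * suc m)
          (ℕ.≤-trans (ℕ.≤-reflexive (trans (length-ʳ++ (bs 0) {[]}) (ℕ.+-identityʳ _)))
                  (light-bound cov (λ q∈ → sub (0 , q∈)) (Good.light G))) }
      where
      only : ∀ {S : Set} {x : Point} → S ⊎ x ∈ [] → S
      only (inj₁ s) = s

    kernel-skip : ∀ {n K} → bs (suc n) ≡ [] → KernelFrom (suc n) K → KernelFrom n K
    kernel-skip {n} {K} e k = record
      { unique = unique k
      ; origin = λ q∈ → weaken (origin k q∈)
      ; light = light k
      ; heavy = λ i n≤i ne → go i (≤-split n≤i) ne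
      ; small = ℕ.≤-trans (ℕ.+-monoʳ-≤ (length K) (ℕ.*-monoˡ-≤ (suc m) (ℕ.n≤1+n n))) (small k) }
      where
      weaken : ∀ {q} → q ∈ bs 0 ⊎ ∃[ i ] suc n ≤ i × q ∈ bs (suc i) → q ∈ bs 0 ⊎ ∃[ i ] n ≤ i × q ∈ bs (suc i)
      weaken (inj₁ m) = inj₁ m
      weaken (inj₂ (i , lt , m)) = inj₂ (i , ℕ.<⇒≤ lt , m)
      go : ∀ i → n ≡ i ⊎ suc n ≤ i → bs (suc i) ≢ [] → _
      go i (inj₁ refl) ne = contradiction e ne
      go i (inj₂ lt) ne = heavy k i lt ne

    kernel-step : ∀ {n K} l → length l ≡ suc m → (∀ {p k} → At l p k → At (bs (suc n)) p k) →
        KernelFrom (suc n) K → KernelFrom n (l ʳ++ K)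
    kernel-step {n} {K} l e emb k = record
      { unique = unique-ʳ++ l ul (unique k) (λ q∈ q∈K → apart (origin k q∈K) (l⊆ q∈))
      ; origin = λ q∈ → from (∈-ʳ++⁻ l q∈)
      ; light = λ q∈ → ∈-ʳ++⁺ʳ l (light k q∈)
      ; heavy = λ i n≤i ne → go i (≤-split n≤i) ne
      ; small = ℕ.≤-trans (ℕ.≤-reflexive
          (trans (cong (_+ n * suc m) (trans (length-ʳ++ l) (cong (_+ length K) e)))
                  (trans (cong (_+ n * suc m) (ℕ.+-comm (suc m) (length K)))
                      (ℕ.+-assoc (length K) (suc m) (n * suc m))))) (small k) }
      where
      l⊆ : ∀ {q} → q ∈ l → q ∈ bs (suc n)
      l⊆ q∈ = at-∈ (emb (proj₂ (∈-at q∈)))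
      ul : Unique l
      ul = at-unique l (λ a a′ → ℤ.+-injective (trans (sym (Rep.pos-ok R (emb a))) (Rep.pos-ok R (emb a′))))
      apart : ∀ {q} → q ∈ bs 0 ⊎ ∃[ i ] suc n ≤ i × q ∈ bs (suc i) → ¬ q ∈ bs (suc n)
      apart (inj₁ m) m′ with () ← rep-disjoint R m m′
      apart (inj₂ (i , lt , m)) m′ = ℕ.<⇒≢ lt (ℕ.suc-injective (rep-disjoint R m′ m))
      from : ∀ {q} → q ∈ l ⊎ q ∈ K → q ∈ bs 0 ⊎ ∃[ i ] n ≤ i × q ∈ bs (suc i)
      from (inj₁ q∈) = inj₂ (n , ℕ.≤-refl , l⊆ q∈)
      from (inj₂ q∈) with origin k q∈
      ... | inj₁ m = inj₁ m
      ... | inj₂ (i , lt , m) = inj₂ (i , ℕ.<⇒≤ lt , m)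
      go : ∀ i → n ≡ i ⊎ suc n ≤ i → bs (suc i) ≢ [] → ∃[ l′ ] Unique l′ × length l′ ≡ suc m ×
          (∀ {q} → q ∈ l′ → q ∈ bs (suc i)) × (∀ {q} → q ∈ l′ → q ∈ l ʳ++ K)
      go i (inj₁ refl) ne = l , ul , e , l⊆ , ∈-ʳ++⁺ˡ l
      go i (inj₂ lt) ne with heavy k i lt ne
      ... | l′ , u , e′ , f , g = l′ , u , e′ , f , λ q∈ → ∈-ʳ++⁺ʳ l (g q∈)

  kernel-run : ∀ {M} (W μ : Scale) → m * m ≤ size W → m ≤ size μ → suc m * size μ ≤ size W → CoreM m P bs L M →
    Runs kernelᴾ M W (λ M′ → ∃[ K ] StackM M′ K × KernelFrom 0 K)
  kernel-run {M} W μ mm≤W m≤μ mμ≤W core = run-seq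
    (run-block {Q = λ M′ → M′ II 0ℤ ≡ + length (bs 0) × M′ PB 0ℤ ≡ 0ℤ × StackM M′ [] × CoreM m P bs L M′} refl
      (Rep.cnt-ok (proj₁ core) 0 , refl , (refl , λ ()) , core))
    λ _ (ei , eb , st , core) → run-seq
        (copy-run W (bs 0) (proj₁ core) eb ei (λ a → a) st
        (ℕ.≤-trans (light-bound cov (λ q∈ → sub (0 , q∈)) (Good.light G)) mm≤W))
    λ f st → let core = core-frame refl refl f core in run-seq
      (run-block {Q = λ M′ → M′ CC 0ℤ ≡ + m × CoreM m P bs L M′ × Inv m M′} refl
        (proj₁ (proj₂ core) , core , ℕ.≤-refl , bs 0 ʳ++ [] , st , kernel-start (proj₁ core)))
    λ _ (ec , core , inv) → run-mono mμ≤W (run-post (λ _ (_ , x) → x)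
      (run-for {X = scale (suc m) (s≤s z≤n)} μ Inv refl id
          (λ f ec inv → body (core-frame refl refl f core) ec inv) m ec m≤μ inv))
    where
    Inv : ℕ → Memory → Set
    Inv n M = n ≤ m × ∃[ K ] StackM M K × KernelFrom n K
    body : ∀ {n M} → CoreM m P bs L M → M CC 0ℤ ≡ + n → Inv (suc n) M →
        Runs _ M (scale (suc m) (s≤s z≤n)) (Inv n)
    body {n} {M} core@(R , eg , _) ec (n<m , K , st , k) = run-≺
      -- `At` counts from the end of the list, so positions 0 to m of the class are its last m + 1
      -- elements.
      (λ lt → let l , e , emb = suffix (suc m) (bs (suc n)) (proj₁ (proj₂ (Good.heavy G n (nonempty (ℤ.drop‿+<+ (subst (0ℤ ℤ.<_) cnt lt)))))) in run-seq
        (run-block {Q = λ M′ → M′ PB 0ℤ ≡ + suc n × M′ II 0ℤ ≡ + length l × RepM M′ bs × StackM M′ K} refl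
          (cong (ℤ._+_ (+ 1)) ec , trans (cong (ℤ._+_ (+ 1)) eg) (cong +_ (sym e)) , R , st))
        λ _ (eb , ei , R , st) → run-post (λ _ st → ℕ.<⇒≤ n<m , l ʳ++ K , st , kernel-step R l e emb k)
          (copy-run (scale (suc m) (s≤s z≤n)) l R eb ei emb st (ℕ.≤-reflexive e)))
      (λ ¬lt → run-skip (ℕ.<⇒≤ n<m , K , st , kernel-skip R
          (empty (λ lt → ¬lt (subst (0ℤ ℤ.<_) (sym cnt) (ℤ.+<+ lt)))) k))
      where
      cnt : M CNT (+ 1 ℤ.+ M CC 0ℤ) ≡ + length (bs (suc n))
      cnt = trans (cong (λ i → M CNT (+ 1 ℤ.+ i)) ec) (Rep.cnt-ok R (suc n))

-- Writing the answer

listUp : ∀ {A : Set} → (ℕ → A) → ℕ → ℕ → List A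
listUp f n zero    = []
listUp f n (suc c) = f n ∷ listUp f (suc n) c

length-listUp : ∀ {A : Set} (f : ℕ → A) n c → length (listUp f n c) ≡ c
length-listUp f n zero = refl
length-listUp f n (suc c) = cong suc (length-listUp f (suc n) c)

lookup-listUp : ∀ {A : Set} (f : ℕ → A) n c i → lookup (listUp f n c) i ≡ f (n + toℕ i)
lookup-listUp f n (suc c) Fin.zero = cong f (sym (ℕ.+-identityʳ n))
lookup-listUp f n (suc c) (Fin.suc i) = trans (lookup-listUp f (suc n) c i) (cong f (sym (ℕ.+-suc n (toℕ i))))

∈-listUp : ∀ {A : Set} (f : ℕ → A) n c {t} → t < c → f (n + t) ∈ listUp f n c
∈-listUp f n (suc c) {zero} _ = here (cong f (ℕ.+-identityʳ n))
∈-listUp f n (suc c) {suc t} (s≤s lt) = there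
    (subst (λ k → f k ∈ listUp f (suc n) c) (sym (ℕ.+-suc n t)) (∈-listUp f (suc n) c lt))

cell : ∀ c {z t} → z ≡ + t → + c ℤ.+ + 3 ℤ.* z ≡ + (c + 3 * t)
cell c {t = t} refl = cong (ℤ._+_ (+ c)) (sym (ℤ.pos-* 3 t))

Printed : (ℤ → ℤ) → ℕ → Coefs → Set
Printed o t (a , b , c) = o (+ (1 + 3 * t)) ≡ a × o (+ (2 + 3 * t)) ≡ b × o (+ (3 + 3 * t)) ≡ c

print : ∀ o t → ℤ → ℤ → ℤ → ℤ → ℤ
print o t a b c = upd (upd (upd o (+ (1 + 3 * t)) a) (+ (2 + 3 * t)) b) (+ (3 + 3 * t)) c

print-other : ∀ o t {a b c} n → n < 1 + 3 * t ⊎ 3 + 3 * t < n → print o t a b c (+ n) ≡ o (+ n)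
print-other o t {a} {b} {c} n h = trans (upd-other o₂ {+ (3 + 3 * t)} {c} (ne 3 (s≤s z≤n) ℕ.≤-refl))
  (trans (upd-other o₁ {+ (2 + 3 * t)} {b} (ne 2 (s≤s z≤n) (s≤s (s≤s z≤n))))
      (upd-other o {+ (1 + 3 * t)} {a} (ne 1 (s≤s z≤n) (s≤s z≤n))))
  where
  o₁ = upd o (+ (1 + 3 * t)) a
  o₂ = upd o₁ (+ (2 + 3 * t)) b
  ne : ∀ c → 1 ≤ c → c ≤ 3 → + n ≢ + (c + 3 * t)
  ne c 1≤c c≤3 e = go h
    where
    go : _ → _
    go (inj₁ lt) = ℕ.<⇒≢ (ℕ.<-≤-trans lt (ℕ.+-monoˡ-≤ (3 * t) 1≤c)) (ℤ.+-injective e)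
    go (inj₂ lt) = ℕ.<⇒≢ (ℕ.≤-<-trans (ℕ.+-monoˡ-≤ (3 * t) c≤3) lt) (sym (ℤ.+-injective e))

print-same : ∀ o t {a b c} → Printed (print o t a b c) t (a , b , c)
print-same o t {a} {b} {c} =
  trans (upd-other o₂ {i₃} {c} (ne 1 3 λ ()))
      (trans (upd-other o₁ {i₂} {b} (ne 1 2 λ ())) (upd-same o {i₁} {a} refl)) ,
  trans (upd-other o₂ {i₃} {c} (ne 2 3 λ ())) (upd-same o₁ {i₂} {b} refl) ,
  upd-same o₂ {i₃} {c} refl
  where
  i₁ = + (1 + 3 * t)
  i₂ = + (2 + 3 * t)
  i₃ = + (3 + 3 * t)
  o₁ = upd o i₁ a
  o₂ = upd o₁ i₂ b
  ne : ∀ c c′ → c ≢ c′ → + (c + 3 * t) ≢ + (c′ + 3 * t)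
  ne c c′ neq e = neq (ℕ.+-cancelʳ-≡ (3 * t) c c′ (ℤ.+-injective e))

printed-cong : ∀ {o o′ t cs} → (∀ i → o′ i ≡ o i) → Printed o t cs → Printed o′ t cs
printed-cong h (x , y , z) = trans (h _) x , trans (h _) y , trans (h _) z

print-≡ : ∀ o {t a b c i₁ i₂ i₃} → i₁ ≡ + (1 + 3 * t) → i₂ ≡ + (2 + 3 * t) → i₃ ≡ + (3 + 3 * t) →
  ∀ n → upd (upd (upd o i₁ a) i₂ b) i₃ c n ≡ print o t a b c n
print-≡ o refl refl refl n = refl

module Answer {j : ℕ} (s : Slots) where

  PrintedFrom : ℕ → (ℤ → ℤ) → Set
  PrintedFrom n o = o 0ℤ ≡ + j × (∀ {t} → n ≤ t → t < j → Printed o t (coefs (s t)))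

  printed-step : ∀ o {n a b c} → coefs (s n) ≡ (a , b , c) → PrintedFrom (suc n) o →
      PrintedFrom n (print o n a b c)
  printed-step o {n} {a} {b} {c} e (e₀ , pr) = trans (print-other o n {a} {b} {c} 0 (inj₁ (s≤s z≤n))) e₀ ,
      λ n≤t → go (≤-split n≤t)
    where
    go : ∀ {t} → n ≡ t ⊎ suc n ≤ t → t < j → Printed (print o n a b c) t (coefs (s t))
    go (inj₁ refl) _ = subst (Printed (print o n a b c) n) (sym e) (print-same o n)
    go {t} (inj₂ lt) t<j with pr lt t<j
    ... | x , y , z = trans (print-other o n _ (inj₂ (far 1 (s≤s z≤n)))) x ,
        trans (print-other o n _ (inj₂ (far 2 (s≤s z≤n)))) y ,
                      trans (print-other o n _ (inj₂ (far 3 (s≤s z≤n)))) z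
      where
      far : ∀ c → 1 ≤ c → 3 + 3 * n < c + 3 * t
      far c 1≤c = ℕ.<-≤-trans (s≤s (ℕ.≤-trans (ℕ.≤-reflexive (sym (ℕ.*-suc 3 n))) (ℕ.*-monoʳ-≤ 3 lt)))
          (ℕ.+-monoˡ-≤ (3 * t) 1≤c)

  answer-run : ∀ {M} (J : Scale) → j ≤ size J → M JJ 0ℤ ≡ + j → M FND 0ℤ ≡ + 1 → SlotsM j M s →
      Runs answerᴾ M J (λ M′ → PrintedFrom 0 (M′ out))
  answer-run {M} J j≤J ej ef sm = run-≐ (λ e → contradiction (trans (sym ef) e) λ ())
    λ _ → run-seq
      (run-block {Q = λ M′ → M′ TT 0ℤ ≡ + j × PrintedFrom j (M′ out) × SlotsM j M′ s} refl
        (ej , (ej , λ j≤t t<j → contradiction t<j (ℕ.≤⇒≯ j≤t)) , sm))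
    λ _ (et , pr , sm) → run-post (λ _ (_ , pr) → pr)
        (run-for₁ J (λ n M → n ≤ j × PrintedFrom n (M out)) refl id
      (λ {n} {M} f et (n<j , pr) → run-block refl (ℕ.<⇒≤ n<j ,
         printed-≡ (print-≡ (M out) {n} (cell 1 et) (cell 2 et) (cell 3 et))
             (printed-step (M out) (row {n} {M} et (slots-frame refl f sm n<j)) pr)))
      j et j≤J (ℕ.≤-refl , pr))
    where
    printed-≡ : ∀ {n o o′} → (∀ i → o′ i ≡ o i) → PrintedFrom n o → PrintedFrom n o′
    printed-≡ h (e₀ , pr) = trans (h _) e₀ , λ {t} n≤t t<j → printed-cong {t = t} h (pr n≤t t<j)
    row : ∀ {n} {M : Memory} → M TT 0ℤ ≡ + n → SlotM (M SC) (M SP) (M SA) (M SB) (M SX) n (s n) →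
        coefs (s n) ≡ (M SA (M TT 0ℤ) , M SB (M TT 0ℤ) , M SX (M TT 0ℤ))
    row {n} {M} et (slotM _ ea eb ex _) rewrite et = cong₂ _,_ (sym ea) (cong₂ _,_ (sym eb) (sym ex))

  lines : (∀ t → Sane (s t)) → List Line
  lines sn = listUp (λ t → toLine (coefs (s t)) (sane-proper (sn t))) 0 j

  lines-written : ∀ {M} (sn : ∀ t → Sane (s t)) → PrintedFrom 0 (M out) → Writes M (lines sn)
  lines-written {M} sn (e₀ , pr) = trans e₀ (cong +_ (sym (length-listUp f 0 j))) , w
    where
    f : ℕ → Line
    f t = toLine (coefs (s t)) (sane-proper (sn t))
    w : ∀ (i : Fin (length (lines sn))) → Line.a (lookup (lines sn) i) ≡ ι (M out (+ (1 + 3 * toℕ i)))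
      × Line.b (lookup (lines sn) i) ≡ ι (M out (+ (2 + 3 * toℕ i))) × Line.c (lookup (lines sn) i) ≡ ι
          (M out (+ (3 + 3 * toℕ i)))
    w i rewrite lookup-listUp f 0 j i with pr {toℕ i} z≤n (subst (toℕ i <_) (length-listUp f 0 j) (Fin.toℕ<n i))
    ... | x , y , z = cong ι (sym x) , cong ι (sym y) , cong ι (sym z)

-- Correctness of a query

nth : List Line → ℕ → Line
nth [] _ = line 0ℚ 1ℚ 0ℚ λ { (_ , ()) }
nth (ℓ ∷ ls) zero = ℓ
nth (ℓ ∷ ls) (suc t) = nth ls t

any-nth : ∀ {q} ls → Any (q on_) ls → ∃[ t ] t < length ls × q on nth ls t
any-nth (ℓ ∷ ls) (here o) = 0 , s≤s z≤n , o
any-nth (ℓ ∷ ls) (there a) with any-nth ls a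
... | t , lt , o = suc t , s≤s lt , o

cover-min : ∀ {k m P} → CoverableBy k P → CoverableBy m P → CoverableBy (k ⊓ m) P
cover-min {k} {m} {P} (ls , le , c) (ls′ , le′ , c′) with ℕ.≤-total k m
... | inj₁ k≤m = ls , subst (length ls ≤_) (sym (ℕ.m≤n⇒m⊓n≡m k≤m)) le , c
... | inj₂ m≤k = ls′ , subst (length ls′ ≤_) (sym (ℕ.m≥n⇒m⊓n≡n m≤k)) le′ , c′

module Query {k m : ℕ} {P : PointSet} (cov : CoverableBy m P) (μ : Scale) (m≤μ : m ≤ size μ) where

  j : ℕ
  j = k ⊓ m

  -- Bucket 0 contributes at most m² points and the classes at most m (m + 1), where m + 1 is at
  -- most twice `size μ`, a number that is positive even if m is 0.
  KS NS : Scale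
  KS = scale (3 * (size μ * size μ)) (ℕ.≤-trans (ℕ.*-mono-≤ (pos μ) (pos μ)) (ℕ.m≤n*m (size μ * size μ) 3))
  NS = scale (choices j) (choices-pos j)

  j≤μ : j ≤ size μ
  j≤μ = ℕ.≤-trans (ℕ.m⊓n≤n k m) m≤μ

  μ≤ : size μ ≤ size (μ · KS · NS)
  μ≤ = ℕ.≤-trans (≤-scale (size μ) KS) (≤-scale (size (μ · KS)) NS)

  KS≤ : size KS ≤ size (μ · KS · NS)
  KS≤ = ℕ.≤-trans (≤-scale (size KS) μ)
      (ℕ.≤-trans (ℕ.≤-reflexive (ℕ.*-comm (size KS) (size μ))) (≤-scale (size (μ · KS)) NS))

  mm≤ : m * m ≤ size μ * size μ
  mm≤ = ℕ.*-mono-≤ m≤μ m≤μ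

  sm≤ : suc m ≤ 2 * size μ
  sm≤ = ℕ.+-mono-≤ (pos μ) (ℕ.≤-trans m≤μ (ℕ.m≤m+n (size μ) 0))

  query-run : ∀ {M} → StateM m P M → M JJ 0ℤ ≡ + j → M LL 0ℤ ≡ + choices j →
    Runs queryᴾ M (μ · KS · NS) (λ M′ → StateM m P M′ × CorrectAnswer k P M′)
  query-run {M} st@(bs , L , core , G , sub , sup) ej el = run-post
    (λ f ans → (bs , L , core-frame refl refl f core , G , sub , sup) , ans)
    (run-seq (kernel-run (μ · KS · NS) μ (ℕ.≤-trans mm≤ (ℕ.≤-trans (ℕ.m≤n*m _ 3) KS≤)) m≤μ
        (ℕ.≤-trans (ℕ.*-monoˡ-≤ (size μ) sm≤)
            (ℕ.≤-trans (ℕ.≤-reflexive (ℕ.*-assoc 2 (size μ) (size μ)))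
            (ℕ.≤-trans (ℕ.*-monoˡ-≤ (size μ * size μ) (ℕ.n≤1+n 2)) KS≤))) core)
      λ {M₁} f (K , st , k) → let open Trial {P} {j} {K} (kernel-sub k) μ j≤μ in
        run-seq (search-run KS (k-small k) {M₁} NS ℕ.≤-refl
                   (trans (same f JJ refl 0ℤ) ej , proj₂ (proj₂ (proj₂ (core-frame refl refl f core))) , st)
                       (trans (same f LL refl 0ℤ) el))
      λ { {M₂} f′ (inj₁ (ef , s , w , sm , e)) → run-post (λ {M₃} _ pr → inj₁ (positive k s w e M₃ pr))
            (run-mono μ≤ (Answer.answer-run s μ j≤μ (trans (same f′ JJ refl 0ℤ) (trans (same f JJ refl 0ℤ) ej))
                ef sm))
        ; {M₂} f′ (inj₂ (ef , none)) → run-≐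
            (λ _ → run-block refl (inj₂ (refl , negative k none)))
            (λ ne → contradiction ef ne) })
    where
    open Kernel G cov sub sup
    k-small : ∀ {K} → KernelFrom 0 K → length K ≤ size KS
    k-small {K} k = ℕ.≤-trans (ℕ.≤-trans (ℕ.m≤m+n (length K) 0) (KernelFrom.small k))
        (ℕ.≤-trans (ℕ.+-mono-≤ mm≤ (ℕ.*-mono-≤ m≤μ sm≤))
      (ℕ.≤-reflexive (solve 1 (λ x → x :* x :+ x :* (con 2 :* x) := con 3 :* (x :* x)) refl (size μ))))
      where open +-*-Solver
    -- The number j of lines is at most k, as the answer demands, and at most m, as `kernel-cover`
    -- demands.
    positive : ∀ {K} → KernelFrom 0 K → ∀ s w → search j K (λ _ → free) (w * j) ≡ just s → ∀ M₃ →
        Answer.PrintedFrom {j} s 0 (M₃ out) →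
      ∃[ ls ] Writes M₃ ls × IsCover k P ls
    positive {K} k₀ s w e M₃ pr with search-sound j K (λ _ → free) (w * j) (KernelFrom.unique k₀) (λ ())
        (λ _ → free) e
    ... | sn , _ , held = ls , Answer.lines-written s {M₃} sn pr , subst (_≤ k) (sym len) (ℕ.m⊓n≤m k m) ,
          kernel-cover k₀ (subst (_≤ m) (sym len) (ℕ.m⊓n≤n k m) , λ q∈ → hit (held q∈))
      where
      ls = Answer.lines {j} s sn
      f = λ t → toLine (coefs (s t)) (sane-proper (sn t))
      len : length ls ≡ j
      len = length-listUp f 0 j
      hit : ∀ {q} → Held j s q → Any (q on_) ls
      hit {q} (t , t<j , h) = Any.map (λ { refl → onᶻ⇒on (coefs (s t)) {sane-proper (sn t)} (holds-on h) })
          (∈-listUp f 0 j t<j)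
    -- A cover by k lines and the promised one by m lines give one by j lines. It covers the kernel
    -- as well, so one of the trials would have succeeded.
    negative : ∀ {K} → KernelFrom 0 K →
        (∀ {w} → 0 ≤ w → w < choices j → search j K (λ _ → free) (w * j) ≡ nothing) → ¬ CoverableBy k P
    negative {K} k₀ none ck with cover-min ck cov
    ... | ls , le , c with search-exists j (nth ls) K (KernelFrom.unique k₀)
            (λ q∈ → let t , lt , o = any-nth ls (c (kernel-sub k₀ q∈)) in t , ℕ.<-≤-trans lt le , o)
    ...   | w , w< , s , e with () ← trans (sym (none z≤n w<)) e

-- Initialisation

paramᴾ : Program
paramᴾ =
  (GG ≔ $ (base + out)) ⨾
  when inp [ zer ] ≺ $ GG then JJ ≔ inp [ zer ] else JJ ≔ $ GG end ⨾
  when zer ≺ $ JJ then ((LL ≔ $ JJ) ⨾ (II ≔ $ JJ ⊖ uno)) ⨾ for II (LL ≔ $ LL ⊗ ($ JJ ⊗ $ JJ)) else LL ≔ uno end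

initᴾ : Program → Program
initᴾ p = ((base + inp) [ zer ]≔ inp [ zer ]) ⨾ shift p ⨾ paramᴾ

algorithm : Program → DynamicAlgorithm
algorithm p .onInit   = initᴾ p
algorithm p .onInsert = insertᴾ
algorithm p .onDelete = deleteᴾ
algorithm p .onQuery  = queryᴾ

FullM : ℕ → ℕ → PointSet → Memory → Set
FullM k m P M = StateM m P M × M JJ 0ℤ ≡ + (k ⊓ m) × M LL 0ℤ ≡ + choices (k ⊓ m)

-- One factor j and j - 1 factors j² make j^(2j - 1), so a loop over j - 1 steps suffices.
choices-run : ∀ {M j} (Y : Scale) → j ≤ size Y → M JJ 0ℤ ≡ + j →
  Runs (when zer ≺ $ JJ then ((LL ≔ $ JJ) ⨾ (II ≔ $ JJ ⊖ uno)) ⨾ for II (LL ≔ $ LL ⊗ ($ JJ ⊗ $ JJ)) else LL ≔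
      uno end) M Y
    (λ M′ → M′ LL 0ℤ ≡ + choices j)
choices-run {M} {zero} Y le ej = run-≺ (λ lt → contradiction (subst (0ℤ ℤ.<_) ej lt) (ℤ.<-irrefl refl))
    (λ _ → run-block refl refl)
choices-run {M} {suc j} Y le ej = run-≺
  (λ _ → run-seq
    (run-block {Q = λ M′ → M′ II 0ℤ ≡ + j × M′ LL 0ℤ ≡ + (suc j ^ 1) × M′ JJ 0ℤ ≡ + suc j} refl
      (cong (ℤ._- + 1) ej , trans ej (cong +_ (sym (ℕ.*-identityʳ (suc j)))) , ej))
    λ _ (ei , el , ej) → run-post (λ { _ (i , e , el) → trans el (cong (λ c → + (suc j ^ c)) (last i e)) })
      (run-for₁ Y (λ n M → ∃[ i ] i + n ≡ j × M LL 0ℤ ≡ + (suc j ^ (1 + 2 * i))) refl id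
        (λ {n} f _ (i , e , el) → run-block refl (suc i , trans (sym (ℕ.+-suc i n)) e ,
           trans (cong₂ ℤ._*_ el (trans (cong₂ ℤ._*_ (trans (same f JJ refl 0ℤ) ej)
               (trans (same f JJ refl 0ℤ) ej)) (sym (ℤ.pos-* (suc j) (suc j)))))
             (trans (sym (ℤ.pos-* (suc j ^ (1 + 2 * i)) (suc j * suc j))) (cong +_ (power (suc j) i)))))
        j ei (ℕ.<⇒≤ le) (0 , refl , el)))
  (λ ¬lt → contradiction (subst (0ℤ ℤ.<_) (sym ej) (ℤ.+<+ (s≤s z≤n))) ¬lt)
  where
  open +-*-Solver
  power : ∀ x i → x ^ (1 + 2 * i) * (x * x) ≡ x ^ (1 + 2 * suc i)
  power x i = trans (solve 2 (λ y x → y :* (x :* x) := x :* (x :* y)) refl (x ^ (1 + 2 * i)) x)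
      (cong (x ^_) (cong suc (sym (ℕ.*-suc 2 i))))
  last : ∀ i → i + 0 ≡ j → 1 + 2 * i ≡ 2 * suc j ∸ 1
  last i e rewrite trans (sym (ℕ.+-identityʳ i)) e = sym (ℕ.+-suc j (j + 0))

-- Zeros in `CNT` and `WH` encode empty buckets and absent points; those in `LA`, `LB` and `LC` are
-- the initial coefficients. The slope table is reset before each use.
zeroArrays : List Array
zeroArrays = CNT ∷ WH ∷ LA ∷ LB ∷ LC ∷ []

Zeros : Memory → Set
Zeros M = ∀ {A} → A ∈ zeroArrays → ∀ i → M A i ≡ 0ℤ

zeros-frame : ∀ {p M M′} → sparing zeroArrays p ≡ true → Frame p M M′ → Zeros M → Zeros M′
zeros-frame sp f z m i = trans (kept zeroArrays sp f m i) (z m i)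

empty-state : ∀ {m M} → M GG 0ℤ ≡ + m → Zeros M → StateM m [] M
empty-state eg z = (λ _ → []) , (λ _ → 0ℤ , 0ℤ , 0ℤ) ,
  ( rep (λ _ → z (here refl) _) (λ ()) (λ ()) (λ ()) (λ _ → inj₁ (z (there (here refl)) _)) , eg
  , (λ _ → z (there (there (here refl))) _ , z (there (there (there (here refl)))) _ ,
      z (there (there (there (there (here refl))))) _) , λ () ) ,
  good (λ _ ne → contradiction refl ne) (λ _ ne _ → contradiction refl ne) (λ _ → z≤n) , (λ { (_ , ()) }) , λ ()

param-run : ∀ {N k m} → N (base + out) 0ℤ ≡ + m → N inp 0ℤ ≡ + k → Zeros N →
  Runs paramᴾ N (scale (suc (k ⊓ m)) (s≤s z≤n)) (FullM k m [])
param-run {N} {k} {m} em ek z = run-seq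
  (run-block {Q = λ M′ → M′ GG 0ℤ ≡ + m × M′ inp 0ℤ ≡ + k} refl (em , ek))
  λ f (eg , ek) → run-seq {R = FullM k m []} (run-≺ {Q = λ M′ → M′ JJ 0ℤ ≡ + (k ⊓ m)}
    (λ lt → run-block refl (trans ek
        (cong +_ (sym (ℕ.m≤n⇒m⊓n≡m (ℕ.<⇒≤ (ℤ.drop‿+<+ (subst₂ ℤ._<_ ek eg lt))))))))
    (λ ¬lt → run-block refl (trans eg
        (cong +_ (sym (ℕ.m≥n⇒m⊓n≡n (ℕ.≮⇒≥ λ lt → ¬lt (subst₂ ℤ._<_ (sym ek) (sym eg) (ℤ.+<+ lt)))))))))
  λ f′ ej → run-post
    (λ {M′} f″ el → empty-state {m} {M′} (trans (same f″ GG refl 0ℤ) (trans (same f′ GG refl 0ℤ) eg))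
        (zeros-frame refl f″ (zeros-frame refl f′ (zeros-frame refl f z))) ,
       trans (same f″ JJ refl 0ℤ) ej , el)
    (choices-run _ (ℕ.n≤1+n _) ej)

shifted : ℕ → Memory
shifted k = exec ((base + inp) [ zer ]≔ inp [ zer ]) (loadℕ k blank)

shifted-zeros : ∀ {p k N} → Frame (shift p) (shifted k) N → Zeros N
shifted-zeros {p} {k} {N} f = go
  where
  old : ∀ A → A < base → ∀ i → N A i ≡ shifted k A i
  old A lt = same f A (shift-writes p lt)
  go : Zeros N
  go (here refl) = old CNT (ℕ.<ᵇ⇒< CNT base tt)
  go (there (here refl)) = old WH (ℕ.<ᵇ⇒< WH base tt)
  go (there (there (here refl))) = old LA (ℕ.<ᵇ⇒< LA base tt)
  go (there (there (there (here refl)))) = old LB (ℕ.<ᵇ⇒< LB base tt)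
  go (there (there (there (there (here refl))))) = old LC (ℕ.<ᵇ⇒< LC base tt)

Halts : Program → Memory → (Memory → Set) → Set
Halts p M Q = ∃[ M′ ] ∃[ t ] (⟨ p , M ⟩⇓⟨ M′ , t ⟩) × Q M′

halts-seq : ∀ {p q M M′ s} {Q : Memory → Set} → ⟨ p , M ⟩⇓⟨ M′ , s ⟩ → Halts q M′ Q → Halts (p ⨾ q) M Q
halts-seq d (M″ , t , e , q) = M″ , _ , ⇓-seq d e , q

halts-runs : ∀ {p M X} {Q : Memory → Set} → Runs p M X Q → Halts p M Q
halts-runs (runs {M′} {t} d _ q) = M′ , t , d , q

init-run : ∀ {p k m M t} → ⟨ p , loadℕ k blank ⟩⇓⟨ M , t ⟩ → M out 0ℤ ≡ + m →
    Halts (initᴾ p) (loadℕ k blank) (FullM k m [])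
init-run {p} {k} {m} d e = halts-seq ⇓-assign (go (shift-run {N = shifted k} d (shadow λ A i → refl)))
  where
  go : ∃[ N ] ∃[ t ] (⟨ shift p , shifted k ⟩⇓⟨ N , t ⟩) × Shadow _ N →
      Halts (shift p ⨾ paramᴾ) (shifted k) (FullM k m [])
  go (N , t , d′ , sh) = halts-seq d′ (halts-runs (param-run {N} {k} {m} (trans (Shadow.at sh out 0ℤ) e)
    (same (frame d′) inp (shift-writes p (ℕ.<ᵇ⇒< inp base tt)) 0ℤ) (shifted-zeros {p} {k} (frame d′))))

-- Time bounds and the theorem

module _ {t C a b c : ℕ} (C-def : C ≡ a + b + 3 * c) where

  square-bound : ∀ {m x} → m ≤ x → t ≤ a * (m * m) → t ≤ C * x ^ 2
  square-bound {m} {x} m≤x le = ℕ.≤-trans le (ℕ.*-mono-≤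
    (subst (a ≤_) (sym C-def) (ℕ.≤-trans (ℕ.m≤m+n a b) (ℕ.m≤m+n (a + b) (3 * c))))
    (ℕ.*-mono-≤ m≤x (ℕ.≤-trans m≤x (ℕ.≤-reflexive (sym (ℕ.*-identityʳ x))))))

  cube-bound : ∀ {x} → t ≤ b * (x * x * x) → t ≤ C * x ^ 3
  cube-bound {x} le = ℕ.≤-trans le (ℕ.*-mono-≤
    (subst (b ≤_) (sym C-def) (ℕ.≤-trans (ℕ.m≤n+m b a) (ℕ.m≤m+n (a + b) (3 * c))))
    (ℕ.≤-reflexive (solve 1 (λ x → x :* x :* x := x :* (x :* (x :* con 1))) refl x)))
    where open +-*-Solver

  -- The factors are x for the slots, 3x² for the kernel and x^(2x - 1) for the trials, and (2x - 1)
  -- + 3 is exactly 2x + 2. By 1 ≤ x the truncated subtraction is a true one.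
  power-bound : ∀ {x n} → 1 ≤ x → n ≤ x ^ (2 * x ∸ 1) → t ≤ c * (x * (3 * (x * x)) * n) →
      t ≤ C * x ^ (2 * x + 2)
  power-bound {x} {n} 1≤x n≤ le = begin
    t                                ≤⟨ le ⟩
    c * (x * (3 * (x * x)) * n)      ≤⟨ ℕ.*-monoʳ-≤ c (ℕ.*-monoʳ-≤ (x * (3 * (x * x))) n≤) ⟩
    c * (x * (3 * (x * x)) * y)      ≡⟨ solve 3 (λ c x y → c :* (x :* (con 3 :* (x :* x)) :* y) :=
                                          (con 3 :* c) :* (y :* (x :* (x :* (x :* con 1))))) refl c x y ⟩
    (3 * c) * (y * x ^ 3)            ≡⟨ cong ((3 * c) *_)
        (trans (sym (ℕ.^-distribˡ-+-* x (2 * x ∸ 1) 3)) (cong (x ^_) e)) ⟩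
    (3 * c) * x ^ (2 * x + 2)        ≤⟨ ℕ.*-monoˡ-≤ (x ^ (2 * x + 2))
        (subst (3 * c ≤_) (sym C-def) (ℕ.m≤n+m (3 * c) (a + b))) ⟩
    C * x ^ (2 * x + 2)              ∎
    where
    open ℕ.≤-Reasoning
    open +-*-Solver
    y = x ^ (2 * x ∸ 1)
    e : 2 * x ∸ 1 + 3 ≡ 2 * x + 2
    e = trans (sym (ℕ.+-assoc (2 * x ∸ 1) 1 2)) (cong (_+ 2) (ℕ.m∸n+n≡m (ℕ.≤-trans 1≤x (ℕ.m≤n*m x 2))))

-- Abstract: as numerals, these weights would be unfolded in every product.
abstract
  insert-weight delete-weight query-weight : ℕ
  insert-weight = weight insertᴾ
  delete-weight = weight deleteᴾ
  query-weight  = weight queryᴾ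

  insert-weight-def : weight insertᴾ ≡ insert-weight
  insert-weight-def = refl

  delete-weight-def : weight deleteᴾ ≡ delete-weight
  delete-weight-def = refl

  query-weight-def : weight queryᴾ ≡ query-weight
  query-weight-def = refl

-- A sum, so that it dominates the constants of all three operations; the factor 3 comes from the
-- size of the kernel. It depends on three fixed program texts only, hence neither on k nor on g.
constant : ℕ
constant = insert-weight + delete-weight + 3 * query-weight

module Serve {k m : ℕ} where

  μ : Scale
  μ = scale (1 ⊔ m) (ℕ.m≤m⊔n 1 m)

  limit : Operation → ℕ
  limit o = constant * boundFor (λ m → m ^ 2) (λ m → m ^ 3) (λ m → m ^ (2 * m + 2)) o (1 ⊔ m)

  m≤μ : m ≤ size μ
  m≤μ = ℕ.m≤n⊔m 1 m

  choices-≤ : choices (k ⊓ m) ≤ size μ ^ (2 * size μ ∸ 1)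
  choices-≤ = ℕ.≤-trans (ℕ.^-monoˡ-≤ (2 * (k ⊓ m) ∸ 1) j≤μ)
      (ℕ.^-monoʳ-≤ (size μ) {{ℕ.>-nonZero (pos μ)}} (ℕ.∸-monoˡ-≤ 1 (ℕ.*-monoʳ-≤ 2 j≤μ)))
    where
    j≤μ : k ⊓ m ≤ size μ
    j≤μ = ℕ.≤-trans (ℕ.m⊓n≤n k m) m≤μ

  now : ∀ {P} os → AlwaysCoverableBy m P os → CoverableBy m P
  now [] c = c
  now (o ∷ os) (c , _) = c

  module _ (p : Program) where

    serve : ∀ {o os P M X Q} w n → weight (programFor (algorithm p) o) ≡ w → size X ≡ n →
        (∀ {t} → t ≤ w * n → t ≤ limit o) →
      Runs (programFor (algorithm p) o) (load o M) X Q →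
      (∀ {M′} → Frame (programFor (algorithm p) o) (load o M) M′ → Q M′ →
         Correct k o P M′ × Serves (algorithm p) k limit M′ (after o P) os) →
      Serves (algorithm p) k limit M P (o ∷ os)
    serve w n refl refl bound (runs {M′} {t} d le q) rest = M′ , t , d , bound le , rest (frame d) q

    parameters : ∀ {o M M′} → writes (programFor (algorithm p) o) JJ ≡ false →
        writes (programFor (algorithm p) o) LL ≡ false →
      Frame (programFor (algorithm p) o) (load o M) M′ →
          load o M JJ 0ℤ ≡ + (k ⊓ m) × load o M LL 0ℤ ≡ + choices (k ⊓ m) →
      M′ JJ 0ℤ ≡ + (k ⊓ m) × M′ LL 0ℤ ≡ + choices (k ⊓ m)
    parameters w w′ f (ej , el) = trans (same f JJ w 0ℤ) ej , trans (same f LL w′ 0ℤ) el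

    serves : ∀ os {P M} → FullM k m P M → AlwaysCoverableBy m P os → Serves (algorithm p) k limit M P os
    serves [] full cov = tt
    serves (ins x ∷ os) {P} {M} (st , ps) (_ , cov) =
      serve {ins x} {os} {P} {M} insert-weight (m * m) insert-weight-def refl
          (square-bound {a = insert-weight} {delete-weight} {query-weight} refl m≤μ)
          (insert-run {m} {P} {x} {M} (now os cov) st)
        λ {M′} f st′ → tt , serves os (st′ , parameters {ins x} {M} {M′} refl refl f ps) cov
    serves (del x ∷ os) {P} {M} (st , ps) (c , cov) =
      serve {del x} {os} {P} {M} delete-weight (size (μ · μ · μ)) delete-weight-def refl
          (cube-bound {a = insert-weight} {delete-weight} {query-weight} refl {size μ})
        (Delete.delete-run {m} {P} {x} c (μ · μ · μ) (ℕ.*-mono-≤ (ℕ.*-mono-≤ m≤μ m≤μ) m≤μ) {M} st)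
        λ {M′} f st′ → tt , serves os (st′ , parameters {del x} {M} {M′} refl refl f ps) cov
    serves (query ∷ os) {P} {M} (st , ps) (c , cov) =
      serve {query} {os} {P} {M} query-weight _ query-weight-def refl
          (power-bound {a = insert-weight} {delete-weight} {query-weight} refl (pos μ) choices-≤)
        (Query.query-run {k} {m} {P} c μ m≤μ {M} st (proj₁ ps) (proj₂ ps))
        λ {M′} f (st′ , ans) → ans , serves os (st′ , parameters {query} {M} {M′} refl refl f ps) cov

theorem4 : (g : ℕ → ℕ) → Computable g → Σ DynamicAlgorithm λ 𝒜 →
    SolvesPointLineCover 𝒜 g (λ m → m ^ 2) (λ m → m ^ 3) (λ m → m ^ (2 * m + 2))
theorem4 g (p , computes) = algorithm p , constant , λ k →
  let M , t , d , e    = computes k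
      M₀ , t₀ , d₀ , full = init-run {p} {k} {g k} d e
  in M₀ , t₀ , d₀ , λ os cov → Serve.serves {k} {g k} p os full cov
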